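{- $K_{1,3}$ is the only unweighted tree with no degree-two vertex that admits $\epsilon$-uniform mixing relative to the adjacency matrix.
   Context: Trees are finite; unweighted means all edges have weight $1$. $K_{1,3}$ is the star on four vertices. For a graph on $n$ vertices with adjacency matrix $A$, put $U(t)=e^{\mathrm{i}tA}$; $\mathbf{e}_u$ is the characteristic vector of $u$, $\mathbf{1}$ the all-ones vector, $\circ$ the entrywise product. $\epsilon$-uniform mixing occurs if for each $\epsilon>0$ there is a $\tau\in\mathbb{R}$ such that $\big\|(U(\tau)\mathbf{e}_u)\circ(\overline{U(\tau)}\mathbf{e}_u)-\tfrac1n\mathbf{1}\big\|<\epsilon$ simultaneously for all vertices $u$.
   Formalization: The formal theorem is for trees on at least three vertices: the one-vertex tree and the single edge K_2 also have no degree-two vertex and admit uniform mixing (K_2 at time π/4), so the sentence taken literally is false for them. -}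

module Defs where

open import Data.Bool.Base using (Bool; true; false; if_then_else_)
open import Data.Fin.Base as Fin using (Fin)
import Data.Fin.Properties as Fin
open import Data.Fin.Subset using () renaming (∣_∣ to ∣_∣ˢ)
open import Data.Integer.Base as ℤ using (+_; +[1+_]; -[1+_])
import Data.Integer.Properties as ℤ
open import Data.Nat.Base as ℕ using (ℕ; zero; suc)
import Data.Nat.Properties as ℕ
open import Data.Product.Base using (Σ-syntax; ∃-syntax; _×_; _,_; proj₁; proj₂)
open import Data.Rational.Base
open import Data.Rational.Literals using (fromℤ)
open import Data.Rational.Properties
open import Data.Rational.Solver using (module +-*-Solver)
import Data.Rational.Unnormalised.Base as ℚᵘ
import Data.Rational.Unnormalised.Properties as ℚᵘ
open import Data.Sum.Base using (inj₁; inj₂)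
open import Data.Vec.Base using (tabulate)
open import Data.Vec.Functional using (Vector; foldr)
open import Function.Bundles using (_↔_; Inverse)
open import Function.Definitions using (Injective)
open import Relation.Binary.Construct.Closure.ReflexiveTransitive using (Star)
open import Relation.Binary.PropositionalEquality
  using (_≡_; _≢_; refl; sym; trans; cong; cong₂; subst)
open import Relation.Nullary.Decidable.Core using (Dec; yes; no; does)
open import Relation.Nullary.Negation.Core using (¬_; contradiction)
open +-*-Solver

fromℕ : ℕ → ℚ
fromℕ n = fromℤ (+ n)

1/1+ : ℕ → ℚ
1/1+ n = 1/ fromℕ (suc n)

1/_! : ℕ → ℚ
1/ zero  ! = 1ℚ
1/ suc k ! = 1/ k ! * 1/1+ k

abstract
  ≤-by : ∀ {p q} r → 0ℚ ≤ r → p + r ≡ q → p ≤ q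
  ≤-by {p} r 0≤r refl = subst (_≤ p + r) (+-identityʳ p) (+-monoʳ-≤ p 0≤r)

  *-nonNeg : ∀ {p q} → 0ℚ ≤ p → 0ℚ ≤ q → 0ℚ ≤ p * q
  *-nonNeg {p} {q} 0≤p 0≤q =
    subst (_≤ p * q) (*-zeroʳ p) (*-monoˡ-≤-nonNeg p {{nonNegative 0≤p}} 0≤q)

  *-pos : ∀ {p q} → 0ℚ < p → 0ℚ < q → 0ℚ < p * q
  *-pos {p} {q} 0<p 0<q =
    subst (_< p * q) (*-zeroʳ p) (*-monoʳ-<-pos p {{positive 0<p}} 0<q)

  *-mono-nonNeg : ∀ {p q r s} → 0ℚ ≤ r → 0ℚ ≤ q → p ≤ q → r ≤ s → p * r ≤ q * s
  *-mono-nonNeg {p} {q} {r} {s} 0≤r 0≤q p≤q r≤s = ≤-trans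
    (*-monoʳ-≤-nonNeg r {{nonNegative 0≤r}} p≤q)
    (*-monoˡ-≤-nonNeg q {{nonNegative 0≤q}} r≤s)

  +-nonNeg : ∀ {p q} → 0ℚ ≤ p → 0ℚ ≤ q → 0ℚ ≤ p + q
  +-nonNeg 0≤p 0≤q = +-mono-≤ 0≤p 0≤q

  p≤∣p∣ : ∀ p → p ≤ ∣ p ∣
  p≤∣p∣ p with ≤-total 0ℚ p
  ... | inj₁ 0≤p = ≤-reflexive (sym (0≤p⇒∣p∣≡p 0≤p))
  ... | inj₂ p≤0 = ≤-trans p≤0 (0≤∣p∣ p)

  ∣p-q∣≡∣q-p∣ : ∀ p q → ∣ p - q ∣ ≡ ∣ q - p ∣
  ∣p-q∣≡∣q-p∣ p q = trans
    (cong ∣_∣ (solve 2 (λ p q → p :- q := :- (q :- p)) refl p q)) (∣-p∣≡∣p∣ (q - p))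

  ∣-∣-triangle : ∀ p q r → ∣ p - r ∣ ≤ ∣ p - q ∣ + ∣ q - r ∣
  ∣-∣-triangle p q r = subst (λ x → ∣ x ∣ ≤ ∣ p - q ∣ + ∣ q - r ∣)
    (solve 3 (λ p q r → (p :- q) :+ (q :- r) := p :- r) refl p q r)
    (∣p+q∣≤∣p∣+∣q∣ (p - q) (q - r))

  ∣-∣<-by : ∀ {p q r} → p < q + r → q < p + r → ∣ p - q ∣ < r
  ∣-∣<-by {p} {q} {r} p<q+r q<p+r with ∣p∣≡p∨∣p∣≡-p (p - q)
  ... | inj₁ eq = subst (_< r) (sym eq) (subst (p - q <_)
    (solve 2 (λ q r → (q :+ r) :- q := r) refl q r) (+-monoˡ-< (- q) p<q+r))
  ... | inj₂ eq = subst (_< r)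
    (sym (trans eq (solve 2 (λ p q → :- (p :- q) := q :- p) refl p q)))
    (subst (q - p <_) (solve 2 (λ p r → (p :+ r) :- p := r) refl p r) (+-monoˡ-< (- p) q<p+r))

  1/1+-pos : ∀ n → 0ℚ < 1/1+ n
  1/1+-pos n = positive⁻¹ (1/1+ n)

  fromℕ-mono-≤ : ∀ {m n} → m ℕ.≤ n → fromℕ m ≤ fromℕ n
  fromℕ-mono-≤ {m} {n} m≤n =
    *≤* (ℤ.*-monoʳ-≤-nonNeg (+ 1) (ℤ.+≤+ m≤n))

  fromℕ-nonNeg : ∀ n → 0ℚ ≤ fromℕ n
  fromℕ-nonNeg n = fromℕ-mono-≤ ℕ.z≤n

  1/1+-antimono-≤ : ∀ {m n} → m ℕ.≤ n → 1/1+ n ≤ 1/1+ m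
  1/1+-antimono-≤ m≤n = *≤* (ℤ.*-monoˡ-≤-nonNeg (+ 1) (ℤ.+≤+ (ℕ.s≤s m≤n)))

  1/1+≤1 : ∀ n → 1/1+ n ≤ 1ℚ
  1/1+≤1 n = 1/1+-antimono-≤ {0} {n} ℕ.z≤n

  1+*1/1+ : ∀ n → fromℕ (suc n) * 1/1+ n ≡ 1ℚ
  1+*1/1+ n = *-inverseʳ (fromℕ (suc n))

  fromℕ-suc : ∀ n → fromℕ (suc n) ≡ 1ℚ + fromℕ n
  fromℕ-suc n = toℚᵘ-injective (ℚᵘ.≃-trans
    (ℚᵘ.*≡* (cong (ℤ._* + 1) (sym (cong₂ ℤ._+_ (ℤ.*-identityʳ (+ 1)) (ℤ.*-identityʳ (+ n))))))
    (ℚᵘ.≃-sym (toℚᵘ-homo-+ 1ℚ (fromℕ n))))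

  fromℕ-* : ∀ m n → fromℕ (m ℕ.* n) ≡ fromℕ m * fromℕ n
  fromℕ-* m n = toℚᵘ-injective (ℚᵘ.≃-trans
    (ℚᵘ.*≡* (cong (ℤ._* + 1) (ℤ.pos-* m n)))
    (ℚᵘ.≃-sym (toℚᵘ-homo-* (fromℕ m) (fromℕ n))))

  archimedean : ∀ {ε} → 0ℚ < ε → ∃[ N ] (∀ {n} → N ℕ.≤ n → 1/1+ n < ε)
  archimedean {mkℚ +[1+ p ] d c} _ = suc d , λ N≤n → ≤-<-trans (1/1+-antimono-≤ N≤n)
    (*<* (ℤ.+<+ (ℕ.<-≤-trans (ℕ.≤-reflexive (cong suc (ℕ.+-identityʳ (suc d)))) (ℕ.m≤m+n (suc (suc d)) (p ℕ.* suc (suc d))))))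
  archimedean {mkℚ (+ 0) d c} (*<* (ℤ.+<+ ()))
  archimedean {mkℚ -[1+ p ] d c} (*<* ())

  p≤∣↥p∣ : ∀ p → p ≤ fromℕ ℤ.∣ ↥ p ∣
  p≤∣↥p∣ (mkℚ (+ p) d c) = *≤* (ℤ.*-monoˡ-≤-nonNeg (+ p) (ℤ.+≤+ (ℕ.s≤s ℕ.z≤n)))
  p≤∣↥p∣ (mkℚ -[1+ p ] d c) = *≤* ℤ.-≤+

  ½-pos : ∀ {ε} → 0ℚ < ε → 0ℚ < ½ * ε
  ½-pos 0<ε = *-pos (positive⁻¹ ½) 0<ε

  ½+½ : ∀ ε → ½ * ε + ½ * ε ≡ ε
  ½+½ = solve 1 (λ ε → con ½ :* ε :+ con ½ :* ε := ε) refl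

  ⅓-pos : ∀ {ε} → 0ℚ < ε → 0ℚ < (+ 1 / 3) * ε
  ⅓-pos 0<ε = *-pos (positive⁻¹ (+ 1 / 3)) 0<ε

  ⅓+⅓+⅓ : ∀ ε → (+ 1 / 3) * ε + (+ 1 / 3) * ε + (+ 1 / 3) * ε ≡ ε
  ⅓+⅓+⅓ = solve 1 (λ ε → con (+ 1 / 3) :* ε :+ con (+ 1 / 3) :* ε :+ con (+ 1 / 3) :* ε := ε) refl

  divide : ∀ {c ε} → 0ℚ < c → 0ℚ < ε → Σ[ δ ∈ ℚ ] 0ℚ < δ × c * δ ≡ ε
  divide {c} {ε} 0<c 0<ε = 1/ c * ε , *-pos (positive⁻¹ (1/ c) {{1/pos⇒pos c}}) 0<ε ,
    trans (sym (*-assoc c (1/ c) ε)) (trans (cong (_* ε) (*-inverseʳ c)) (*-identityˡ ε))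
    where
    instance
      pos-c : Positive c
      pos-c = positive 0<c
      nonZero-c : NonZero c
      nonZero-c = pos⇒nonZero c

IsCauchy : (ℕ → ℚ) → Set
IsCauchy x = ∀ ε → 0ℚ < ε → ∃[ N ] (∀ m n → N ℕ.≤ m → N ℕ.≤ n → ∣ x m - x n ∣ < ε)

record ℝ : Set where
  constructor real
  field
    seq    : ℕ → ℚ
    cauchy : IsCauchy seq

open ℝ public

infix 4 _<ᴿ_ _≈ᴿ_

_≈ᴿ_ : ℝ → ℝ → Set
x ≈ᴿ y = ∀ ε → 0ℚ < ε → ∃[ N ] (∀ n → N ℕ.≤ n → ∣ seq x n - seq y n ∣ < ε)

-- The witness δ makes this the constructive strict order rather than its double negation.
_<ᴿ_ : ℝ → ℝ → Set
x <ᴿ y = Σ[ δ ∈ ℚ ] 0ℚ < δ × ∃[ N ] (∀ n → N ℕ.≤ n → seq x n + δ ≤ seq y n)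

const-cauchy : ∀ q → IsCauchy (λ _ → q)
const-cauchy q ε 0<ε = 0 , λ _ _ _ _ → subst (λ x → ∣ x ∣ < ε) (sym (+-inverseʳ q)) 0<ε

+-cauchy : ∀ x y → IsCauchy x → IsCauchy y → IsCauchy (λ n → x n + y n)
+-cauchy x y cx cy ε 0<ε with cx (½ * ε) (½-pos 0<ε) | cy (½ * ε) (½-pos 0<ε)
... | M , hM | N , hN = M ℕ.⊔ N , λ m n M⊔N≤m M⊔N≤n → begin-strict
  ∣ x m + y m - (x n + y n) ∣    ≡⟨ cong ∣_∣ (solve 4 (λ a b c d →
                                      (a :+ b) :- (c :+ d) := (a :- c) :+ (b :- d))
                                      refl (x m) (y m) (x n) (y n)) ⟩
  ∣ (x m - x n) + (y m - y n) ∣  ≤⟨ ∣p+q∣≤∣p∣+∣q∣ (x m - x n) (y m - y n) ⟩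
  ∣ x m - x n ∣ + ∣ y m - y n ∣  <⟨ +-mono-<
                                      (hM m n (ℕ.m⊔n≤o⇒m≤o M N M⊔N≤m) (ℕ.m⊔n≤o⇒m≤o M N M⊔N≤n))
                                      (hN m n (ℕ.m⊔n≤o⇒n≤o M N M⊔N≤m) (ℕ.m⊔n≤o⇒n≤o M N M⊔N≤n)) ⟩
  ½ * ε + ½ * ε                  ≡⟨ ½+½ ε ⟩
  ε                              ∎
  where open ≤-Reasoning

neg-cauchy : ∀ x → IsCauchy x → IsCauchy (λ n → - x n)
neg-cauchy x cx ε 0<ε with cx ε 0<ε
... | N , hN = N , λ m n N≤m N≤n → subst (_< ε)
  (trans (sym (∣-p∣≡∣p∣ (x m - x n)))
    (cong ∣_∣ (solve 2 (λ a b → :- (a :- b) := :- a :- (:- b)) refl (x m) (x n))))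
  (hN m n N≤m N≤n)

prefix-bound : (x : ℕ → ℚ) (N : ℕ) →
               ∃[ B ] 0ℚ < B × (∀ n → n ℕ.< N → ∣ x n ∣ ≤ B)
prefix-bound x zero    = 1ℚ , positive⁻¹ 1ℚ , λ _ ()
prefix-bound x (suc N) with prefix-bound x N
... | B , 0<B , hB = B + ∣ x N ∣ , <-≤-trans 0<B B≤B′ , bound
  where
  B≤B′ : B ≤ B + ∣ x N ∣
  B≤B′ = ≤-by ∣ x N ∣ (0≤∣p∣ (x N)) refl
  bound : ∀ n → n ℕ.< suc N → ∣ x n ∣ ≤ B + ∣ x N ∣
  bound n n<1+N with ℕ.m≤n⇒m<n∨m≡n (ℕ.s≤s⁻¹ n<1+N)
  ... | inj₁ n<N  = ≤-trans (hB n n<N) B≤B′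
  ... | inj₂ refl = ≤-by B (<⇒≤ 0<B) (+-comm ∣ x N ∣ B)

cauchy⇒bounded : ∀ x → IsCauchy x → ∃[ B ] 0ℚ < B × (∀ n → ∣ x n ∣ ≤ B)
cauchy⇒bounded x cx with cx 1ℚ (positive⁻¹ 1ℚ)
... | N , hN with prefix-bound x (suc N)
...   | B , 0<B , hB = 1ℚ + B , +-mono-< (positive⁻¹ 1ℚ) 0<B , bound
  where
  open ≤-Reasoning
  bound : ∀ n → ∣ x n ∣ ≤ 1ℚ + B
  bound n with ℕ.≤-total N n
  ... | inj₁ N≤n = begin
    ∣ x n ∣                  ≡⟨ cong ∣_∣ (solve 2 (λ a b → a := (a :- b) :+ b) refl (x n) (x N)) ⟩
    ∣ (x n - x N) + x N ∣    ≤⟨ ∣p+q∣≤∣p∣+∣q∣ (x n - x N) (x N) ⟩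
    ∣ x n - x N ∣ + ∣ x N ∣  ≤⟨ +-mono-≤ (<⇒≤ (hN n N N≤n ℕ.≤-refl)) (hB N ℕ.≤-refl) ⟩
    1ℚ + B                   ∎
  ... | inj₂ n≤N = ≤-trans (hB n (ℕ.s≤s n≤N)) (≤-by 1ℚ (nonNegative⁻¹ 1ℚ) (+-comm B 1ℚ))

*-cauchy : ∀ x y → IsCauchy x → IsCauchy y → IsCauchy (λ n → x n * y n)
*-cauchy x y cx cy ε 0<ε with cauchy⇒bounded x cx | cauchy⇒bounded y cy
... | A , 0<A , hA | B , 0<B , hB with divide (+-mono-< 0<A 0<B) 0<ε
...   | δ , 0<δ , [A+B]δ≡ε = M ℕ.⊔ N , close
  where
  M N : ℕ
  M = proj₁ (cx δ 0<δ)
  N = proj₁ (cy δ 0<δ)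
  open ≤-Reasoning
  close : ∀ m n → M ℕ.⊔ N ℕ.≤ m → M ℕ.⊔ N ℕ.≤ n → ∣ x m * y m - x n * y n ∣ < ε
  close m n M⊔N≤m M⊔N≤n = begin-strict
    ∣ x m * y m - x n * y n ∣                          ≡⟨ cong ∣_∣ (solve 4 (λ a b c d →
      a :* b :- c :* d := a :* (b :- d) :+ d :* (a :- c)) refl (x m) (y m) (x n) (y n)) ⟩
    ∣ x m * (y m - y n) + y n * (x m - x n) ∣          ≤⟨ ∣p+q∣≤∣p∣+∣q∣ (x m * (y m - y n)) _ ⟩
    ∣ x m * (y m - y n) ∣ + ∣ y n * (x m - x n) ∣      ≡⟨ cong₂ _+_ (∣p*q∣≡∣p∣*∣q∣ (x m) _) (∣p*q∣≡∣p∣*∣q∣ (y n) _) ⟩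
    ∣ x m ∣ * ∣ y m - y n ∣ + ∣ y n ∣ * ∣ x m - x n ∣  ≤⟨ +-mono-≤
      (*-monoʳ-≤-nonNeg _ {{∣-∣-nonNeg (y m - y n)}} (hA m))
      (*-monoʳ-≤-nonNeg _ {{∣-∣-nonNeg (x m - x n)}} (hB n)) ⟩
    A * ∣ y m - y n ∣ + B * ∣ x m - x n ∣              <⟨ +-mono-<
      (*-monoʳ-<-pos A {{positive 0<A}} (proj₂ (cy δ 0<δ) m n (ℕ.m⊔n≤o⇒n≤o M N M⊔N≤m) (ℕ.m⊔n≤o⇒n≤o M N M⊔N≤n)))
      (*-monoʳ-<-pos B {{positive 0<B}} (proj₂ (cx δ 0<δ) m n (ℕ.m⊔n≤o⇒m≤o M N M⊔N≤m) (ℕ.m⊔n≤o⇒m≤o M N M⊔N≤n))) ⟩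
    A * δ + B * δ                                      ≡⟨ sym (*-distribʳ-+ δ A B) ⟩
    (A + B) * δ                                        ≡⟨ [A+B]δ≡ε ⟩
    ε                                                  ∎

infixl 6 _+ᴿ_
infixl 7 _*ᴿ_
infix  8 -ᴿ_

fromℚ : ℚ → ℝ
fromℚ q = real (λ _ → q) (const-cauchy q)

_+ᴿ_ : ℝ → ℝ → ℝ
x +ᴿ y = real (λ n → seq x n + seq y n) (+-cauchy (seq x) (seq y) (cauchy x) (cauchy y))

-ᴿ_ : ℝ → ℝ
-ᴿ x = real (λ n → - seq x n) (neg-cauchy (seq x) (cauchy x))

_*ᴿ_ : ℝ → ℝ → ℝ
x *ᴿ y = real (λ n → seq x n * seq y n) (*-cauchy (seq x) (seq y) (cauchy x) (cauchy y))

0ᴿ 1ᴿ : ℝ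
0ᴿ = fromℚ 0ℚ
1ᴿ = fromℚ 1ℚ

-- The greatest j ≤ k satisfying P, or 0 if there is none.
greatest : ∀ {P : ℕ → Set} → (∀ j → Dec (P j)) → ℕ → ℕ
greatest P? zero    = 0
greatest P? (suc k) = if does (P? (suc k)) then suc k else greatest P? k

grid : ℕ → ℕ → ℚ
grid n j = fromℕ j * 1/1+ n

abstract
  greatest-holds : ∀ {P : ℕ → Set} (P? : ∀ j → Dec (P j)) k → P 0 → P (greatest P? k)
  greatest-holds P? zero    p₀ = p₀
  greatest-holds P? (suc k) p₀ with P? (suc k)
  ... | yes p = p
  ... | no  _ = greatest-holds P? k p₀

  greatest-maximal : ∀ {P : ℕ → Set} (P? : ∀ j → Dec (P j)) k →
                     ¬ P (suc k) → ¬ P (suc (greatest P? k))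
  greatest-maximal P? zero    ¬p = ¬p
  greatest-maximal P? (suc k) ¬p with P? (suc k)
  ... | yes _  = ¬p
  ... | no ¬p′ = greatest-maximal P? k ¬p′

  *-self-mono-≤ : ∀ {p q} → 0ℚ ≤ p → p ≤ q → p * p ≤ q * q
  *-self-mono-≤ 0≤p p≤q = *-mono-nonNeg 0≤p (≤-trans 0≤p p≤q) p≤q p≤q

  grid-zero : ∀ n → grid n 0 ≡ 0ℚ
  grid-zero n = *-zeroˡ (1/1+ n)

  grid-suc : ∀ n j → grid n (suc j) ≡ grid n j + 1/1+ n
  grid-suc n j = trans (cong (_* 1/1+ n) (fromℕ-suc j))
    (solve 2 (λ k h → (con 1ℚ :+ k) :* h := k :* h :+ h) refl (fromℕ j) (1/1+ n))

  grid-* : ∀ n B → grid n (B ℕ.* suc n) ≡ fromℕ B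
  grid-* n B = trans (cong (_* 1/1+ n) (fromℕ-* B (suc n)))
    (trans (*-assoc (fromℕ B) (fromℕ (suc n)) (1/1+ n)) (trans (cong (fromℕ B *_) (1+*1/1+ n)) (*-identityʳ (fromℕ B))))

  grid-nonNeg : ∀ n j → 0ℚ ≤ grid n j
  grid-nonNeg n j = *-nonNeg (fromℕ-nonNeg j) (<⇒≤ (1/1+-pos n))

  grid-top : ∀ n q → q < grid n (suc (suc ℤ.∣ ↥ q ∣ ℕ.* suc n)) * grid n (suc (suc ℤ.∣ ↥ q ∣ ℕ.* suc n))
  grid-top n q = subst (λ t → q < t * t) (sym eq) (begin-strict
      q                ≤⟨ p≤∣↥p∣ q ⟩
      fromℕ ℤ.∣ ↥ q ∣  ≤⟨ fromℕ-mono-≤ (ℕ.n≤1+n ℤ.∣ ↥ q ∣) ⟩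
      fromℕ B          <⟨ B<T ⟩
      T                ≡⟨ sym (*-identityʳ T) ⟩
      T * 1ℚ           ≤⟨ *-mono-nonNeg (nonNegative⁻¹ 1ℚ) (≤-trans (nonNegative⁻¹ 1ℚ) 1≤T) ≤-refl 1≤T ⟩
      T * T            ∎)
    where
    open ≤-Reasoning
    B : ℕ
    B = suc ℤ.∣ ↥ q ∣
    T : ℚ
    T = fromℕ B + 1/1+ n
    eq : grid n (suc (B ℕ.* suc n)) ≡ T
    eq = trans (grid-suc n (B ℕ.* suc n)) (cong (_+ 1/1+ n) (grid-* n B))
    B<T : fromℕ B < T
    B<T = subst (_< T) (+-identityʳ (fromℕ B)) (+-monoʳ-< (fromℕ B) (1/1+-pos n))
    1≤T : 1ℚ ≤ T
    1≤T = ≤-trans (fromℕ-mono-≤ {1} {B} (ℕ.s≤s ℕ.z≤n)) (<⇒≤ B<T)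

  -- √ q for 0 ≤ q, rounded down to a multiple of 1 / (n + 1).
  √-approx : ℕ → ℚ → ℚ
  √-approx n q = grid n (greatest (λ j → grid n j * grid n j ≤? q) (suc ℤ.∣ ↥ q ∣ ℕ.* suc n))

  √-approx-nonNeg : ∀ n q → 0ℚ ≤ √-approx n q
  √-approx-nonNeg n q = grid-nonNeg n (greatest (λ j → grid n j * grid n j ≤? q) (suc ℤ.∣ ↥ q ∣ ℕ.* suc n))

  √-approx-lower : ∀ n {q} → 0ℚ ≤ q → √-approx n q * √-approx n q ≤ q
  √-approx-lower n {q} 0≤q =
    greatest-holds (λ j → grid n j * grid n j ≤? q) (suc ℤ.∣ ↥ q ∣ ℕ.* suc n)
      (subst (_≤ q) (sym (trans (cong (λ x → x * x) (grid-zero n)) (*-zeroˡ 0ℚ))) 0≤q)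

  √-approx-upper : ∀ n q →
    q < (√-approx n q + 1/1+ n) * (√-approx n q + 1/1+ n)
  √-approx-upper n q = subst (λ x → q < x * x) (grid-suc n j)
    (≰⇒> (greatest-maximal P? K (λ T²≤q → <-irrefl refl (<-≤-trans (grid-top n q) T²≤q))))
    where
    K j : ℕ
    K = suc ℤ.∣ ↥ q ∣ ℕ.* suc n
    P? : ∀ i → Dec (grid n i * grid n i ≤ q)
    P? i = grid n i * grid n i ≤? q
    j = greatest P? K

  √-error : ∀ {q s h δ S ε} → 0ℚ < ε → 0ℚ ≤ h → h ≤ 1ℚ → h ≤ δ → 0ℚ < S → s ≤ S →
            s * s ≤ q → q < (s + h) * (s + h) → (S + S + 1ℚ) * δ ≡ ε → ∣ s * s - q ∣ < ε
  √-error {q} {s} {h} {δ} {S} {ε} 0<ε 0≤h h≤1 h≤δ 0<S s≤S s²≤q q<[s+h]² refl = ∣-∣<-by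
    (≤-<-trans s²≤q (subst (_< q + ε) (+-identityʳ q) (+-monoʳ-< q 0<ε)))
    (begin-strict
      q                          <⟨ q<[s+h]² ⟩
      (s + h) * (s + h)          ≡⟨ solve 2 (λ s h → (s :+ h) :* (s :+ h) := s :* s :+ (s :+ s :+ h) :* h) refl s h ⟩
      s * s + (s + s + h) * h    ≤⟨ +-monoʳ-≤ (s * s) (*-mono-nonNeg 0≤h
                                      (+-nonNeg (+-nonNeg (<⇒≤ 0<S) (<⇒≤ 0<S)) (nonNegative⁻¹ 1ℚ))
                                      (+-mono-≤ (+-mono-≤ s≤S s≤S) h≤1) h≤δ) ⟩
      s * s + (S + S + 1ℚ) * δ   ∎)
    where open ≤-Reasoning

√-approx-close : ∀ m n {p q δ} → 0ℚ ≤ p → 0ℚ < δ → p < q + δ * δ →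
                 √-approx m p < √-approx n q + (1/1+ n + δ)
√-approx-close m n {p} {q} {δ} 0≤p 0<δ p<q+δ²
  with √-approx m p <? √-approx n q + (1/1+ n + δ)
... | yes ok = ok
... | no  ¬p = contradiction (begin-strict
  p                                ≤⟨ ≤-refl ⟩
  p                                <⟨ p<q+δ² ⟩
  q + δ * δ                        <⟨ +-monoˡ-< (δ * δ) (√-approx-upper n q) ⟩
  (s + h) * (s + h) + δ * δ        ≤⟨ ≤-by ((1ℚ + 1ℚ) * ((s + h) * δ))
                                        (*-nonNeg (nonNegative⁻¹ (1ℚ + 1ℚ)) (*-nonNeg 0≤s+h (<⇒≤ 0<δ)))
                                        (solve 3 (λ s h δ →
                                          (s :+ h) :* (s :+ h) :+ δ :* δ :+ con (1ℚ + 1ℚ) :* ((s :+ h) :* δ)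
                                          := (s :+ (h :+ δ)) :* (s :+ (h :+ δ))) refl s h δ) ⟩
  (s + (h + δ)) * (s + (h + δ))    ≤⟨ *-self-mono-≤ (+-nonNeg 0≤s (+-nonNeg 0≤h (<⇒≤ 0<δ))) (≮⇒≥ ¬p) ⟩
  √-approx m p * √-approx m p      ≤⟨ √-approx-lower m 0≤p ⟩
  p                                ∎) (<-irrefl refl)
  where
  open ≤-Reasoning
  s h : ℚ
  s = √-approx n q
  h = 1/1+ n
  0≤s : 0ℚ ≤ s
  0≤s = √-approx-nonNeg n q
  0≤h : 0ℚ ≤ h
  0≤h = <⇒≤ (1/1+-pos n)
  0≤s+h : 0ℚ ≤ s + h
  0≤s+h = +-nonNeg 0≤s 0≤h

⊔0-close : ∀ {p q r} → 0ℚ < r → ∣ p - q ∣ < r → p ⊔ 0ℚ < q ⊔ 0ℚ + r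
⊔0-close {p} {q} {r} 0<r ∣p-q∣<r with ⊔-sel p 0ℚ
... | inj₁ eq = begin-strict
  p ⊔ 0ℚ                   ≡⟨ eq ⟩
  p                        ≡⟨ solve 2 (λ p q → p := q :+ (p :- q)) refl p q ⟩
  q + (p - q)              ≤⟨ +-monoʳ-≤ q (p≤∣p∣ (p - q)) ⟩
  q + ∣ p - q ∣            <⟨ +-monoʳ-< q ∣p-q∣<r ⟩
  q + r                    ≤⟨ +-monoˡ-≤ r (p≤p⊔q q 0ℚ) ⟩
  q ⊔ 0ℚ + r               ∎
  where open ≤-Reasoning
... | inj₂ eq = begin-strict
  p ⊔ 0ℚ                   ≡⟨ eq ⟩
  0ℚ                       <⟨ 0<r ⟩
  r                        ≡⟨ sym (+-identityˡ r) ⟩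
  0ℚ + r                   ≤⟨ +-monoˡ-≤ r (p≤q⊔p q 0ℚ) ⟩
  q ⊔ 0ℚ + r               ∎
  where open ≤-Reasoning

√-cauchy : ∀ x → IsCauchy x → IsCauchy (λ n → √-approx n (x n ⊔ 0ℚ))
√-cauchy x cx ε 0<ε = M ℕ.⊔ N , λ m n M⊔N≤m M⊔N≤n → ∣-∣<-by
  (half (ℕ.m⊔n≤o⇒m≤o M N M⊔N≤m) (ℕ.m⊔n≤o⇒m≤o M N M⊔N≤n) (ℕ.m⊔n≤o⇒n≤o M N M⊔N≤n))
  (half (ℕ.m⊔n≤o⇒m≤o M N M⊔N≤n) (ℕ.m⊔n≤o⇒m≤o M N M⊔N≤m) (ℕ.m⊔n≤o⇒n≤o M N M⊔N≤m))
  where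
  δ : ℚ
  δ = ½ * ε
  0<δ : 0ℚ < δ
  0<δ = ½-pos 0<ε
  M N : ℕ
  M = proj₁ (cx (δ * δ) (*-pos 0<δ 0<δ))
  N = proj₁ (archimedean 0<δ)
  half : ∀ {m n} → M ℕ.≤ m → M ℕ.≤ n → N ℕ.≤ n →
         √-approx m (x m ⊔ 0ℚ) < √-approx n (x n ⊔ 0ℚ) + ε
  half {m} {n} M≤m M≤n N≤n = <-trans
    (√-approx-close m n {x m ⊔ 0ℚ} {x n ⊔ 0ℚ} (p≤q⊔p (x m) 0ℚ) 0<δ
      (⊔0-close {x m} {x n} (*-pos 0<δ 0<δ) (proj₂ (cx (δ * δ) (*-pos 0<δ 0<δ)) m n M≤m M≤n)))
    (+-monoʳ-< (√-approx n (x n ⊔ 0ℚ))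
      (subst (1/1+ n + δ <_) (½+½ ε) (+-monoˡ-< δ (proj₂ (archimedean 0<δ) N≤n))))

-- Negative arguments are sent to 0.
√ : ℝ → ℝ
√ x = real (λ n → √-approx n (seq x n ⊔ 0ℚ)) (√-cauchy (seq x) (cauchy x))

√-square : ∀ x → (∀ n → 0ℚ ≤ seq x n) → √ x *ᴿ √ x ≈ᴿ x
√-square x 0≤x ε 0<ε =
  let S , 0<S , √x≤S      = cauchy⇒bounded (seq (√ x)) (cauchy (√ x))
      δ , 0<δ , [S+S+1]δ≡ε = divide (+-mono-< (+-mono-< 0<S 0<S) (positive⁻¹ 1ℚ)) 0<ε
      N , 1/1+n<δ         = archimedean 0<δ
  in N , λ n N≤n →
    subst (λ q → ∣ seq (√ x) n * seq (√ x) n - q ∣ < ε) (p≥q⇒p⊔q≡p (0≤x n))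
      (√-error 0<ε (<⇒≤ (1/1+-pos n)) (1/1+≤1 n) (<⇒≤ (1/1+n<δ N≤n)) 0<S
        (≤-trans (p≤∣p∣ (seq (√ x) n)) (√x≤S n))
        (√-approx-lower n (p≤q⊔p (seq x n) 0ℚ)) (√-approx-upper n (seq x n ⊔ 0ℚ)) [S+S+1]δ≡ε)

-- N is uniform in the approximation index p, so the diagonal below converges to the limit of S.
UniformlyCauchy : (ℕ → ℝ) → Set
UniformlyCauchy S =
  ∀ ε → 0ℚ < ε → ∃[ N ] (∀ m p → N ℕ.≤ m → ∣ seq (S m) p - seq (S N) p ∣ < ε)

_⟶_ : (ℕ → ℝ) → ℝ → Set
S ⟶ x = ∀ ε → 0ℚ < ε → ∃[ N ] (∀ m → N ℕ.≤ m →
          ∃[ P ] (∀ p → P ℕ.≤ p → ∣ seq (S m) p - seq x p ∣ < ε))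

diagonal-cauchy : ∀ S → UniformlyCauchy S → IsCauchy (λ p → seq (S p) p)
diagonal-cauchy S uc ε 0<ε =
  let N , hN = uc ((+ 1 / 3) * ε) (⅓-pos 0<ε)
      M , hM = cauchy (S N) ((+ 1 / 3) * ε) (⅓-pos 0<ε)
  in N ℕ.⊔ M , λ m n N⊔M≤m N⊔M≤n → begin-strict
    ∣ seq (S m) m - seq (S n) n ∣
      ≤⟨ ∣-∣-triangle (seq (S m) m) (seq (S N) n) (seq (S n) n) ⟩
    ∣ seq (S m) m - seq (S N) n ∣ + ∣ seq (S N) n - seq (S n) n ∣
      ≤⟨ +-monoˡ-≤ _ (∣-∣-triangle (seq (S m) m) (seq (S N) m) (seq (S N) n)) ⟩
    ∣ seq (S m) m - seq (S N) m ∣ + ∣ seq (S N) m - seq (S N) n ∣ + ∣ seq (S N) n - seq (S n) n ∣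
      <⟨ +-mono-<
           (+-mono-< (hN m m (ℕ.m⊔n≤o⇒m≤o N M N⊔M≤m))
                     (hM m n (ℕ.m⊔n≤o⇒n≤o N M N⊔M≤m) (ℕ.m⊔n≤o⇒n≤o N M N⊔M≤n)))
           (subst (_< (+ 1 / 3) * ε) (∣p-q∣≡∣q-p∣ (seq (S n) n) (seq (S N) n))
             (hN n n (ℕ.m⊔n≤o⇒m≤o N M N⊔M≤n))) ⟩
    (+ 1 / 3) * ε + (+ 1 / 3) * ε + (+ 1 / 3) * ε
      ≡⟨ ⅓+⅓+⅓ ε ⟩
    ε ∎
  where open ≤-Reasoning

lim : (S : ℕ → ℝ) → UniformlyCauchy S → ℝ
lim S uc = real (λ p → seq (S p) p) (diagonal-cauchy S uc)

⟶-lim : ∀ S uc → S ⟶ lim S uc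
⟶-lim S uc ε 0<ε =
  let N , hN = uc (½ * ε) (½-pos 0<ε)
  in N , λ m N≤m → N , λ p N≤p → begin-strict
    ∣ seq (S m) p - seq (S p) p ∣
      ≤⟨ ∣-∣-triangle (seq (S m) p) (seq (S N) p) (seq (S p) p) ⟩
    ∣ seq (S m) p - seq (S N) p ∣ + ∣ seq (S N) p - seq (S p) p ∣
      <⟨ +-mono-< (hN m p N≤m)
           (subst (_< ½ * ε) (∣p-q∣≡∣q-p∣ (seq (S p) p) (seq (S N) p)) (hN p p N≤p)) ⟩
    ½ * ε + ½ * ε
      ≡⟨ ½+½ ε ⟩
    ε ∎
  where open ≤-Reasoning

record ℂ : Set where
  constructor _+i_
  field
    re im : ℝ

open ℂ public

infixl 6 _+ᶜ_
infixl 7 _*ᶜ_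
infix  8 -ᶜ_

_+ᶜ_ _*ᶜ_ : ℂ → ℂ → ℂ
z +ᶜ w = (re z +ᴿ re w) +i (im z +ᴿ im w)
z *ᶜ w = (re z *ᴿ re w +ᴿ -ᴿ (im z *ᴿ im w)) +i (re z *ᴿ im w +ᴿ im z *ᴿ re w)

-ᶜ_ conj : ℂ → ℂ
-ᶜ z   = (-ᴿ re z) +i (-ᴿ im z)
conj z = re z +i (-ᴿ im z)

fromℝ : ℝ → ℂ
fromℝ x = x +i 0ᴿ

0ᶜ 1ᶜ 𝕚 : ℂ
0ᶜ = fromℝ 0ᴿ
1ᶜ = fromℝ 1ᴿ
𝕚  = 0ᴿ +i 1ᴿ

∣_∣² : ℂ → ℝ
∣ z ∣² = re z *ᴿ re z +ᴿ im z *ᴿ im z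

∑ : ∀ {n} → Vector ℂ n → ℂ
∑ = foldr _+ᶜ_ 0ᶜ

‖_‖ : ∀ {n} → Vector ℂ n → ℝ
‖ v ‖ = √ (foldr _+ᴿ_ 0ᴿ (λ i → ∣ v i ∣²))

Matrix : ℕ → Set
Matrix n = Fin n → Fin n → ℂ

basis : ∀ {n} → Fin n → Vector ℂ n
basis u v = if does (u Fin.≟ v) then 1ᶜ else 0ᶜ

identity : ∀ {n} → Matrix n
identity = basis

_⊗_ : ∀ {n} → Matrix n → Matrix n → Matrix n
(M ⊗ N) u v = ∑ (λ w → M u w *ᶜ N w v)

_^ᴹ_ : ∀ {n} → Matrix n → ℕ → Matrix n
M ^ᴹ zero  = identity
M ^ᴹ suc k = M ⊗ (M ^ᴹ k)

_·_ : ∀ {n} → ℂ → Matrix n → Matrix n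
(z · M) u v = z *ᶜ M u v

_⊡_ : ∀ {n} → Matrix n → Vector ℂ n → Vector ℂ n
(M ⊡ x) u = ∑ (λ w → M u w *ᶜ x w)

_∘ᵛ_ _-ᵛ_ : ∀ {n} → Vector ℂ n → Vector ℂ n → Vector ℂ n
(x ∘ᵛ y) u = x u *ᶜ y u
(x -ᵛ y) u = x u +ᶜ -ᶜ y u

constant : ∀ {n} → ℂ → Vector ℂ n
constant z _ = z

conjᴹ : ∀ {n} → Matrix n → Matrix n
conjᴹ M u v = conj (M u v)

expTerm : ∀ {n} → Matrix n → ℕ → Matrix n
expTerm M k = fromℝ (fromℚ (1/ k !)) · (M ^ᴹ k)

-- The partial sum over exponents below N.
expPartial : ∀ {n} → Matrix n → ℕ → Matrix n
expPartial M zero    u v = 0ᶜ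
expPartial M (suc N) u v = expPartial M N u v +ᶜ expTerm M N u v

-- z ⊑ b bounds |re| + |im| at every rational approximation of z.
_⊑_ : ℂ → ℚ → Set
z ⊑ b = ∀ p → ∣ seq (re z) p ∣ + ∣ seq (im z) p ∣ ≤ b

abstract
  ⊑-0 : 0ᶜ ⊑ 0ℚ
  ⊑-0 p = ≤-refl

  ⊑-1 : 1ᶜ ⊑ 1ℚ
  ⊑-1 p = ≤-refl

  ⊑-mono : ∀ {z b c} → b ≤ c → z ⊑ b → z ⊑ c
  ⊑-mono b≤c z⊑b p = ≤-trans (z⊑b p) b≤c

  ⊑-fromℚ : ∀ {q} → 0ℚ ≤ q → fromℝ (fromℚ q) ⊑ q
  ⊑-fromℚ {q} 0≤q p = ≤-reflexive (trans (+-identityʳ ∣ q ∣) (0≤p⇒∣p∣≡p 0≤q))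

  ⊑-+ : ∀ z w {b c} → z ⊑ b → w ⊑ c → (z +ᶜ w) ⊑ (b + c)
  ⊑-+ z w {b} {c} z⊑b w⊑c p = begin
    ∣ x + x′ ∣ + ∣ y + y′ ∣                    ≤⟨ +-mono-≤ (∣p+q∣≤∣p∣+∣q∣ x x′) (∣p+q∣≤∣p∣+∣q∣ y y′) ⟩
    (∣ x ∣ + ∣ x′ ∣) + (∣ y ∣ + ∣ y′ ∣)        ≡⟨ solve 4 (λ a b c d → (a :+ b) :+ (c :+ d) := (a :+ c) :+ (b :+ d))
                                                   refl (∣ x ∣) (∣ x′ ∣) (∣ y ∣) (∣ y′ ∣) ⟩
    (∣ x ∣ + ∣ y ∣) + (∣ x′ ∣ + ∣ y′ ∣)        ≤⟨ +-mono-≤ (z⊑b p) (w⊑c p) ⟩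
    b + c                                      ∎
    where
    open ≤-Reasoning
    x y x′ y′ : ℚ
    x = seq (re z) p
    y = seq (im z) p
    x′ = seq (re w) p
    y′ = seq (im w) p

  ∣∣-*-bound : ∀ x y x′ y′ {b c} → ∣ x ∣ + ∣ y ∣ ≤ b → ∣ x′ ∣ + ∣ y′ ∣ ≤ c →
               ∣ x * x′ + - (y * y′) ∣ + ∣ x * y′ + y * x′ ∣ ≤ b * c
  ∣∣-*-bound x y x′ y′ {b} {c} hb hc = begin
    ∣ x * x′ + - (y * y′) ∣ + ∣ x * y′ + y * x′ ∣
      ≤⟨ +-mono-≤ (∣p-q∣≤∣p∣+∣q∣ (x * x′) (y * y′)) (∣p+q∣≤∣p∣+∣q∣ (x * y′) (y * x′)) ⟩
    (∣ x * x′ ∣ + ∣ y * y′ ∣) + (∣ x * y′ ∣ + ∣ y * x′ ∣)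
      ≡⟨ cong₂ _+_ (cong₂ _+_ (∣p*q∣≡∣p∣*∣q∣ x x′) (∣p*q∣≡∣p∣*∣q∣ y y′))
                   (cong₂ _+_ (∣p*q∣≡∣p∣*∣q∣ x y′) (∣p*q∣≡∣p∣*∣q∣ y x′)) ⟩
    (∣ x ∣ * ∣ x′ ∣ + ∣ y ∣ * ∣ y′ ∣) + (∣ x ∣ * ∣ y′ ∣ + ∣ y ∣ * ∣ x′ ∣)
      ≡⟨ solve 4 (λ a b c d → (a :* c :+ b :* d) :+ (a :* d :+ b :* c) := (a :+ b) :* (c :+ d))
           refl (∣ x ∣) (∣ y ∣) (∣ x′ ∣) (∣ y′ ∣) ⟩
    (∣ x ∣ + ∣ y ∣) * (∣ x′ ∣ + ∣ y′ ∣)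
      ≤⟨ *-mono-nonNeg (+-nonNeg (0≤∣p∣ x′) (0≤∣p∣ y′))
           (≤-trans (+-nonNeg (0≤∣p∣ x) (0≤∣p∣ y)) hb) hb hc ⟩
    b * c ∎
    where open ≤-Reasoning

  ⊑-* : ∀ z w {b c} → z ⊑ b → w ⊑ c → (z *ᶜ w) ⊑ (b * c)
  ⊑-* z w z⊑b w⊑c p =
    ∣∣-*-bound (seq (re z) p) (seq (im z) p) (seq (re w) p) (seq (im w) p) (z⊑b p) (w⊑c p)

  ⊑-∑ : ∀ {n} (x : Vector ℂ n) {b} → (∀ i → x i ⊑ b) → ∑ x ⊑ (fromℕ n * b)
  ⊑-∑ {zero}  x {b} x⊑b = ⊑-mono {0ᶜ} (≤-reflexive (sym (*-zeroˡ b))) ⊑-0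
  ⊑-∑ {suc n} x {b} x⊑b =
    subst (∑ x ⊑_)
      (trans (solve 2 (λ n b → b :+ n :* b := (con 1ℚ :+ n) :* b) refl (fromℕ n) b)
        (cong (_* b) (sym (fromℕ-suc n))))
      (⊑-+ (x Fin.zero) (∑ (λ i → x (Fin.suc i))) (x⊑b Fin.zero)
        (⊑-∑ (λ i → x (Fin.suc i)) (λ i → x⊑b (Fin.suc i))))

  ⊑-exists : ∀ z → ∃[ b ] z ⊑ b
  ⊑-exists z =
    let A , _ , hA = cauchy⇒bounded (seq (re z)) (cauchy (re z))
        B , _ , hB = cauchy⇒bounded (seq (im z)) (cauchy (im z))
    in A + B , λ p → +-mono-≤ (hA p) (hB p)

  Fin-bound : ∀ {n} {P : Fin n → ℚ → Set} → (∀ i {b c} → b ≤ c → P i b → P i c) →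
              (∀ i → ∃[ b ] P i b) → ∃[ b ] 0ℚ ≤ b × (∀ i → P i b)
  Fin-bound {zero}  mono bound = 0ℚ , ≤-refl , λ ()
  Fin-bound {suc n} {P} mono bound =
    let b , hb       = bound Fin.zero
        c , 0≤c , hc = Fin-bound (λ i → mono (Fin.suc i)) (λ i → bound (Fin.suc i))
    in b ⊔ c , ≤-trans 0≤c (p≤q⊔p b c) ,
       λ { Fin.zero    → mono Fin.zero (p≤p⊔q b c) hb
         ; (Fin.suc i) → mono (Fin.suc i) (p≤q⊔p b c) (hc i) }

  matrix-bound : ∀ {n} (M : Matrix n) → ∃[ b ] 0ℚ ≤ b × (∀ u v → M u v ⊑ b)
  matrix-bound M = Fin-bound (λ u b≤c h v → ⊑-mono {M u v} b≤c (h v)) λ u →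
    let b , _ , h = Fin-bound (λ v → ⊑-mono {M u v}) (λ v → ⊑-exists (M u v))
    in b , h

_^ℚ_ : ℚ → ℕ → ℚ
q ^ℚ zero  = 1ℚ
q ^ℚ suc k = q * (q ^ℚ k)

abstract
  ^ℚ-nonNeg : ∀ {c} → 0ℚ ≤ c → ∀ k → 0ℚ ≤ c ^ℚ k
  ^ℚ-nonNeg 0≤c zero    = nonNegative⁻¹ 1ℚ
  ^ℚ-nonNeg 0≤c (suc k) = *-nonNeg 0≤c (^ℚ-nonNeg 0≤c k)

  1/!-nonNeg : ∀ k → 0ℚ ≤ 1/ k !
  1/!-nonNeg zero    = nonNegative⁻¹ 1ℚ
  1/!-nonNeg (suc k) = *-nonNeg (1/!-nonNeg k) (<⇒≤ (1/1+-pos k))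

  basis-bound : ∀ {n} (u v : Fin n) → basis u v ⊑ 1ℚ
  basis-bound u v with u Fin.≟ v
  ... | yes _ = ⊑-1
  ... | no  _ = ⊑-mono {0ᶜ} (nonNegative⁻¹ 1ℚ) ⊑-0

  ^ᴹ-bound : ∀ {n} (M : Matrix n) {b} → (∀ u v → M u v ⊑ b) →
             ∀ k u v → (M ^ᴹ k) u v ⊑ ((fromℕ n * b) ^ℚ k)
  ^ᴹ-bound M M⊑b zero    u v = basis-bound u v
  ^ᴹ-bound {n} M {b} M⊑b (suc k) u v =
    subst ((M ^ᴹ suc k) u v ⊑_) (sym (*-assoc (fromℕ n) b ((fromℕ n * b) ^ℚ k)))
      (⊑-∑ (λ w → M u w *ᶜ (M ^ᴹ k) w v)
        (λ w → ⊑-* (M u w) ((M ^ᴹ k) w v) (M⊑b u w) (^ᴹ-bound M M⊑b k w v)))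

  expTerm-bound : ∀ {n} (M : Matrix n) {b} → (∀ u v → M u v ⊑ b) →
                  ∀ k u v → expTerm M k u v ⊑ (1/ k ! * (fromℕ n * b) ^ℚ k)
  expTerm-bound M M⊑b k u v =
    ⊑-* (fromℝ (fromℚ (1/ k !))) ((M ^ᴹ k) u v) (⊑-fromℚ (1/!-nonNeg k)) (^ᴹ-bound M M⊑b k u v)

  -- A nonnegative sequence that eventually at least halves at each step tends to 0.
  halving-null : (t : ℕ → ℚ) (K : ℕ) → (∀ k → 0ℚ ≤ t k) →
                 (∀ k → K ℕ.≤ k → t (suc k) + t (suc k) ≤ t k) →
                 ∀ ε → 0ℚ < ε → ∃[ N ] K ℕ.≤ N × t N + t N < ε
  halving-null t K 0≤t halve ε 0<ε =
    let δ , 0<δ , [tK+1]δ≡½ε = divide (+-mono-≤-< (0≤t K) (positive⁻¹ 1ℚ)) (½-pos 0<ε)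
        j , 1/1+<δ = archimedean 0<δ
        tN<½ε : t (j ℕ.+ K) < ½ * ε
        tN<½ε = begin-strict
          t (j ℕ.+ K)            ≤⟨ decay′ j ⟩
          t K * 1/1+ j           ≤⟨ *-monoʳ-≤-nonNeg (1/1+ j) {{nonNegative (<⇒≤ (1/1+-pos j))}}
                                      (≤-by {t K} {t K + 1ℚ} 1ℚ (nonNegative⁻¹ 1ℚ) refl) ⟩
          (t K + 1ℚ) * 1/1+ j    <⟨ *-monoʳ-<-pos (t K + 1ℚ)
                                      {{positive (+-mono-≤-< (0≤t K) (positive⁻¹ 1ℚ))}} (1/1+<δ ℕ.≤-refl) ⟩
          (t K + 1ℚ) * δ         ≡⟨ [tK+1]δ≡½ε ⟩
          ½ * ε                  ∎
    in j ℕ.+ K , ℕ.m≤n+m K j , subst (t (j ℕ.+ K) + t (j ℕ.+ K) <_) (½+½ ε) (+-mono-< tN<½ε tN<½ε)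
    where
    open ≤-Reasoning
    decay : ∀ j → t (j ℕ.+ K) * fromℕ (suc j) ≤ t K
    decay zero    = ≤-reflexive (*-identityʳ (t K))
    decay (suc j) = begin
      t′ * fromℕ (suc (suc j))             ≡⟨ cong (t′ *_) (fromℕ-suc (suc j)) ⟩
      t′ * (1ℚ + fromℕ (suc j))            ≤⟨ *-monoˡ-≤-nonNeg t′ {{nonNegative (0≤t (suc j ℕ.+ K))}}
                                                (+-monoˡ-≤ (fromℕ (suc j)) (fromℕ-mono-≤ {1} {suc j} (ℕ.s≤s ℕ.z≤n))) ⟩
      t′ * (fromℕ (suc j) + fromℕ (suc j)) ≡⟨ solve 2 (λ a b → a :* (b :+ b) := (a :+ a) :* b) refl t′ (fromℕ (suc j)) ⟩
      (t′ + t′) * fromℕ (suc j)            ≤⟨ *-monoʳ-≤-nonNeg (fromℕ (suc j)) (halve (j ℕ.+ K) (ℕ.m≤n+m K j)) ⟩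
      t (j ℕ.+ K) * fromℕ (suc j)          ≤⟨ decay j ⟩
      t K                                  ∎
      where
      t′ : ℚ
      t′ = t (suc j ℕ.+ K)
    decay′ : ∀ j → t (j ℕ.+ K) ≤ t K * 1/1+ j
    decay′ j = begin
      t (j ℕ.+ K)                              ≡⟨ sym (*-identityʳ _) ⟩
      t (j ℕ.+ K) * 1ℚ                         ≡⟨ cong (t (j ℕ.+ K) *_) (sym (1+*1/1+ j)) ⟩
      t (j ℕ.+ K) * (fromℕ (suc j) * 1/1+ j)   ≡⟨ sym (*-assoc (t (j ℕ.+ K)) (fromℕ (suc j)) (1/1+ j)) ⟩
      t (j ℕ.+ K) * fromℕ (suc j) * 1/1+ j     ≤⟨ *-monoʳ-≤-nonNeg (1/1+ j) {{nonNegative (<⇒≤ (1/1+-pos j))}} (decay j) ⟩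
      t K * 1/1+ j                             ∎

  dominated : (S : ℕ → ℝ) (t : ℕ → ℚ) (K : ℕ) → (∀ k → 0ℚ ≤ t k) →
              (∀ k → K ℕ.≤ k → t (suc k) + t (suc k) ≤ t k) →
              (∀ k p → ∣ seq (S (suc k)) p - seq (S k) p ∣ ≤ t k) → UniformlyCauchy S
  dominated S t K 0≤t halve step ε 0<ε =
    let N , K≤N , 2tN<ε = halving-null t K 0≤t halve ε 0<ε
    in N , λ m p N≤m →
      subst (λ i → ∣ seq (S i) p - seq (S N) p ∣ < ε) (ℕ.m∸n+n≡m N≤m)
        (≤-<-trans
          (≤-trans (≤-by (t (m ℕ.∸ N ℕ.+ N) + t (m ℕ.∸ N ℕ.+ N)) (+-nonNeg (0≤t _) (0≤t _)) refl)
            (tail N K≤N p (m ℕ.∸ N)))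
          2tN<ε)
    where
    open ≤-Reasoning
    tail : ∀ N → K ℕ.≤ N → ∀ p j →
           ∣ seq (S (j ℕ.+ N)) p - seq (S N) p ∣ + (t (j ℕ.+ N) + t (j ℕ.+ N)) ≤ t N + t N
    tail N K≤N p zero    = ≤-reflexive (trans
      (cong (λ d → ∣ d ∣ + (t N + t N)) (+-inverseʳ (seq (S N) p))) (+-identityˡ (t N + t N)))
    tail N K≤N p (suc j) = begin
      ∣ s″ - s ∣ + (t′ + t′)               ≤⟨ +-mono-≤ (∣-∣-triangle s″ s′ s)
                                                (halve (j ℕ.+ N) (ℕ.≤-trans K≤N (ℕ.m≤n+m N j))) ⟩
      ∣ s″ - s′ ∣ + ∣ s′ - s ∣ + τ         ≤⟨ +-monoˡ-≤ τ (+-monoˡ-≤ ∣ s′ - s ∣ (step (j ℕ.+ N) p)) ⟩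
      τ + ∣ s′ - s ∣ + τ                   ≡⟨ solve 2 (λ τ d → τ :+ d :+ τ := d :+ (τ :+ τ)) refl τ (∣ s′ - s ∣) ⟩
      ∣ s′ - s ∣ + (τ + τ)                 ≤⟨ tail N K≤N p j ⟩
      t N + t N                            ∎
      where
      s s′ s″ τ t′ : ℚ
      s  = seq (S N) p
      s′ = seq (S (j ℕ.+ N)) p
      s″ = seq (S (suc j ℕ.+ N)) p
      τ  = t (j ℕ.+ N)
      t′ = t (suc j ℕ.+ N)

  exponential-halving : ∀ {c} → 0ℚ ≤ c → ∀ k → c + c ≤ fromℕ k →
    (1/ suc k ! * c ^ℚ suc k) + (1/ suc k ! * c ^ℚ suc k) ≤ 1/ k ! * c ^ℚ k
  exponential-halving {c} 0≤c k 2c≤k = begin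
    (f * h) * (c * e) + (f * h) * (c * e)  ≡⟨ solve 4 (λ f h c e →
                                                (f :* h) :* (c :* e) :+ (f :* h) :* (c :* e)
                                                := (f :* e) :* ((c :+ c) :* h)) refl f h c e ⟩
    (f * e) * ((c + c) * h)                ≤⟨ *-monoˡ-≤-nonNeg (f * e)
                                                {{nonNegative (*-nonNeg (1/!-nonNeg k) (^ℚ-nonNeg 0≤c k))}} 2ch≤1 ⟩
    (f * e) * 1ℚ                           ≡⟨ *-identityʳ (f * e) ⟩
    f * e                                  ∎
    where
    open ≤-Reasoning
    f h e : ℚ
    f = 1/ k !
    h = 1/1+ k
    e = c ^ℚ k
    2ch≤1 : (c + c) * h ≤ 1ℚ
    2ch≤1 = subst ((c + c) * h ≤_) (1+*1/1+ k)
      (*-monoʳ-≤-nonNeg h {{nonNegative (<⇒≤ (1/1+-pos k))}}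
        (≤-trans 2c≤k (fromℕ-mono-≤ (ℕ.n≤1+n k))))

  p+q-p≡q : ∀ p q → (p + q) - p ≡ q
  p+q-p≡q = solve 2 (λ p q → (p :+ q) :- p := q) refl

  expPartial-uniform : ∀ {n} (M : Matrix n) u v →
    UniformlyCauchy (λ N → re (expPartial M N u v)) ×
    UniformlyCauchy (λ N → im (expPartial M N u v))
  expPartial-uniform {n} M u v =
    let b , 0≤b , M⊑b = matrix-bound M
        c = fromℕ n * b
        t = λ k → 1/ k ! * c ^ℚ k
        K = ℤ.∣ ↥ (c + c) ∣
        0≤c = *-nonNeg (fromℕ-nonNeg n) 0≤b
        0≤t = λ k → *-nonNeg (1/!-nonNeg k) (^ℚ-nonNeg 0≤c k)
        halve = λ k K≤k → exponential-halving 0≤c k (≤-trans (p≤∣↥p∣ (c + c)) (fromℕ-mono-≤ K≤k))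
        bound = λ k → expTerm-bound M M⊑b k u v
    in dominated (λ N → re (expPartial M N u v)) t K 0≤t halve
         (λ k p → ≤-trans
           (≤-reflexive (cong ∣_∣ (p+q-p≡q (seq (re (expPartial M k u v)) p) (seq (re (expTerm M k u v)) p))))
           (≤-trans (≤-by ∣ seq (im (expTerm M k u v)) p ∣ (0≤∣p∣ (seq (im (expTerm M k u v)) p)) refl) (bound k p))) ,
       dominated (λ N → im (expPartial M N u v)) t K 0≤t halve
         (λ k p → ≤-trans
           (≤-reflexive (cong ∣_∣ (p+q-p≡q (seq (im (expPartial M k u v)) p) (seq (im (expTerm M k u v)) p))))
           (≤-trans (≤-by ∣ seq (re (expTerm M k u v)) p ∣ (0≤∣p∣ (seq (re (expTerm M k u v)) p))
               (+-comm ∣ seq (im (expTerm M k u v)) p ∣ ∣ seq (re (expTerm M k u v)) p ∣)) (bound k p)))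

exp : ∀ {n} → Matrix n → Matrix n
exp M u v = lim (λ N → re (expPartial M N u v)) (proj₁ (expPartial-uniform M u v))
         +i lim (λ N → im (expPartial M N u v)) (proj₂ (expPartial-uniform M u v))

expPartial⟶exp : ∀ {n} (M : Matrix n) u v →
  ((λ N → re (expPartial M N u v)) ⟶ re (exp M u v)) ×
  ((λ N → im (expPartial M N u v)) ⟶ im (exp M u v))
expPartial⟶exp M u v =
  ⟶-lim (λ N → re (expPartial M N u v)) (proj₁ (expPartial-uniform M u v)) ,
  ⟶-lim (λ N → im (expPartial M N u v)) (proj₂ (expPartial-uniform M u v))

record Graph (n : ℕ) : Set where
  field
    adj       : Fin n → Fin n → Bool
    symmetric : ∀ u v → adj u v ≡ adj v u
    loopless  : ∀ u → adj u u ≡ false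

  _~_ : Fin n → Fin n → Set
  u ~ v = adj u v ≡ true

open Graph public using (adj)

module _ {n : ℕ} (G : Graph n) where
  open Graph G using (_~_)

  degree : Fin n → ℕ
  degree u = ∣ tabulate (adj G u) ∣ˢ

  Connected : Set
  Connected = ∀ u v → Star _~_ u v

  -- A cycle of length k + 3 is an injective listing c of its vertices.
  Acyclic : Set
  Acyclic = ∀ k (c : Fin (3 ℕ.+ k) → Fin n) → Injective _≡_ _≡_ c →
            (∀ i → c (Fin.inject₁ i) ~ c (Fin.suc i)) →
            ¬ (c (Fin.fromℕ (2 ℕ.+ k)) ~ c Fin.zero)

  IsTree : Set
  IsTree = ℕ.NonZero n × Connected × Acyclic

  NoDegreeTwoVertex : Set
  NoDegreeTwoVertex = ∀ u → degree u ≢ 2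

  adjacency : Matrix n
  adjacency u v = if adj G u v then 1ᶜ else 0ᶜ

  U : ℝ → Matrix n
  U t = exp ((𝕚 *ᶜ fromℝ t) · adjacency)

  EpsilonUniformMixing : .{{ℕ.NonZero n}} → Set
  EpsilonUniformMixing = ∀ ε → 0ᴿ <ᴿ ε → Σ[ τ ∈ ℝ ] (∀ u →
    ‖ ((U τ ⊡ basis u) ∘ᵛ (conjᴹ (U τ) ⊡ basis u)) -ᵛ constant (fromℝ (fromℚ (+ 1 / n))) ‖ <ᴿ ε)

_≅_ : ∀ {m n} → Graph m → Graph n → Set
_≅_ {m} {n} G H =
  Σ[ f ∈ Fin m ↔ Fin n ] (∀ u v → adj G u v ≡ adj H (Inverse.to f u) (Inverse.to f v))

K₁,₃ : Graph 4
K₁,₃ = record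
  { adj       = edge
  ; symmetric = λ { Fin.zero Fin.zero → refl ; Fin.zero (Fin.suc _) → refl
                  ; (Fin.suc _) Fin.zero → refl ; (Fin.suc _) (Fin.suc _) → refl }
  ; loopless  = λ { Fin.zero → refl ; (Fin.suc _) → refl }
  }
  where
  edge : Fin 4 → Fin 4 → Bool
  edge Fin.zero    (Fin.suc _) = true
  edge (Fin.suc _) Fin.zero    = true
  edge _           _           = false

{-# OPTIONS --safe #-}
-- In a tree without vertices of degree two the end of a longest path is a leaf a with a twin leaf b.
-- The rows of a and b in the adjacency matrix agree, so U(t)_aa − U(t)_ba = 1 for every t; since both
-- entries have modulus near 1/√n under ε-uniform mixing, n ≤ 4, which leaves K₁,₃.
-- Conversely, for K₁,₃ the powers of iA are spanned by I, A and Q = A²/3, and U(t) = I − Q + c Q + i s A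
-- with c = cos (√3 t) and s = sin (√3 t) / √3. All entries have modulus 1/2 once c = −1/2 and s² = 1/4.
-- Such t is found up to any error by walking along a fine grid until the series of c crosses −1/2, while
-- c² + 3s² stays near 1 because it changes only by O(h²) in a step of size h.
module Submission where

open import Defs
import Algebra.Properties.CommutativeMonoid.Sum as Sum
open import Data.Bool.Base using (Bool; true; false; if_then_else_)
open import Data.Bool.Properties using (¬-not) renaming (_≟_ to _≟ᵇ_)
open import Data.Fin.Base as Fin using (Fin; zero; suc; toℕ; inject₁; inject≤)
open import Data.Fin.Permutation using (↔⇒≡)
open import Data.Fin.Properties as Fin using (any?; _≟_; toℕ-injective; injective⇒≤)
open import Data.Fin.Subset using () renaming (∣_∣ to ∣_∣ˢ)
open import Data.Integer.Base as ℤ using (+_)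
open import Data.Nat.Base as ℕ using (ℕ; NonZero; _≤_; z≤n; s≤s)
import Data.Nat.Properties as ℕ
open import Data.Product.Base using (_×_; _,_; proj₁; proj₂; ∃-syntax; Σ-syntax)
open import Data.Rational.Base as ℚ using (ℚ; 0ℚ; 1ℚ; ½; _+_; _*_; -_; _-_; _<_; _/_; ∣_∣; _⊔_)
  renaming (_≤_ to _≤ℚ_)
import Data.Rational.Properties as ℚ
open import Data.Rational.Solver using (module +-*-Solver)
import Data.Rational.Unnormalised.Base as ℚᵘ
import Data.Rational.Unnormalised.Properties as ℚᵘ
open import Data.Sum.Base using (_⊎_; inj₁; inj₂)
open import Data.Vec.Base using (tabulate)
open import Data.Vec.Functional using (Vector; foldr; _∷_; [])
open import Function.Base using (_∘_)
open import Function.Bundles using (_⇔_; _↔_; Inverse; Injection; mk⇔; mk↔ₛ′)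
open import Function.Definitions using (Injective)
open import Function.Properties.Inverse using (↔⇒↣)
open import Relation.Binary.Construct.Closure.ReflexiveTransitive using (Star; _◅_) renaming (ε to nil)
open import Relation.Binary.PropositionalEquality
open import Relation.Nullary using (¬_; Dec; yes; no; does; contradiction; ¬?; _×-dec_)
open import Relation.Nullary.Decidable using (dec-true; dec-false; from-yes)
open +-*-Solver

-- Twin leaves

-- The twin exists because the second vertex of a longest path has two neighbours on the path and
-- degree other than two, hence a third neighbour off it. Putting that neighbour in place of the end
-- gives a path of the same length, so it is a leaf as well. The bound on n is then 1 ≤ |U_aa| +
-- |U_ba|, which tends to 2/√n. For the converse the exact time 2π/(3√3) is irrational, but mixing
-- only asks for approximation, so a rational t depending on ε is enough; for rational t every
-- approximant of U(t) is given by an exact rational formula. Two errors compete in the walk: the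
-- mesh h, and the truncation of the series at p terms. The mesh is fixed first, and p is then taken
-- so large that the omitted term is at most h. Each step thus loses only O(h²), and T/h steps lose
-- O(h) in total. The sign of s never matters: near c = -1/2 the conserved quantity alone forces s²
-- to be near 1/4.

count : ∀ {n} → (Fin n → Bool) → ℕ
count f = ∣ tabulate f ∣ˢ

count-none : ∀ {n} (f : Fin n → Bool) → (∀ i → f i ≡ false) → count f ≡ 0
count-none {ℕ.zero}  f none = refl
count-none {ℕ.suc n} f none rewrite none zero = count-none (f ∘ suc) (none ∘ suc)

count-one : ∀ {n} (f : Fin n → Bool) a → f a ≡ true → (∀ i → i ≢ a → f i ≡ false) →
            count f ≡ 1
count-one f zero    fa others rewrite fa =
  cong ℕ.suc (count-none (f ∘ suc) (λ i → others (suc i) λ ()))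
count-one f (suc a) fa others rewrite others zero (λ ()) =
  count-one (f ∘ suc) a fa (λ i i≢a → others (suc i) (i≢a ∘ Fin.suc-injective))

count-two : ∀ {n} (f : Fin n → Bool) a b → a ≢ b → f a ≡ true → f b ≡ true →
            (∀ i → i ≢ a → i ≢ b → f i ≡ false) → count f ≡ 2
count-two f zero    zero    a≢b fa fb others = contradiction refl a≢b
count-two f zero    (suc b) a≢b fa fb others rewrite fa = cong ℕ.suc
  (count-one (f ∘ suc) b fb (λ i i≢b → others (suc i) (λ ()) (i≢b ∘ Fin.suc-injective)))
count-two f (suc a) zero    a≢b fa fb others rewrite fb = cong ℕ.suc
  (count-one (f ∘ suc) a fa (λ i i≢a → others (suc i) (i≢a ∘ Fin.suc-injective) (λ ())))
count-two f (suc a) (suc b) a≢b fa fb others rewrite others zero (λ ()) (λ ()) =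
  count-two (f ∘ suc) a b (a≢b ∘ cong suc) fa fb
    (λ i i≢a i≢b → others (suc i) (i≢a ∘ Fin.suc-injective) (i≢b ∘ Fin.suc-injective))

∷-injective : ∀ {m n} {x : Fin n} {p : Fin m → Fin n} → Injective _≡_ _≡_ p →
              (∀ i → x ≢ p i) → Injective _≡_ _≡_ (x ∷ p)
∷-injective inj x∉p {zero}  {zero}  _  = refl
∷-injective inj x∉p {zero}  {suc j} eq = contradiction eq (x∉p j)
∷-injective inj x∉p {suc i} {zero}  eq = contradiction (sym eq) (x∉p i)
∷-injective inj x∉p {suc i} {suc j} eq = cong suc (inj eq)

module _ {n : ℕ} (G : Graph n) where
  open Graph G using (_~_; symmetric; loopless)

  ~-sym : ∀ {u v} → u ~ v → v ~ u
  ~-sym {u} {v} u~v = trans (symmetric v u) u~v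

  ~-irrefl : ∀ {u} → ¬ (u ~ u)
  ~-irrefl {u} u~u with trans (sym u~u) (loopless u)
  ... | ()

  _~?_ : ∀ u v → Dec (u ~ v)
  u ~? v = adj G u v ≟ᵇ true

  record Path (k : ℕ) (p : Fin (ℕ.suc k) → Fin n) : Set where
    field
      injective : Injective _≡_ _≡_ p
      step      : ∀ i → p (inject₁ i) ~ p (suc i)

  open Path

  path-singleton : ∀ v → Path 0 (v ∷ [])
  path-singleton v = record { injective = ∷-injective (λ { {()} }) (λ ()) ; step = λ () }

  path-∷ : ∀ {k p x} → Path k p → x ~ p zero → (∀ i → x ≢ p i) → Path (ℕ.suc k) (x ∷ p)
  path-∷ P x~p₀ x∉p = record
    { injective = ∷-injective (injective P) x∉p
    ; step      = λ { zero → x~p₀ ; (suc i) → step P i }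
    }

  path-tail : ∀ {k p} → Path (ℕ.suc k) p → Path k (p ∘ suc)
  path-tail P = record
    { injective = Fin.suc-injective ∘ injective P
    ; step      = step P ∘ suc
    }

  -- If x were the vertex at position j + 2 of the path, the edge from x to the front would close
  -- the first j + 3 vertices into a cycle. Positions 0 and 1 are too short for a cycle: the first
  -- is excluded because there are no loops, the second by hypothesis.
  path-fresh : Acyclic G → ∀ {k p x} → Path (ℕ.suc k) p →
               x ~ p zero → x ≢ p (suc zero) → ∀ i → x ≢ p i
  path-fresh acyclic P x~p₀ x≢p₁ zero       refl = ~-irrefl x~p₀
  path-fresh acyclic P x~p₀ x≢p₁ (suc zero) x≡p₁ = x≢p₁ x≡p₁
  path-fresh acyclic {k} {p} {x} P x~p₀ x≢p₁ (suc (suc j)) x≡pⱼ =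
    acyclic (toℕ j) c
      (λ {a} {b} eq → toℕ-injective (trans (sym (Fin.toℕ-inject≤ a bound))
        (trans (cong toℕ (injective P eq)) (Fin.toℕ-inject≤ b bound))))
      (λ i → subst (λ a → p a ~ c (suc i)) (inject-step i) (step P (inject≤ i (ℕ.s≤s⁻¹ bound))))
      (subst (_~ p zero) (trans x≡pⱼ (cong p last)) x~p₀)
    where
    bound : 3 ℕ.+ toℕ j ≤ ℕ.suc (ℕ.suc k)
    bound = s≤s (s≤s (Fin.toℕ<n j))
    c : Fin (3 ℕ.+ toℕ j) → Fin n
    c i = p (inject≤ i bound)
    inject-step : ∀ (i : Fin (2 ℕ.+ toℕ j)) →
                  inject₁ (inject≤ i (ℕ.s≤s⁻¹ bound)) ≡ inject≤ (inject₁ i) bound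
    inject-step i = toℕ-injective (trans (Fin.toℕ-inject₁ _) (trans (Fin.toℕ-inject≤ i _)
      (sym (trans (Fin.toℕ-inject≤ (inject₁ i) bound) (Fin.toℕ-inject₁ i)))))
    last : suc (suc j) ≡ inject≤ (Fin.fromℕ (2 ℕ.+ toℕ j)) bound
    last = toℕ-injective (sym (trans (Fin.toℕ-inject≤ (Fin.fromℕ (2 ℕ.+ toℕ j)) bound)
      (Fin.toℕ-fromℕ (2 ℕ.+ toℕ j))))

  third-neighbour : ∀ {v a b} → degree G v ≢ 2 → a ≢ b → v ~ a → v ~ b →
                    ∃[ w ] v ~ w × w ≢ a × w ≢ b
  third-neighbour {v} {a} {b} deg≢2 a≢b v~a v~b
    with any? (λ w → (v ~? w) ×-dec ¬? (w ≟ a) ×-dec ¬? (w ≟ b))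
  ... | yes found = found
  ... | no  none  = contradiction
    (count-two (adj G v) a b a≢b v~a v~b
      (λ i i≢a i≢b → ¬-not (λ v~i → none (i , v~i , i≢a , i≢b))))
    deg≢2

  record Fork : Set where
    field
      v a b y : Fin n
      a≢b     : a ≢ b
      a≢y     : a ≢ y
      b≢y     : b ≢ y
      v~a     : v ~ a
      v~b     : v ~ b
      v~y     : v ~ y
      a-leaf  : ∀ x → a ~ x → x ≡ v
      b-leaf  : ∀ x → b ~ x → x ≡ v

  leaf : ∀ {u v} → ¬ (∃[ x ] u ~ x × x ≢ v) → ∀ x → u ~ x → x ≡ v
  leaf {u} {v} none x u~x with x ≟ v
  ... | yes x≡v = x≡v
  ... | no  x≢v = contradiction (x , u~x , x≢v) none

  second-neighbour? : ∀ u v → Dec (∃[ x ] u ~ x × x ≢ v)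
  second-neighbour? u v = any? (λ x → (u ~? x) ×-dec ¬? (x ≟ v))

  -- Lengthens a path at its front until the first vertex and a sibling of it are both leaves;
  -- m bounds the number of vertices off the path.
  path⇒fork : Acyclic G → NoDegreeTwoVertex G →
              ∀ m k {p} → Path (2 ℕ.+ k) p → n ≤ m ℕ.+ k → Fork
  path⇒fork acyclic deg≢2 ℕ.zero k P n≤k =
    contradiction (ℕ.≤-trans (injective⇒≤ (injective P)) n≤k) (ℕ.<⇒≱ (ℕ.m<n+m k {3} (s≤s z≤n)))
  path⇒fork acyclic deg≢2 (ℕ.suc m) k {p} P n≤1+m+k
    with n≤m+1+k ← subst (n ≤_) (sym (ℕ.+-suc m k)) n≤1+m+k
       | second-neighbour? (p zero) (p (suc zero))
  ... | yes (x , p₀~x , x≢p₁) = path⇒fork acyclic deg≢2 m (ℕ.suc k)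
    (path-∷ P (~-sym p₀~x) (path-fresh acyclic P (~-sym p₀~x) x≢p₁)) n≤m+1+k
  ... | no none-p₀
    with w , p₁~w , w≢p₀ , w≢p₂ ← third-neighbour {b = p (suc (suc zero))} (deg≢2 (p (suc zero)))
           (λ eq → contradiction (injective P eq) λ ()) (~-sym (step P zero)) (step P (suc zero))
    with Q ← path-∷ (path-tail P) (~-sym p₁~w) (path-fresh acyclic (path-tail P) (~-sym p₁~w) w≢p₂)
       | second-neighbour? w (p (suc zero))
  ... | yes (x , w~x , x≢p₁) = path⇒fork acyclic deg≢2 m (ℕ.suc k)
    (path-∷ Q (~-sym w~x) (path-fresh acyclic Q (~-sym w~x) x≢p₁)) n≤m+1+k
  ... | no none-w = record
    { v = p (suc zero) ; a = p zero ; b = w ; y = p (suc (suc zero))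
    ; a≢b = w≢p₀ ∘ sym
    ; a≢y = λ eq → contradiction (injective P eq) λ ()
    ; b≢y = w≢p₂
    ; v~a = ~-sym (step P zero)
    ; v~b = p₁~w
    ; v~y = step P (suc zero)
    ; a-leaf = leaf none-p₀
    ; b-leaf = leaf none-w
    }

  star-closed : ∀ {u v w x} → (∀ z → u ~ z → z ≡ v) → (∀ z → v ~ z → z ≡ u) →
                Star _~_ w x → w ≡ u ⊎ w ≡ v → x ≡ u ⊎ x ≡ v
  star-closed u-leaf v-leaf nil             here        = here
  star-closed u-leaf v-leaf (_◅_ {j = j} w~j r) (inj₁ refl) = star-closed u-leaf v-leaf r (inj₂ (u-leaf j w~j))
  star-closed u-leaf v-leaf (_◅_ {j = j} w~j r) (inj₂ refl) = star-closed u-leaf v-leaf r (inj₁ (v-leaf j w~j))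

  path-of-length-2 : ∀ {u v w} → u ~ v → v ~ w → w ≢ u → ∃[ p ] Path 2 p
  path-of-length-2 {u} {v} {w} u~v v~w w≢u = _ ,
    path-∷ (path-∷ (path-singleton w) v~w (λ { zero refl → ~-irrefl v~w })) u~v
      (λ { zero refl → ~-irrefl u~v ; (suc zero) u≡w → w≢u (sym u≡w) })

  -- Take the first edge of a walk that leaves a. If neither of its ends has another neighbour, no
  -- walk leaves these two vertices, so b and c would both be the far end.
  connected⇒path-of-length-2 : Connected G → ∀ {a b c} → a ≢ b → a ≢ c → b ≢ c → ∃[ p ] Path 2 p
  connected⇒path-of-length-2 connected {a} {b} {c} a≢b a≢c b≢c with connected a b
  ... | nil = contradiction refl a≢b
  ... | _◅_ {j = x} a~x _ with second-neighbour? a x | second-neighbour? x a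
  ... | yes (y , a~y , y≢x) | _ = path-of-length-2 (~-sym a~x) a~y y≢x
  ... | no _ | yes (y , x~y , y≢a) = path-of-length-2 a~x x~y y≢a
  ... | no none-a | no none-x
    with star-closed (leaf none-a) (leaf none-x) (connected a b) (inj₁ refl)
       | star-closed (leaf none-a) (leaf none-x) (connected a c) (inj₁ refl)
  ... | inj₁ b≡a | _        = contradiction (sym b≡a) a≢b
  ... | inj₂ _   | inj₁ c≡a = contradiction (sym c≡a) a≢c
  ... | inj₂ b≡x | inj₂ c≡x = contradiction (trans b≡x (sym c≡x)) b≢c

tree⇒fork : ∀ {n} (G : Graph n) → 3 ≤ n → IsTree G → NoDegreeTwoVertex G → Fork G
tree⇒fork {n} G (s≤s (s≤s (s≤s _))) (_ , connected , acyclic) deg≢2 =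
  path⇒fork G acyclic deg≢2 n 0
    (proj₂ (connected⇒path-of-length-2 G connected {zero} {suc zero} {suc (suc zero)}
      (λ ()) (λ ()) (λ ())))
    (ℕ.≤-reflexive (sym (ℕ.+-identityʳ n)))

-- By the pigeonhole principle the four distinct vertices of the fork are all the vertices: one more
-- would embed `Fin 5` into `Fin n`. That `y` meets only `v` then follows from `a` and `b` being
-- leaves.
fork⇒≅K₁,₃ : ∀ {n} (G : Graph n) → n ≤ 4 → Fork G → G ≅ K₁,₃
fork⇒≅K₁,₃ {n} G n≤4 F = mk↔ₛ′ to g to∘g g∘to ,
  λ u w → trans (cong₂ (adj G) (sym (g∘to u)) (sym (g∘to w))) (adj-g (to u) (to w))
  where
  open Graph G using (_~_; loopless)
  open Fork F
  g : Fin 4 → Fin n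
  g = v ∷ a ∷ b ∷ y ∷ []
  v≢ : ∀ {x} → v ~ x → v ≢ x
  v≢ v~x refl = ~-irrefl G v~x
  g-injective : Injective _≡_ _≡_ g
  g-injective =
    ∷-injective {3} (∷-injective {2} (∷-injective {1} (∷-injective {0} (λ { {()} }) (λ ()))
      (λ { zero → b≢y }))
      (λ { zero → a≢b ; (suc zero) → a≢y }))
      (λ { zero → v≢ v~a ; (suc zero) → v≢ v~b ; (suc (suc zero)) → v≢ v~y })
  g-surjective : ∀ u → ∃[ i ] u ≡ g i
  g-surjective u with any? (λ i → u ≟ g i)
  ... | yes found = found
  ... | no  none  = contradiction
    (ℕ.≤-trans (injective⇒≤ (∷-injective g-injective (λ i u≡gi → none (i , u≡gi)))) n≤4) ℕ.1+n≰n
  to : Fin n → Fin 4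
  to u = proj₁ (g-surjective u)
  g∘to : ∀ u → g (to u) ≡ u
  g∘to u = sym (proj₂ (g-surjective u))
  to∘g : ∀ i → to (g i) ≡ i
  to∘g i = g-injective (g∘to (g i))
  leaf≁ : ∀ {u x} → (∀ z → u ~ z → z ≡ v) → v ~ x → adj G u x ≡ false
  leaf≁ u-leaf v~x = ¬-not (λ u~x → v≢ v~x (sym (u-leaf _ u~x)))
  flip : ∀ {u x t} → adj G u x ≡ t → adj G x u ≡ t
  flip {u} {x} eq = trans (Graph.symmetric G x u) eq
  adj-g : ∀ i j → adj G (g i) (g j) ≡ adj K₁,₃ i j
  adj-g zero zero = loopless v
  adj-g zero (suc zero) = v~a
  adj-g zero (suc (suc zero)) = v~b
  adj-g zero (suc (suc (suc zero))) = v~y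
  adj-g (suc zero) zero = flip v~a
  adj-g (suc zero) (suc zero) = loopless a
  adj-g (suc zero) (suc (suc zero)) = leaf≁ a-leaf v~b
  adj-g (suc zero) (suc (suc (suc zero))) = leaf≁ a-leaf v~y
  adj-g (suc (suc zero)) zero = flip v~b
  adj-g (suc (suc zero)) (suc zero) = leaf≁ b-leaf v~a
  adj-g (suc (suc zero)) (suc (suc zero)) = loopless b
  adj-g (suc (suc zero)) (suc (suc (suc zero))) = leaf≁ b-leaf v~y
  adj-g (suc (suc (suc zero))) zero = flip v~y
  adj-g (suc (suc (suc zero))) (suc zero) = flip (leaf≁ a-leaf v~y)
  adj-g (suc (suc (suc zero))) (suc (suc zero)) = flip (leaf≁ b-leaf v~y)
  adj-g (suc (suc (suc zero))) (suc (suc (suc zero))) = loopless y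

-- The combinatorics of K₁,₃

module ℕ-Sum = Sum ℕ.+-0-commutativeMonoid

-- Puts degrees into the form of a sum over a commutative monoid, where invariance under bijections
-- is available.
count≡sum : ∀ {n} (f : Fin n → Bool) → count f ≡ ℕ-Sum.sum (λ i → if f i then 1 else 0)
count≡sum {ℕ.zero}  f = refl
count≡sum {ℕ.suc n} f with f zero
... | true  = cong ℕ.suc (count≡sum (f ∘ suc))
... | false = count≡sum (f ∘ suc)

module _ {n : ℕ} (G : Graph n) (G≅K : G ≅ K₁,₃) where
  open Graph G using (_~_)

  private
    f : Fin n ↔ Fin 4
    f = proj₁ G≅K

  open Inverse f using (to; from; strictlyInverseˡ; strictlyInverseʳ)

  centre : Fin n
  centre = from zero

  ≅⇒nonZero : NonZero n
  ≅⇒nonZero = Fin.nonZeroIndex centre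

  ≢centre⇒≢zero : ∀ {u} → u ≢ centre → to u ≢ zero
  ≢centre⇒≢zero {u} u≢c tou≡0 = u≢c (trans (sym (strictlyInverseʳ u)) (cong from tou≡0))

  centre-~ : ∀ {u} → u ≢ centre → centre ~ u
  centre-~ {u} u≢c with to u in eq
  ... | zero  = contradiction eq (≢centre⇒≢zero u≢c)
  ... | suc i = trans (proj₂ G≅K centre u) (cong₂ (adj K₁,₃) (strictlyInverseˡ zero) eq)

  ~⇒centre : ∀ {u v} → u ~ v → u ≡ centre ⊎ v ≡ centre
  ~⇒centre {u} {v} u~v with u ≟ centre | v ≟ centre
  ... | yes u≡c | _       = inj₁ u≡c
  ... | no  _   | yes v≡c = inj₂ v≡c
  ... | no  u≢c | no  v≢c with to u in eqᵘ | to v in eqᵛ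
  ...   | zero  | _     = contradiction eqᵘ (≢centre⇒≢zero u≢c)
  ...   | suc _ | zero  = contradiction eqᵛ (≢centre⇒≢zero v≢c)
  ...   | suc i | suc j with trans (sym u~v) (trans (proj₂ G≅K u v) (cong₂ (adj K₁,₃) eqᵘ eqᵛ))
  ...     | ()

  ≅⇒connected : Connected G
  ≅⇒connected u v = to-centre (u ≟ centre) (v ≟ centre)
    where
    to-centre : Dec (u ≡ centre) → Dec (v ≡ centre) → Star _~_ u v
    to-centre (yes refl) (yes refl) = nil
    to-centre (yes refl) (no v≢c)   = centre-~ v≢c ◅ nil
    to-centre (no u≢c)   (yes refl) = ~-sym G (centre-~ u≢c) ◅ nil
    to-centre (no u≢c)   (no v≢c)   = ~-sym G (centre-~ u≢c) ◅ centre-~ v≢c ◅ nil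

  -- The edges c₁c₂ and c_last c₀ both contain the centre, so c₂ is the last vertex; but then c₀c₁ avoids it.
  ≅⇒acyclic : Acyclic G
  ≅⇒acyclic k c inj step closing
    with ~⇒centre (step (suc zero)) | ~⇒centre closing | ~⇒centre (step zero)
  ... | inj₁ c₁ | inj₁ cₗ | _ = contradiction (inj (trans c₁ (sym cₗ))) λ ()
  ... | inj₁ c₁ | inj₂ c₀ | _ = contradiction (inj (trans c₁ (sym c₀))) λ ()
  ... | inj₂ c₂ | inj₂ c₀ | _ = contradiction (inj (trans c₂ (sym c₀))) λ ()
  ... | inj₂ c₂ | inj₁ cₗ | inj₁ c₀ = contradiction (inj (trans c₂ (sym c₀))) λ ()
  ... | inj₂ c₂ | inj₁ cₗ | inj₂ c₁ = contradiction (inj (trans c₂ (sym c₁))) λ ()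

  ≅⇒isTree : IsTree G
  ≅⇒isTree = ≅⇒nonZero , ≅⇒connected , ≅⇒acyclic

  degree-≅ : ∀ u → degree G u ≡ degree K₁,₃ (to u)
  degree-≅ u = begin
    count (adj G u)                                         ≡⟨ count≡sum (adj G u) ⟩
    ℕ-Sum.sum (λ v → if adj G u v then 1 else 0)            ≡⟨ ℕ-Sum.sum-cong-≗ (λ v →
      cong (λ b → if b then 1 else 0) (proj₂ G≅K u v)) ⟩
    ℕ-Sum.sum (λ v → if adj K₁,₃ (to u) (to v) then 1 else 0) ≡⟨ ℕ-Sum.sum-permute (λ j → if adj K₁,₃ (to u) j then 1 else 0) f ⟨
    ℕ-Sum.sum (λ j → if adj K₁,₃ (to u) j then 1 else 0)    ≡⟨ count≡sum (adj K₁,₃ (to u)) ⟨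
    count (adj K₁,₃ (to u))                                 ∎
    where open ≡-Reasoning

  ≅⇒noDegreeTwoVertex : NoDegreeTwoVertex G
  ≅⇒noDegreeTwoVertex u rewrite degree-≅ u with to u
  ... | zero  = λ ()
  ... | suc _ = λ ()

-- Twins bound the number of vertices

infix 4 _≈[_]_

-- The identities below hold exactly on each rational approximant, so no limit is ever taken.
_≈[_]_ : ℂ → ℕ → ℂ → Set
z ≈[ p ] w = seq (re z) p ≡ seq (re w) p × seq (im z) p ≡ seq (im w) p

≈-reflexive : ∀ {z w p} → z ≡ w → z ≈[ p ] w
≈-reflexive refl = refl , refl

*ᶜ-cong : ∀ p {x x′ y y′} → x ≈[ p ] x′ → y ≈[ p ] y′ → x *ᶜ y ≈[ p ] x′ *ᶜ y′
*ᶜ-cong p (a , b) (c , d) =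
  cong₂ _+_ (cong₂ _*_ a c) (cong -_ (cong₂ _*_ b d)) , cong₂ _+_ (cong₂ _*_ a d) (cong₂ _*_ b c)

sum : ∀ {n} → Vector ℚ n → ℚ
sum = foldr _+_ 0ℚ

sum-cong : ∀ {n} {x y : Vector ℚ n} → (∀ i → x i ≡ y i) → sum x ≡ sum y
sum-cong {ℕ.zero}  x≡y = refl
sum-cong {ℕ.suc n} x≡y = cong₂ _+_ (x≡y zero) (sum-cong (x≡y ∘ suc))

sum-zero : ∀ n → sum {n} (λ _ → 0ℚ) ≡ 0ℚ
sum-zero ℕ.zero    = refl
sum-zero (ℕ.suc n) = trans (ℚ.+-identityˡ (sum {n} (λ _ → 0ℚ))) (sum-zero n)

seq-re-∑ : ∀ p {n} (x : Vector ℂ n) → seq (re (∑ x)) p ≡ sum (λ i → seq (re (x i)) p)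
seq-re-∑ p {ℕ.zero}  x = refl
seq-re-∑ p {ℕ.suc n} x = cong (λ s → seq (re (x zero)) p + s) (seq-re-∑ p (x ∘ suc))

seq-im-∑ : ∀ p {n} (x : Vector ℂ n) → seq (im (∑ x)) p ≡ sum (λ i → seq (im (x i)) p)
seq-im-∑ p {ℕ.zero}  x = refl
seq-im-∑ p {ℕ.suc n} x = cong (λ s → seq (im (x zero)) p + s) (seq-im-∑ p (x ∘ suc))

∑-cong : ∀ p {n} (x y : Vector ℂ n) → (∀ i → x i ≈[ p ] y i) → ∑ x ≈[ p ] ∑ y
∑-cong p x y x≈y =
  trans (seq-re-∑ p x) (trans (sum-cong (proj₁ ∘ x≈y)) (sym (seq-re-∑ p y))) ,
  trans (seq-im-∑ p x) (trans (sum-cong (proj₂ ∘ x≈y)) (sym (seq-im-∑ p y)))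

*ᶜ-zeroʳ : ∀ p z → z *ᶜ 0ᶜ ≈[ p ] 0ᶜ
*ᶜ-zeroʳ p z =
  solve 2 (λ x y → x :* con 0ℚ :+ :- (y :* con 0ℚ) := con 0ℚ) refl (seq (re z) p) (seq (im z) p) ,
  solve 2 (λ x y → x :* con 0ℚ :+ y :* con 0ℚ := con 0ℚ) refl (seq (re z) p) (seq (im z) p)

*ᶜ-identityʳ : ∀ p z → z *ᶜ 1ᶜ ≈[ p ] z
*ᶜ-identityʳ p z =
  solve 2 (λ x y → x :* con 1ℚ :+ :- (y :* con 0ℚ) := x) refl (seq (re z) p) (seq (im z) p) ,
  solve 2 (λ x y → x :* con 0ℚ :+ y :* con 1ℚ := y) refl (seq (re z) p) (seq (im z) p)

sum-basis : ∀ {n} (q : Fin n → ℚ) u → sum (λ w → if does (u ≟ w) then q w else 0ℚ) ≡ q u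
sum-basis {ℕ.suc n} q zero    =
  trans (cong (λ s → q zero + s) (sum-zero n)) (ℚ.+-identityʳ (q zero))
sum-basis {ℕ.suc n} q (suc u) = trans (ℚ.+-identityˡ (sum (λ w → if does (u ≟ w) then q (suc w) else 0ℚ))) (sum-basis (q ∘ suc) u)

∑-basis : ∀ p {n} (x : Vector ℂ n) u → ∑ (λ w → x w *ᶜ basis u w) ≈[ p ] x u
∑-basis p {n} x u =
  trans (seq-re-∑ p x·eᵤ) (trans (sum-cong (proj₁ ∘ term)) (sum-basis (λ w → seq (re (x w)) p) u)) ,
  trans (seq-im-∑ p x·eᵤ) (trans (sum-cong (proj₂ ∘ term)) (sum-basis (λ w → seq (im (x w)) p) u))
  where
  x·eᵤ : Vector ℂ n
  x·eᵤ w = x w *ᶜ basis u w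
  term : ∀ w → seq (re (x·eᵤ w)) p ≡ (if does (u ≟ w) then seq (re (x w)) p else 0ℚ) ×
               seq (im (x·eᵤ w)) p ≡ (if does (u ≟ w) then seq (im (x w)) p else 0ℚ)
  term w with does (u ≟ w)
  ... | true  = *ᶜ-identityʳ p (x w)
  ... | false = *ᶜ-zeroʳ p (x w)

basis-≡ : ∀ {n} (u : Fin n) → basis u u ≡ 1ᶜ
basis-≡ u = cong (if_then 1ᶜ else 0ᶜ) (dec-true (u ≟ u) refl)

basis-≢ : ∀ {n} {u v : Fin n} → u ≢ v → basis u v ≡ 0ᶜ
basis-≢ {u = u} {v} u≢v = cong (if_then 1ᶜ else 0ᶜ) (dec-false (u ≟ v) u≢v)

-- Squared moduli of a column, and the norm

normSq : ℂ → ℕ → ℚ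
normSq z p = seq (re z) p * seq (re z) p + seq (im z) p * seq (im z) p

abstract
  -- The Schur product of a column with its conjugate lists squared moduli. The vector whose norm
  -- mixing bounds is thus real, with entries |M_ju|² - c.
  defect-re : ∀ {n} (M : Matrix n) u c j p →
              seq (re ((((M ⊡ basis u) ∘ᵛ (conjᴹ M ⊡ basis u)) -ᵛ constant (fromℝ (fromℚ c))) j)) p ≡ normSq (M j u) p + - c
  defect-re M u c j p =
    let a , b = ∑-basis p (M j) u
        a′ , b′ = ∑-basis p (conjᴹ M j) u
    in cong (λ t → t + - c) (trans
         (cong₂ (λ s t → s + - t) (cong₂ _*_ a a′) (cong₂ _*_ b b′))
         (solve 2 (λ x y → x :* x :+ :- (y :* :- y) := x :* x :+ y :* y) refl
           (seq (re (M j u)) p) (seq (im (M j u)) p)))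

  defect-im : ∀ {n} (M : Matrix n) u c j p → seq (im ((((M ⊡ basis u) ∘ᵛ (conjᴹ M ⊡ basis u)) -ᵛ constant (fromℝ (fromℚ c))) j)) p ≡ 0ℚ
  defect-im M u c j p =
    let a , b = ∑-basis p (M j) u
        a′ , b′ = ∑-basis p (conjᴹ M j) u
    in trans (cong (_+ - 0ℚ) (cong₂ _+_ (cong₂ _*_ a b′) (cong₂ _*_ b a′)))
         (solve 2 (λ x y → (x :* :- y :+ y :* x) :+ :- con 0ℚ := con 0ℚ) refl
           (seq (re (M j u)) p) (seq (im (M j u)) p))

  0≤p*p : ∀ q → 0ℚ ≤ℚ q * q
  0≤p*p q with ℚ.∣p∣≡p∨∣p∣≡-p q
  ... | inj₁ eq = subst (0ℚ ≤ℚ_) (cong₂ _*_ eq eq) (*-nonNeg (ℚ.0≤∣p∣ q) (ℚ.0≤∣p∣ q))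
  ... | inj₂ eq = subst (0ℚ ≤ℚ_)
    (trans (cong₂ _*_ eq eq) (solve 1 (λ q → (:- q) :* (:- q) := q :* q) refl q))
    (*-nonNeg (ℚ.0≤∣p∣ q) (ℚ.0≤∣p∣ q))

  square-cancel-≤ : ∀ {p q} → 0ℚ ≤ℚ q → p * p ≤ℚ q * q → p ≤ℚ q
  square-cancel-≤ {p} {q} 0≤q p²≤q² = ℚ.≮⇒≥ λ q<p → ℚ.<-irrefl refl (begin-strict
    p * p ≤⟨ p²≤q² ⟩
    q * q ≤⟨ ℚ.*-monoˡ-≤-nonNeg q {{ℚ.nonNegative 0≤q}} (ℚ.<⇒≤ q<p) ⟩
    q * p <⟨ ℚ.*-monoˡ-<-pos p {{ℚ.positive (ℚ.≤-<-trans 0≤q q<p)}} q<p ⟩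
    p * p ∎)
    where open ℚ.≤-Reasoning

sumSq : ∀ {n} → Vector ℂ n → ℝ
sumSq v = foldr _+ᴿ_ 0ᴿ (λ i → ∣ v i ∣²)

abstract
  normSq-nonNeg : ∀ z p → 0ℚ ≤ℚ normSq z p
  normSq-nonNeg z p = +-nonNeg (0≤p*p (seq (re z) p)) (0≤p*p (seq (im z) p))

  sumSq-nonNeg : ∀ {n} (v : Vector ℂ n) p → 0ℚ ≤ℚ seq (sumSq v) p
  sumSq-nonNeg {ℕ.zero}  v p = ℚ.≤-refl
  sumSq-nonNeg {ℕ.suc n} v p = +-nonNeg (normSq-nonNeg (v zero) p) (sumSq-nonNeg (v ∘ suc) p)

  normSq≤sumSq : ∀ {n} (v : Vector ℂ n) j p → normSq (v j) p ≤ℚ seq (sumSq v) p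
  normSq≤sumSq v zero    p = ≤-by (seq (sumSq (v ∘ suc)) p) (sumSq-nonNeg (v ∘ suc) p) refl
  normSq≤sumSq v (suc j) p = ℚ.≤-trans (normSq≤sumSq (v ∘ suc) j p)
    (≤-by (normSq (v zero) p) (normSq-nonNeg (v zero) p)
      (ℚ.+-comm (seq (sumSq (v ∘ suc)) p) (normSq (v zero) p)))

  -- The square root is rounded down by less than 1/(p+1). The margin δ inside `_<ᴿ_` absorbs this
  -- rounding as soon as 1/(p+1) ≤ δ.
  ‖‖<⇒re≤ : ∀ {n} (v : Vector ℂ n) {ε} → 0ℚ ≤ℚ ε → ‖ v ‖ <ᴿ fromℚ ε →
            ∃[ N ] (∀ p → N ℕ.≤ p → ∀ j → seq (re (v j)) p ≤ℚ ε)
  ‖‖<⇒re≤ v {ε} 0≤ε (δ , 0<δ , N , s+δ≤ε) = N ℕ.⊔ M , bound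
    where
    M : ℕ
    M = proj₁ (archimedean 0<δ)
    open ℚ.≤-Reasoning
    bound : ∀ p → N ℕ.⊔ M ℕ.≤ p → ∀ j → seq (re (v j)) p ≤ℚ ε
    bound p N⊔M≤p j = square-cancel-≤ 0≤ε (begin
      x * x              ≤⟨ ≤-by (seq (im (v j)) p * seq (im (v j)) p) (0≤p*p (seq (im (v j)) p)) refl ⟩
      normSq (v j) p     ≤⟨ normSq≤sumSq v j p ⟩
      S                  ≤⟨ ℚ.p≤p⊔q S 0ℚ ⟩
      S ⊔ 0ℚ             ≤⟨ ℚ.<⇒≤ (√-approx-upper p (S ⊔ 0ℚ)) ⟩
      (s + h) * (s + h)  ≤⟨ *-self-mono-≤ (+-nonNeg (√-approx-nonNeg p (S ⊔ 0ℚ)) (ℚ.<⇒≤ (1/1+-pos p)))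
                              (ℚ.≤-trans (ℚ.+-monoʳ-≤ s (ℚ.<⇒≤ (proj₂ (archimedean 0<δ) (ℕ.m⊔n≤o⇒n≤o N M N⊔M≤p))))
                                (s+δ≤ε p (ℕ.m⊔n≤o⇒m≤o N M N⊔M≤p))) ⟩
      ε * ε              ∎)
      where
      x S s h : ℚ
      x = seq (re (v j)) p
      S = seq (sumSq v) p
      s = √-approx p (S ⊔ 0ℚ)
      h = 1/1+ p

  -- The sharp bound nη² has in general no rational square root; the cruder (nη)² has one, and n is
  -- fixed.
  sumSq-bound : ∀ {n} (v : Vector ℂ n) p {η} → 0ℚ ≤ℚ η →
                (∀ j → normSq (v j) p ≤ℚ η * η) → seq (sumSq v) p ≤ℚ (fromℕ n * η) * (fromℕ n * η)
  sumSq-bound {ℕ.zero}  v p {η} 0≤η bound = 0≤p*p (fromℕ 0 * η)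
  sumSq-bound {ℕ.suc n} v p {η} 0≤η bound = begin
    normSq (v zero) p + seq (sumSq (v ∘ suc)) p  ≤⟨ ℚ.+-mono-≤ (bound zero) (sumSq-bound (v ∘ suc) p 0≤η (bound ∘ suc)) ⟩
    η * η + (m * η) * (m * η)                    ≤⟨ ≤-by ((m * η) * η + (m * η) * η) (+-nonNeg 0≤mηη 0≤mηη)
      (solve 2 (λ m η → (η :* η :+ (m :* η) :* (m :* η)) :+ ((m :* η) :* η :+ (m :* η) :* η)
                        := ((con 1ℚ :+ m) :* η) :* ((con 1ℚ :+ m) :* η)) refl m η) ⟩
    ((1ℚ + m) * η) * ((1ℚ + m) * η)              ≡⟨ cong (λ k → (k * η) * (k * η)) (fromℕ-suc n) ⟨
    (fromℕ (ℕ.suc n) * η) * (fromℕ (ℕ.suc n) * η) ∎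
    where
    open ℚ.≤-Reasoning
    m : ℚ
    m = fromℕ n
    0≤mηη : 0ℚ ≤ℚ (m * η) * η
    0≤mηη = *-nonNeg (*-nonNeg (fromℕ-nonNeg n) 0≤η) 0≤η

  -- In this direction rounding costs nothing, since the approximate root never exceeds the true
  -- one. The margin δ is passed on as the witness of strictness.
  normSq-bounded⇒‖‖< : ∀ {n} (v : Vector ℂ n) {η δ ε} → 0ℚ ≤ℚ η → 0ℚ < δ →
    ∃[ N ] (∀ p → N ℕ.≤ p → fromℕ n * η + δ ≤ℚ seq ε p) →
    ∃[ M ] (∀ p → M ℕ.≤ p → ∀ j → normSq (v j) p ≤ℚ η * η) → ‖ v ‖ <ᴿ ε
  normSq-bounded⇒‖‖< {n} v {η} {δ} {ε} 0≤η 0<δ (N , hN) (M , hM) = δ , 0<δ , N ℕ.⊔ M , λ p N⊔M≤p →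
    ℚ.≤-trans (ℚ.+-monoˡ-≤ δ {√-approx p (seq (sumSq v) p ⊔ 0ℚ)} {fromℕ n * η} (square-cancel-≤ (*-nonNeg (fromℕ-nonNeg n) 0≤η) (ℚ.≤-trans
      (√-approx-lower p (ℚ.p≤q⊔p (seq (sumSq v) p) 0ℚ))
      (ℚ.≤-trans (ℚ.≤-reflexive (ℚ.p≥q⇒p⊔q≡p (sumSq-nonNeg v p)))
        (sumSq-bound v p 0≤η (hM p (ℕ.m⊔n≤o⇒n≤o N M N⊔M≤p)))))))
      (hN p (ℕ.m⊔n≤o⇒m≤o N M N⊔M≤p))

  1/-antimono-≤ : ∀ {m n} .{{_ : NonZero m}} .{{_ : NonZero n}} → m ℕ.≤ n → + 1 / n ≤ℚ + 1 / m
  1/-antimono-≤ {ℕ.suc m} {ℕ.suc n} m≤n = ℚ.toℚᵘ-cancel-≤ (begin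
    ℚ.toℚᵘ (+ 1 / ℕ.suc n) ≃⟨ ℚ.toℚᵘ-fromℚᵘ (ℚᵘ.mkℚᵘ (+ 1) n) ⟩
    ℚᵘ.mkℚᵘ (+ 1) n        ≤⟨ ℚᵘ.*≤* (ℤ.+≤+ (ℕ.*-monoʳ-≤ 1 m≤n)) ⟩
    ℚᵘ.mkℚᵘ (+ 1) m        ≃⟨ ℚ.toℚᵘ-fromℚᵘ (ℚᵘ.mkℚᵘ (+ 1) m) ⟨
    ℚ.toℚᵘ (+ 1 / ℕ.suc m) ∎)
    where open ℚᵘ.≤-Reasoning

-- Twins in the exponential

module _ {n : ℕ} (M : Matrix n) {a b : Fin n} (a≢b : a ≢ b) (rows : ∀ w → M a w ≡ M b w) where

  abstract
    -- The row index enters only through the leftmost factor, so one factor must be present. The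
    -- power 0 does distinguish the rows, and it is the source of the difference 1.
    twins-powers : ∀ p k v → (M ^ᴹ ℕ.suc k) a v ≈[ p ] (M ^ᴹ ℕ.suc k) b v
    twins-powers p k v = ∑-cong p (λ w → M a w *ᶜ (M ^ᴹ k) w v) (λ w → M b w *ᶜ (M ^ᴹ k) w v)
      (λ w → *ᶜ-cong p {M a w} {M b w} {(M ^ᴹ k) w v} {(M ^ᴹ k) w v} (≈-reflexive (rows w)) (refl , refl))

    -- M (e_a − e_b) = 0 when M is symmetric, so the exponential fixes e_a − e_b.
    twins-expPartial : ∀ p k → expPartial M (ℕ.suc k) a a ≈[ p ] expPartial M (ℕ.suc k) b a +ᶜ 1ᶜ
    twins-expPartial p ℕ.zero = first (basis-≡ a) (basis-≢ (≢-sym a≢b))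
      where
      first : ∀ {x y} → x ≡ 1ᶜ → y ≡ 0ᶜ →
              0ᶜ +ᶜ fromℝ (fromℚ 1ℚ) *ᶜ x ≈[ p ] (0ᶜ +ᶜ fromℝ (fromℚ 1ℚ) *ᶜ y) +ᶜ 1ᶜ
      first refl refl = refl , refl
    twins-expPartial p (ℕ.suc k) =
      let x , y = twins-expPartial p k
          s , t = *ᶜ-cong p {F} {F} {(M ^ᴹ ℕ.suc k) a a} {(M ^ᴹ ℕ.suc k) b a} (refl , refl) (twins-powers p k a)
      in trans (cong₂ _+_ x s) (swap (seq (re (expPartial M (ℕ.suc k) b a)) p) (seq (re (F *ᶜ (M ^ᴹ ℕ.suc k) b a)) p) 1ℚ) ,
         trans (cong₂ _+_ y t) (swap (seq (im (expPartial M (ℕ.suc k) b a)) p) (seq (im (F *ᶜ (M ^ᴹ ℕ.suc k) b a)) p) 0ℚ)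
      where
      F : ℂ
      F = fromℝ (fromℚ (1/ ℕ.suc k !))
      swap : ∀ x y c → (x + c) + y ≡ (x + y) + c
      swap = solve 3 (λ x y c → (x :+ c) :+ y := (x :+ y) :+ c) refl

    -- Approximant q of the exponential is the partial sum with q terms. It is empty for q = 0,
    -- hence the successor.
    twins-exp : ∀ p → exp M a a ≈[ ℕ.suc p ] exp M b a +ᶜ 1ᶜ
    twins-exp p = twins-expPartial (ℕ.suc p) p

-- Mixing for one fixed ε, with a variable `c` as target; `+ 1 / n` comes in only through an
-- equation with `c`.
MixingWithin : ∀ {n} → Graph n → ℚ → ℝ → Set
MixingWithin G c ε = Σ[ τ ∈ ℝ ] (∀ u →
  ‖ ((U G τ ⊡ basis u) ∘ᵛ (conjᴹ (U G τ) ⊡ basis u)) -ᵛ constant (fromℝ (fromℚ c)) ‖ <ᴿ ε)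

abstract
  twins-rows : ∀ {n} (G : Graph n) z {a b} → (∀ w → adj G a w ≡ adj G b w) →
               ∀ w → (z · adjacency G) a w ≡ (z · adjacency G) b w
  twins-rows G z {a} {b} twins w = cong (λ t → z *ᶜ t) {adjacency G a w} {adjacency G b w}
    (cong (λ t → if t then 1ᶜ else 0ᶜ) (twins w))

  -- (x + 1)² + x² ≥ 1/2 with equality at x = −1/2.
  consecutive-squares : ∀ x y {c} → (x + 1ℚ) * (x + 1ℚ) + y * y ≤ℚ c → x * x + y * y ≤ℚ c → ½ ≤ℚ c + c
  consecutive-squares x y {c} h₁ h₂ = ℚ.≤-trans
    (≤-by (½ * ((x + x + 1ℚ) * (x + x + 1ℚ)) + (y * y + y * y))
      (+-nonNeg (*-nonNeg (ℚ.nonNegative⁻¹ ½) (0≤p*p (x + x + 1ℚ))) (+-nonNeg (0≤p*p y) (0≤p*p y)))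
      (solve 2 (λ x y → con ½ :+ (con ½ :* ((x :+ x :+ con 1ℚ) :* (x :+ x :+ con 1ℚ)) :+ (y :* y :+ y :* y))
        := ((x :+ con 1ℚ) :* (x :+ con 1ℚ) :+ y :* y) :+ (x :* x :+ y :* y)) refl x y))
    (ℚ.+-mono-≤ h₁ h₂)

  -- One late index suffices: there the entries of column a in rows a and b differ by exactly 1, and
  -- both squared moduli are at most c + ε.
  shift⇒½≤ : ∀ {n} (V : Matrix n) a b → (∀ p → V a a ≈[ ℕ.suc p ] V b a +ᶜ 1ᶜ) →
             ∀ c {ε} → 0ℚ ≤ℚ ε → ‖ ((V ⊡ basis a) ∘ᵛ (conjᴹ V ⊡ basis a)) -ᵛ constant (fromℝ (fromℚ c)) ‖ <ᴿ fromℚ ε → ½ ≤ℚ (c + ε) + (c + ε)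
  shift⇒½≤ V a b shift c {ε} 0≤ε mixes =
    let N , bound = ‖‖<⇒re≤ (((V ⊡ basis a) ∘ᵛ (conjᴹ V ⊡ basis a)) -ᵛ constant (fromℝ (fromℚ c))) 0≤ε mixes
        x = seq (re (V b a)) (ℕ.suc N)
        y = seq (im (V b a)) (ℕ.suc N)
        entry = λ j → subst (_≤ℚ c + ε)
          (solve 2 (λ q c → c :+ (q :+ :- c) := q) refl (normSq (V j a) (ℕ.suc N)) c)
          (ℚ.+-monoʳ-≤ c (subst (_≤ℚ ε) (defect-re V a c j (ℕ.suc N)) (bound (ℕ.suc N) (ℕ.n≤1+n N) j)))
    in consecutive-squares x y
         (subst (_≤ℚ c + ε)
           (cong₂ (λ s t → s * s + t * t) (proj₁ (shift N)) (trans (proj₂ (shift N)) (ℚ.+-identityʳ y))) (entry a))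
         (entry b)

  twins⇒½≤ : ∀ {n} (G : Graph n) {a b} → a ≢ b → (∀ w → adj G a w ≡ adj G b w) →
    ∀ c ε → 0ℚ ≤ℚ ε →
    MixingWithin G c (fromℚ ε) →
    ½ ≤ℚ (c + ε) + (c + ε)
  twins⇒½≤ G {a} {b} a≢b twins c ε 0≤ε (τ , mixes) = shift⇒½≤ (U G τ) a b
    (twins-exp ((𝕚 *ᶜ fromℝ τ) · adjacency G) a≢b (twins-rows G (𝕚 *ᶜ fromℝ τ) twins))
    c 0≤ε (mixes a)

  mixing-at : ∀ {n} .{{_ : NonZero n}} (G : Graph n) → EpsilonUniformMixing G →
    ∀ {c} → c ≡ + 1 / n → ∀ ε → 0ᴿ <ᴿ fromℚ ε → MixingWithin G c (fromℚ ε)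
  mixing-at G mixing refl ε 0<ε = mixing (fromℚ ε) 0<ε

  0ᴿ<fromℚ : ∀ {ε} → 0ℚ < ε → 0ᴿ <ᴿ fromℚ ε
  0ᴿ<fromℚ {ε} 0<ε = ε , 0<ε , 0 , λ _ _ → ℚ.≤-reflexive (ℚ.+-identityˡ ε)

  mixing⇒½≤ : ∀ {n} .{{_ : NonZero n}} (G : Graph n) {a b} → a ≢ b →
    (∀ w → adj G a w ≡ adj G b w) → EpsilonUniformMixing G →
    ∀ {c} → c ≡ + 1 / n → ∀ ε → 0ℚ < ε → ½ ≤ℚ (c + ε) + (c + ε)
  mixing⇒½≤ {n} {{nz}} G a≢b twins mixing {c} c≡1/n ε 0<ε =
    let mixes = mixing-at {n} {{nz}} G mixing {c} c≡1/n ε (0ᴿ<fromℚ 0<ε)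
    in twins⇒½≤ G a≢b twins c ε (ℚ.<⇒≤ 0<ε) mixes

  twins⇒n≤4 : ∀ {n} .{{_ : NonZero n}} (G : Graph n) {a b} → a ≢ b →
              (∀ w → adj G a w ≡ adj G b w) → EpsilonUniformMixing G → n ℕ.≤ 4
  twins⇒n≤4 {n} {{nz}} G a≢b twins mixing = ℕ.≮⇒≥ λ 5≤n →
    -- For n ≥ 5 any ε below 1/20 contradicts 1/2 ≤ 2(1/n + ε); here 2(1/5 + 1/25) = 12/25.
    let ε = + 1 / 25
        c≤⅕ = ℚ.+-monoˡ-≤ ε (1/-antimono-≤ 5≤n)
    in ℚ.<-irrefl refl (ℚ.≤-<-trans
         (ℚ.≤-trans (mixing⇒½≤ {n} {{nz}} G a≢b twins mixing {+ 1 / n} refl ε (ℚ.positive⁻¹ ε)) (ℚ.+-mono-≤ c≤⅕ c≤⅕))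
         (from-yes (((+ 1 / 5 + ε) + (+ 1 / 5 + ε)) ℚ.<? ½)))

  fork⇒n≤4 : ∀ {n} .{{_ : NonZero n}} (G : Graph n) → Fork G → EpsilonUniformMixing G → n ℕ.≤ 4
  fork⇒n≤4 {n} {{nz}} G F = twins⇒n≤4 {n} {{nz}} G (Fork.a≢b F) twins
    where
    open Fork F
    twins : ∀ w → adj G a w ≡ adj G b w
    twins w with w ≟ v
    ... | yes refl = trans (~-sym G v~a) (sym (~-sym G v~b))
    ... | no  w≢v  = trans (¬-not (w≢v ∘ a-leaf w)) (sym (¬-not (w≢v ∘ b-leaf w)))

-- The equation cos (√3 t) = −1/2

abstract
  ∣+∣≤ : ∀ {x y a b} → ∣ x ∣ ≤ℚ a → ∣ y ∣ ≤ℚ b → ∣ x + y ∣ ≤ℚ a + b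
  ∣+∣≤ {x} {y} x≤a y≤b = ℚ.≤-trans (ℚ.∣p+q∣≤∣p∣+∣q∣ x y) (ℚ.+-mono-≤ x≤a y≤b)

  ∣*∣≤ : ∀ {x y a b} → ∣ x ∣ ≤ℚ a → ∣ y ∣ ≤ℚ b → ∣ x * y ∣ ≤ℚ a * b
  ∣*∣≤ {x} {y} {a} {b} x≤a y≤b = subst (_≤ℚ a * b) (sym (ℚ.∣p*q∣≡∣p∣*∣q∣ x y))
    (*-mono-nonNeg (ℚ.0≤∣p∣ y) (ℚ.≤-trans (ℚ.0≤∣p∣ x) x≤a) x≤a y≤b)

  ∣-∣≤ : ∀ {x a} → ∣ x ∣ ≤ℚ a → ∣ - x ∣ ≤ℚ a
  ∣-∣≤ {x} {a} = subst (_≤ℚ a) (sym (ℚ.∣-p∣≡∣p∣ x))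

  nonNeg⇒∣∣≤ : ∀ {x} → 0ℚ ≤ℚ x → ∣ x ∣ ≤ℚ x
  nonNeg⇒∣∣≤ 0≤x = ℚ.≤-reflexive (ℚ.0≤p⇒∣p∣≡p 0≤x)

-- Divided powers and their second-order expansion

divPow : ℕ → ℚ → ℚ
divPow k x = 1/ k ! * x ^ℚ k

abstract
  divPow-nonNeg : ∀ k {x} → 0ℚ ≤ℚ x → 0ℚ ≤ℚ divPow k x
  divPow-nonNeg k 0≤x = *-nonNeg (1/!-nonNeg k) (^ℚ-nonNeg 0≤x k)

  divPow-suc : ∀ k x → divPow (ℕ.suc k) x ≡ x * divPow k x * 1/1+ k
  divPow-suc k x = solve 4 (λ f u x y → (f :* u) :* (x :* y) := x :* (f :* y) :* u)
    refl (1/ k !) (1/1+ k) x (x ^ℚ k)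

  divPow-suc′ : ∀ k x → fromℕ (ℕ.suc k) * divPow (ℕ.suc k) x ≡ x * divPow k x
  divPow-suc′ k x = trans (cong (fromℕ (ℕ.suc k) *_) (divPow-suc k x))
    (trans (solve 3 (λ n y u → n :* (y :* u) := (n :* u) :* y) refl (fromℕ (ℕ.suc k)) (x * divPow k x) (1/1+ k))
      (trans (cong (_* (x * divPow k x)) (1+*1/1+ k)) (ℚ.*-identityˡ (x * divPow k x))))

  ^ℚ-mono : ∀ k {x y} → 0ℚ ≤ℚ x → x ≤ℚ y → x ^ℚ k ≤ℚ y ^ℚ k
  ^ℚ-mono ℕ.zero    0≤x x≤y = ℚ.≤-refl
  ^ℚ-mono (ℕ.suc k) 0≤x x≤y =
    *-mono-nonNeg (^ℚ-nonNeg 0≤x k) (ℚ.≤-trans 0≤x x≤y) x≤y (^ℚ-mono k 0≤x x≤y)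

  divPow-mono : ∀ k {x y} → 0ℚ ≤ℚ x → x ≤ℚ y → divPow k x ≤ℚ divPow k y
  divPow-mono k 0≤x x≤y =
    *-mono-nonNeg (^ℚ-nonNeg 0≤x k) (1/!-nonNeg k) ℚ.≤-refl (^ℚ-mono k 0≤x x≤y)

  ^ℚ-* : ∀ k x y → x ^ℚ k * y ^ℚ k ≡ (x * y) ^ℚ k
  ^ℚ-* ℕ.zero    x y = refl
  ^ℚ-* (ℕ.suc k) x y = trans
    (solve 4 (λ x y a b → (x :* a) :* (y :* b) := (x :* y) :* (a :* b)) refl x y (x ^ℚ k) (y ^ℚ k))
    (cong (x * y *_) (^ℚ-* k x y))

  divPow-* : ∀ k x y → x ^ℚ k * divPow k y ≡ divPow k (x * y)
  divPow-* k x y = trans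
    (solve 3 (λ a f b → a :* (f :* b) := f :* (a :* b)) refl (x ^ℚ k) (1/ k !) (y ^ℚ k))
    (cong (1/ k ! *_) (^ℚ-* k x y))

-- Exact second-order Taylor remainder of the divided power, divided by h².
remainder : ℕ → ℚ → ℚ → ℚ
remainder ℕ.zero              x h = 0ℚ
remainder (ℕ.suc ℕ.zero)      x h = 0ℚ
remainder (ℕ.suc (ℕ.suc k)) x h = (divPow k x + (x + h) * remainder (ℕ.suc k) x h) * 1/1+ (ℕ.suc k)

abstract
  -- Induction multiplies the previous expansion by (x + h)/(k + 2). The part with factor h² is by
  -- definition the next remainder, and the linear coefficient collapses because x · x^k/k! is k + 1
  -- times the next divided power.
  divPow-taylor : ∀ k x h → divPow (ℕ.suc k) (x + h) ≡
                  divPow (ℕ.suc k) x + h * divPow k x + h * h * remainder (ℕ.suc k) x h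
  divPow-taylor ℕ.zero x h = solve 2 (λ x h →
      con 1ℚ :* ((x :+ h) :* con 1ℚ) := con 1ℚ :* (x :* con 1ℚ) :+ h :* con 1ℚ :+ h :* h :* con 0ℚ)
    refl x h
  divPow-taylor (ℕ.suc k) x h = begin
    divPow (2 ℕ.+ k) (x + h)
      ≡⟨ divPow-suc (ℕ.suc k) (x + h) ⟩
    (x + h) * divPow (ℕ.suc k) (x + h) * u
      ≡⟨ cong (λ z → (x + h) * z * u) (divPow-taylor k x h) ⟩
    (x + h) * (E₁ + h * E₀ + h * h * r) * u
      ≡⟨ solve 6 (λ x h E₁ E₀ r u → (x :+ h) :* (E₁ :+ h :* E₀ :+ h :* h :* r) :* u
           := (x :* E₁ :* u :+ h :* ((E₁ :+ x :* E₀) :* u)) :+ h :* h :* ((E₀ :+ (x :+ h) :* r) :* u))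
         refl x h E₁ E₀ r u ⟩
    (x * E₁ * u + h * ((E₁ + x * E₀) * u)) + h * h * ((E₀ + (x + h) * r) * u)
      ≡⟨ cong₂ (λ y z → (y + h * z) + h * h * ((E₀ + (x + h) * r) * u)) (sym (divPow-suc (ℕ.suc k) x)) collect ⟩
    divPow (2 ℕ.+ k) x + h * E₁ + h * h * remainder (2 ℕ.+ k) x h ∎
    where
    open ≡-Reasoning
    u E₀ E₁ r : ℚ
    u = 1/1+ (ℕ.suc k)
    E₀ = divPow k x
    E₁ = divPow (ℕ.suc k) x
    r = remainder (ℕ.suc k) x h
    collect : (E₁ + x * E₀) * u ≡ E₁
    collect = begin
      (E₁ + x * E₀) * u                       ≡⟨ cong (λ z → (E₁ + z) * u) (divPow-suc′ k x) ⟨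
      (E₁ + fromℕ (ℕ.suc k) * E₁) * u         ≡⟨ solve 3 (λ E n u → (E :+ n :* E) :* u := E :* ((con 1ℚ :+ n) :* u))
                                                   refl E₁ (fromℕ (ℕ.suc k)) u ⟩
      E₁ * ((1ℚ + fromℕ (ℕ.suc k)) * u)       ≡⟨ cong (λ z → E₁ * (z * u)) (fromℕ-suc (ℕ.suc k)) ⟨
      E₁ * (fromℕ (2 ℕ.+ k) * u)              ≡⟨ cong (E₁ *_) (1+*1/1+ (ℕ.suc k)) ⟩
      E₁ * 1ℚ                                 ≡⟨ ℚ.*-identityʳ E₁ ⟩
      E₁                                      ∎

  remainder-nonNeg : ∀ k {x h} → 0ℚ ≤ℚ x → 0ℚ ≤ℚ h → 0ℚ ≤ℚ remainder k x h
  remainder-nonNeg ℕ.zero              0≤x 0≤h = ℚ.≤-refl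
  remainder-nonNeg (ℕ.suc ℕ.zero)      0≤x 0≤h = ℚ.≤-refl
  remainder-nonNeg (ℕ.suc (ℕ.suc k)) 0≤x 0≤h = *-nonNeg
    (+-nonNeg (divPow-nonNeg k 0≤x) (*-nonNeg (+-nonNeg 0≤x 0≤h) (remainder-nonNeg (ℕ.suc k) 0≤x 0≤h)))
    (ℚ.<⇒≤ (1/1+-pos (ℕ.suc k)))

  -- By induction the second summand is at most T · T^(k-1)/(k-1)!, which is k · T^k/k!. The total
  -- (1 + k) · T^k/k! is then divided by k + 2.
  remainder-bound : ∀ k {x h T} → 0ℚ ≤ℚ x → 0ℚ ≤ℚ h → x + h ≤ℚ T →
                    remainder (2 ℕ.+ k) x h ≤ℚ divPow k T
  remainder-bound k {x} {h} {T} 0≤x 0≤h x+h≤T = begin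
    (divPow k x + (x + h) * remainder (ℕ.suc k) x h) * u
      ≤⟨ ℚ.*-monoʳ-≤-nonNeg u {{ℚ.nonNegative 0≤u}}
           {divPow k x + (x + h) * remainder (ℕ.suc k) x h} {divPow k T + fromℕ k * divPow k T}
           (ℚ.+-mono-≤ (divPow-mono k 0≤x (ℚ.≤-trans (≤-by h 0≤h refl) x+h≤T)) (previous k)) ⟩
    (divPow k T + fromℕ k * divPow k T) * u
      ≡⟨ solve 3 (λ D n u → (D :+ n :* D) :* u := D :* ((con 1ℚ :+ n) :* u)) refl (divPow k T) (fromℕ k) u ⟩
    divPow k T * ((1ℚ + fromℕ k) * u)
      ≡⟨ cong (λ z → divPow k T * (z * u)) (fromℕ-suc k) ⟨
    divPow k T * (fromℕ (ℕ.suc k) * u)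
      ≤⟨ ℚ.*-monoˡ-≤-nonNeg (divPow k T) {{ℚ.nonNegative (divPow-nonNeg k 0≤T)}} {fromℕ (ℕ.suc k) * u} {1ℚ}
           (subst (fromℕ (ℕ.suc k) * u ≤ℚ_) (1+*1/1+ (ℕ.suc k))
             (ℚ.*-monoʳ-≤-nonNeg u {{ℚ.nonNegative 0≤u}} (fromℕ-mono-≤ (ℕ.n≤1+n (ℕ.suc k))))) ⟩
    divPow k T * 1ℚ
      ≡⟨ ℚ.*-identityʳ (divPow k T) ⟩
    divPow k T ∎
    where
    open ℚ.≤-Reasoning
    u : ℚ
    u = 1/1+ (ℕ.suc k)
    0≤u : 0ℚ ≤ℚ u
    0≤u = ℚ.<⇒≤ (1/1+-pos (ℕ.suc k))
    0≤T : 0ℚ ≤ℚ T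
    0≤T = ℚ.≤-trans (+-nonNeg 0≤x 0≤h) x+h≤T
    previous : ∀ k → (x + h) * remainder (ℕ.suc k) x h ≤ℚ fromℕ k * divPow k T
    previous ℕ.zero    = ℚ.≤-reflexive (trans (ℚ.*-zeroʳ (x + h)) (sym (ℚ.*-zeroˡ (divPow 0 T))))
    previous (ℕ.suc k) = ℚ.≤-trans
      (*-mono-nonNeg (remainder-nonNeg (2 ℕ.+ k) 0≤x 0≤h) 0≤T x+h≤T (remainder-bound k 0≤x 0≤h x+h≤T))
      (ℚ.≤-reflexive (sym (divPow-suc′ k T)))

-- The coefficients are weights of x^k/k!, so that differentiation becomes the shift `γ ∘ suc`.
series : (ℕ → ℚ) → ℕ → ℚ → ℚ
series γ ℕ.zero    x = 0ℚ
series γ (ℕ.suc p) x = series γ p x + γ p * divPow p x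

remainderSeries : (ℕ → ℚ) → ℕ → ℚ → ℚ → ℚ
remainderSeries γ ℕ.zero    x h = 0ℚ
remainderSeries γ (ℕ.suc p) x h = remainderSeries γ p x h + γ (ℕ.suc p) * remainder (ℕ.suc p) x h

three : ℚ
three = fromℕ 3

-- The actual growth is that of √3^k; the base 3 is a rational replacement.
Tempered : (ℕ → ℚ) → Set
Tempered γ = ∀ k → ∣ γ k ∣ ≤ℚ three ^ℚ k

abstract
  series-at-0 : ∀ γ p → series γ (ℕ.suc p) 0ℚ ≡ γ 0
  series-at-0 γ ℕ.zero    = solve 1 (λ g → con 0ℚ :+ g :* (con 1ℚ :* con 1ℚ) := g) refl (γ 0)
  series-at-0 γ (ℕ.suc p) = trans (cong (λ z → z + γ (ℕ.suc p) * divPow (ℕ.suc p) 0ℚ) (series-at-0 γ p))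
    (solve 4 (λ g g′ f y → g :+ g′ :* (f :* (con 0ℚ :* y)) := g) refl (γ 0) (γ (ℕ.suc p)) (1/ ℕ.suc p !) (0ℚ ^ℚ p))

  -- The derivative of a sum with p + 1 terms has only p terms. This lost term is the truncation
  -- error that arises when c′ = -3s, s′ = c is written for sums of equal length.
  series-taylor : ∀ γ p x h → series γ (ℕ.suc p) (x + h) ≡
    series γ (ℕ.suc p) x + h * series (γ ∘ ℕ.suc) p x + h * h * remainderSeries γ p x h
  series-taylor γ ℕ.zero x h =
    solve 2 (λ g h → con 0ℚ :+ g :* (con 1ℚ :* con 1ℚ) :=
      (con 0ℚ :+ g :* (con 1ℚ :* con 1ℚ)) :+ h :* con 0ℚ :+ h :* h :* con 0ℚ) refl (γ 0) h
  series-taylor γ (ℕ.suc p) x h = trans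
    (cong₂ (λ y z → y + g * z) (series-taylor γ p x h) (divPow-taylor p x h))
    (solve 8 (λ h g A B R E₁ E₀ r →
        (A :+ h :* B :+ h :* h :* R) :+ g :* (E₁ :+ h :* E₀ :+ h :* h :* r)
        := (A :+ g :* E₁) :+ h :* (B :+ g :* E₀) :+ h :* h :* (R :+ g :* r))
      refl h g (series γ (ℕ.suc p) x) (series (γ ∘ ℕ.suc) p x) (remainderSeries γ p x h)
        (divPow (ℕ.suc p) x) (divPow p x) (remainder (ℕ.suc p) x h))
    where
    g : ℚ
    g = γ (ℕ.suc p)

-- Bounds uniform on the interval from 0 to T

module Majorant (T : ℚ) (0≤T : 0ℚ ≤ℚ T) (K : ℕ) (6T≤K : three * T + three * T ≤ℚ fromℕ K) where

  majorant : ℕ → ℚ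
  majorant k = divPow k (three * T)

  total : ℕ → ℚ
  total ℕ.zero    = 0ℚ
  total (ℕ.suc p) = total p + majorant p

  -- Beyond `K` the terms (3T)^k/k! at least halve at each step, because 6T ≤ `K`. The whole tail is
  -- therefore at most twice its first term.
  B : ℚ
  B = total K + (majorant K + majorant K)

  abstract
    0≤3T : 0ℚ ≤ℚ three * T
    0≤3T = *-nonNeg (fromℕ-nonNeg 3) 0≤T

    majorant-nonNeg : ∀ k → 0ℚ ≤ℚ majorant k
    majorant-nonNeg k = divPow-nonNeg k 0≤3T

    majorant-halves : ∀ k → K ℕ.≤ k → majorant (ℕ.suc k) + majorant (ℕ.suc k) ≤ℚ majorant k
    majorant-halves k K≤k = exponential-halving 0≤3T k (ℚ.≤-trans 6T≤K (fromℕ-mono-≤ K≤k))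

    total-nonNeg : ∀ p → 0ℚ ≤ℚ total p
    total-nonNeg ℕ.zero    = ℚ.≤-refl
    total-nonNeg (ℕ.suc p) = +-nonNeg (total-nonNeg p) (majorant-nonNeg p)

    0≤B : 0ℚ ≤ℚ B
    0≤B = +-nonNeg (total-nonNeg K) (+-nonNeg (majorant-nonNeg K) (majorant-nonNeg K))

    total-mono : ∀ j p → total p ≤ℚ total (j ℕ.+ p)
    total-mono ℕ.zero    p = ℚ.≤-refl
    total-mono (ℕ.suc j) p =
      ℚ.≤-trans (total-mono j p) (≤-by (majorant (j ℕ.+ p)) (majorant-nonNeg (j ℕ.+ p)) refl)

    -- The sum so far plus twice the next term does not increase, since each new term pays for
    -- itself and for twice its successor.
    total-tail : ∀ j → total (j ℕ.+ K) + (majorant (j ℕ.+ K) + majorant (j ℕ.+ K)) ≤ℚ B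
    total-tail ℕ.zero    = ℚ.≤-refl
    total-tail (ℕ.suc j) = ℚ.≤-trans
      (ℚ.+-monoʳ-≤ (total (j ℕ.+ K) + majorant (j ℕ.+ K)) (majorant-halves (j ℕ.+ K) (ℕ.m≤n+m K j)))
      (ℚ.≤-trans (ℚ.≤-reflexive (ℚ.+-assoc (total (j ℕ.+ K)) (majorant (j ℕ.+ K)) (majorant (j ℕ.+ K))))
        (total-tail j))

    total≤B : ∀ p → total p ≤ℚ B
    total≤B p = ℚ.≤-trans (total-mono K p) (subst (λ i → total i ≤ℚ B) (ℕ.+-comm p K)
      (ℚ.≤-trans (≤-by (majorant (p ℕ.+ K) + majorant (p ℕ.+ K))
          (+-nonNeg (majorant-nonNeg (p ℕ.+ K)) (majorant-nonNeg (p ℕ.+ K))) refl)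
        (total-tail p)))

    term-bound : ∀ {γ x} → Tempered γ → 0ℚ ≤ℚ x → x ≤ℚ T → ∀ k → ∣ γ k * divPow k x ∣ ≤ℚ majorant k
    term-bound {γ} {x} γ≤3ᵏ 0≤x x≤T k = subst (∣ γ k * divPow k x ∣ ≤ℚ_) (divPow-* k three T)
      (∣*∣≤ {γ k} {divPow k x} (γ≤3ᵏ k)
        (ℚ.≤-trans (nonNeg⇒∣∣≤ (divPow-nonNeg k 0≤x)) (divPow-mono k 0≤x x≤T)))

    series-bound : ∀ {γ x} → Tempered γ → 0ℚ ≤ℚ x → x ≤ℚ T → ∀ p → ∣ series γ p x ∣ ≤ℚ total p
    series-bound γ≤3ᵏ 0≤x x≤T ℕ.zero    = ℚ.≤-refl
    series-bound {γ} {x} γ≤3ᵏ 0≤x x≤T (ℕ.suc p) = ∣+∣≤ {series γ p x} {γ p * divPow p x}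
      (series-bound γ≤3ᵏ 0≤x x≤T p) (term-bound γ≤3ᵏ 0≤x x≤T p)

    series≤B : ∀ {γ x} → Tempered γ → 0ℚ ≤ℚ x → x ≤ℚ T → ∀ p → ∣ series γ p x ∣ ≤ℚ B
    series≤B γ≤3ᵏ 0≤x x≤T p = ℚ.≤-trans (series-bound γ≤3ᵏ 0≤x x≤T p) (total≤B p)

    -- The same accounting as for `total-tail`: the distance covered plus twice the next majorant
    -- never exceeds its initial value.
    series-tail : ∀ {γ x} → Tempered γ → 0ℚ ≤ℚ x → x ≤ℚ T → ∀ {P p} → K ℕ.≤ P → P ℕ.≤ p →
                  ∣ series γ p x - series γ P x ∣ ≤ℚ majorant P + majorant P
    series-tail {γ} {x} γ≤3ᵏ 0≤x x≤T {P} {p} K≤P P≤p =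
      subst (λ i → ∣ series γ i x - series γ P x ∣ ≤ℚ majorant P + majorant P) (ℕ.m∸n+n≡m P≤p)
        (ℚ.≤-trans
          (≤-by (m (p ℕ.∸ P) + m (p ℕ.∸ P)) (+-nonNeg (majorant-nonNeg (p ℕ.∸ P ℕ.+ P)) (majorant-nonNeg (p ℕ.∸ P ℕ.+ P))) refl)
          (go (p ℕ.∸ P)))
      where
      m : ℕ → ℚ
      m j = majorant (j ℕ.+ P)
      go : ∀ j → ∣ series γ (j ℕ.+ P) x - series γ P x ∣ + (m j + m j) ≤ℚ majorant P + majorant P
      go ℕ.zero    = ℚ.≤-reflexive (trans
        (cong (λ d → ∣ d ∣ + (m 0 + m 0)) (ℚ.+-inverseʳ (series γ P x))) (ℚ.+-identityˡ (m 0 + m 0)))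
      go (ℕ.suc j) = begin
        ∣ (a + t) - b ∣ + (m (ℕ.suc j) + m (ℕ.suc j))
          ≤⟨ ℚ.+-mono-≤
               (subst (λ z → ∣ z ∣ ≤ℚ ∣ a - b ∣ + m j) (solve 3 (λ a b t → (a :- b) :+ t := (a :+ t) :- b) refl a b t)
                 (∣+∣≤ {a - b} {t} ℚ.≤-refl (term-bound γ≤3ᵏ 0≤x x≤T (j ℕ.+ P))))
               (majorant-halves (j ℕ.+ P) (ℕ.≤-trans K≤P (ℕ.m≤n+m P j))) ⟩
        (∣ a - b ∣ + m j) + m j
          ≡⟨ ℚ.+-assoc (∣ a - b ∣) (m j) (m j) ⟩
        ∣ a - b ∣ + (m j + m j)
          ≤⟨ go j ⟩
        majorant P + majorant P ∎
        where
        open ℚ.≤-Reasoning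
        a b t : ℚ
        a = series γ (j ℕ.+ P) x
        b = series γ P x
        t = γ (j ℕ.+ P) * divPow (j ℕ.+ P) x

    -- The remainder of degree k + 2 is at most T^k/k! and carries weight 3^(k+2). Splitting off 9
    -- leaves the majorant of degree k, hence the shift by one in the induction.
    remainderSeries-bound : ∀ {γ x h} → Tempered γ → 0ℚ ≤ℚ x → 0ℚ ≤ℚ h → x + h ≤ℚ T →
                            ∀ p → ∣ remainderSeries γ p x h ∣ ≤ℚ three * three * B
    remainderSeries-bound {γ} {x} {h} γ≤3ᵏ 0≤x 0≤h x+h≤T p = ℚ.≤-trans (go p)
      (ℚ.*-monoˡ-≤-nonNeg (three * three) {{ℚ.nonNegative (*-nonNeg (fromℕ-nonNeg 3) (fromℕ-nonNeg 3))}} (total≤B (ℕ.pred p)))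
      where
      go : ∀ p → ∣ remainderSeries γ p x h ∣ ≤ℚ three * three * total (ℕ.pred p)
      go ℕ.zero            = ℚ.≤-refl
      go (ℕ.suc ℕ.zero)    = ℚ.≤-reflexive (cong ∣_∣ (solve 1 (λ g → con 0ℚ :+ g :* con 0ℚ := con 0ℚ) refl (γ 1)))
      go (ℕ.suc (ℕ.suc p)) = ℚ.≤-trans
        (∣+∣≤ {remainderSeries γ (ℕ.suc p) x h} {γ (2 ℕ.+ p) * remainder (2 ℕ.+ p) x h} (go (ℕ.suc p))
          (∣*∣≤ {γ (2 ℕ.+ p)} {remainder (2 ℕ.+ p) x h} (γ≤3ᵏ (2 ℕ.+ p))
            (ℚ.≤-trans (nonNeg⇒∣∣≤ (remainder-nonNeg (2 ℕ.+ p) 0≤x 0≤h)) (remainder-bound p 0≤x 0≤h x+h≤T))))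
        (ℚ.≤-reflexive (trans
          (solve 4 (λ c t w d → c :* c :* t :+ (c :* (c :* w)) :* d := c :* c :* (t :+ w :* d))
            refl three (total p) (three ^ℚ p) (divPow p T))
          (cong (λ z → three * three * (total p + z)) (divPow-* p three T))))

-- The first integral of c′ = -3s, s′ = c: its derivative 2c(-3s) + 6sc vanishes, so the terms
-- linear in h cancel in a step.
energy : ℚ → ℚ → ℚ
energy c s = c * c + three * (s * s)

abstract
  ∣fromℕ∣≤ : ∀ n → ∣ fromℕ n ∣ ≤ℚ fromℕ n
  ∣fromℕ∣≤ n = nonNeg⇒∣∣≤ (fromℕ-nonNeg n)

  -- One step of size h of the system c′ = −3s, s′ = c, with errors ρ and σ of order h².
  energy-step : ∀ {c s h ρ σ b k} → 0ℚ ≤ℚ h → h ≤ℚ 1ℚ → 0ℚ ≤ℚ k → ∣ c ∣ ≤ℚ b → ∣ s ∣ ≤ℚ b →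
    ∣ ρ ∣ ≤ℚ k * (h * h) → ∣ σ ∣ ≤ℚ k * (h * h) →
    ∣ energy (c + (h * - (three * s) + ρ)) (s + (h * c + σ)) - energy c s ∣ ≤ℚ
    (fromℕ 12 * (b * b) + fromℕ 20 * (b * k) + fromℕ 4 * (k * k)) * (h * h)
  energy-step {c} {s} {h} {ρ} {σ} {b} {k} 0≤h h≤1 0≤k ∣c∣≤b ∣s∣≤b ∣ρ∣≤ ∣σ∣≤ = begin
    ∣ energy (c + (h * - (three * s) + ρ)) (s + (h * c + σ)) - energy c s ∣
      ≡⟨ cong ∣_∣ (solve 5 (λ c s h ρ σ →
           ((c :+ (h :* :- (con three :* s) :+ ρ)) :* (c :+ (h :* :- (con three :* s) :+ ρ))
             :+ con three :* ((s :+ (h :* c :+ σ)) :* (s :+ (h :* c :+ σ))))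
             :- (c :* c :+ con three :* (s :* s))
           := h :* h :* (con (fromℕ 9) :* (s :* s) :+ con three :* (c :* c))
             :+ (ρ :* (con (fromℕ 2) :* (c :+ :- (con three :* (h :* s))) :+ ρ)
             :+ σ :* (con (fromℕ 6) :* (s :+ h :* c) :+ con three :* σ)))
           refl c s h ρ σ) ⟩
    ∣ h * h * (fromℕ 9 * (s * s) + three * (c * c))
      + (ρ * (fromℕ 2 * (c + - (three * (h * s))) + ρ) + σ * (fromℕ 6 * (s + h * c) + three * σ)) ∣
      ≤⟨ ∣+∣≤ {h * h * (fromℕ 9 * (s * s) + three * (c * c))}
              {ρ * (fromℕ 2 * (c + - (three * (h * s))) + ρ) + σ * (fromℕ 6 * (s + h * c) + three * σ)}
           (∣*∣≤ {h * h} {fromℕ 9 * (s * s) + three * (c * c)} ∣hh∣≤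
             (∣+∣≤ {fromℕ 9 * (s * s)} {three * (c * c)}
               (∣*∣≤ {fromℕ 9} {s * s} (∣fromℕ∣≤ 9) (∣*∣≤ {s} {s} ∣s∣≤b ∣s∣≤b))
               (∣*∣≤ {three} {c * c} (∣fromℕ∣≤ 3) (∣*∣≤ {c} {c} ∣c∣≤b ∣c∣≤b))))
           (∣+∣≤ {ρ * (fromℕ 2 * (c + - (three * (h * s))) + ρ)} {σ * (fromℕ 6 * (s + h * c) + three * σ)}
             (∣*∣≤ {ρ} {fromℕ 2 * (c + - (three * (h * s))) + ρ} ∣ρ∣≤
               (∣+∣≤ {fromℕ 2 * (c + - (three * (h * s)))} {ρ}
                 (∣*∣≤ {fromℕ 2} {c + - (three * (h * s))} (∣fromℕ∣≤ 2)
                   (∣+∣≤ {c} { - (three * (h * s))} ∣c∣≤b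
                     (∣-∣≤ {three * (h * s)} (∣*∣≤ {three} {h * s} (∣fromℕ∣≤ 3) (∣*∣≤ {h} {s} ∣h∣≤1 ∣s∣≤b)))))
                 (ℚ.≤-trans ∣ρ∣≤ khh≤k)))
             (∣*∣≤ {σ} {fromℕ 6 * (s + h * c) + three * σ} ∣σ∣≤
               (∣+∣≤ {fromℕ 6 * (s + h * c)} {three * σ}
                 (∣*∣≤ {fromℕ 6} {s + h * c} (∣fromℕ∣≤ 6) (∣+∣≤ {s} {h * c} ∣s∣≤b (∣*∣≤ {h} {c} ∣h∣≤1 ∣c∣≤b)))
                 (∣*∣≤ {three} {σ} (∣fromℕ∣≤ 3) (ℚ.≤-trans ∣σ∣≤ khh≤k))))) ⟩
    h * h * (fromℕ 9 * (b * b) + three * (b * b))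
      + (k * (h * h) * (fromℕ 2 * (b + three * (1ℚ * b)) + k) + k * (h * h) * (fromℕ 6 * (b + 1ℚ * b) + three * k))
      ≡⟨ solve 3 (λ h b k →
           h :* h :* (con (fromℕ 9) :* (b :* b) :+ con three :* (b :* b))
             :+ (k :* (h :* h) :* (con (fromℕ 2) :* (b :+ con three :* (con 1ℚ :* b)) :+ k)
             :+ k :* (h :* h) :* (con (fromℕ 6) :* (b :+ con 1ℚ :* b) :+ con three :* k))
           := (con (fromℕ 12) :* (b :* b) :+ con (fromℕ 20) :* (b :* k) :+ con (fromℕ 4) :* (k :* k)) :* (h :* h))
           refl h b k ⟩
    (fromℕ 12 * (b * b) + fromℕ 20 * (b * k) + fromℕ 4 * (k * k)) * (h * h) ∎
    where
    open ℚ.≤-Reasoning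
    ∣h∣≤1 : ∣ h ∣ ≤ℚ 1ℚ
    ∣h∣≤1 = ℚ.≤-trans (nonNeg⇒∣∣≤ 0≤h) h≤1
    ∣hh∣≤ : ∣ h * h ∣ ≤ℚ h * h
    ∣hh∣≤ = ∣*∣≤ {h} {h} (nonNeg⇒∣∣≤ 0≤h) (nonNeg⇒∣∣≤ 0≤h)
    khh≤k : k * (h * h) ≤ℚ k
    khh≤k = subst (k * (h * h) ≤ℚ_) (ℚ.*-identityʳ k)
      (ℚ.*-monoˡ-≤-nonNeg k {{ℚ.nonNegative 0≤k}} (*-mono-nonNeg 0≤h (ℚ.nonNegative⁻¹ 1ℚ) h≤1 h≤1))

  drift : ∀ {s h ρ b k} → 0ℚ ≤ℚ h → h ≤ℚ 1ℚ → 0ℚ ≤ℚ k → ∣ s ∣ ≤ℚ b → ∣ ρ ∣ ≤ℚ k * (h * h) →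
          ∣ h * - (three * s) + ρ ∣ ≤ℚ (three * b + k) * h
  drift {s} {h} {ρ} {b} {k} 0≤h h≤1 0≤k ∣s∣≤b ∣ρ∣≤ = ℚ.≤-trans
    (∣+∣≤ {h * - (three * s)} {ρ}
      (∣*∣≤ {h} { - (three * s)} (nonNeg⇒∣∣≤ 0≤h) (∣-∣≤ {three * s} (∣*∣≤ {three} {s} (∣fromℕ∣≤ 3) ∣s∣≤b)))
      (ℚ.≤-trans ∣ρ∣≤ (ℚ.*-monoˡ-≤-nonNeg k {{ℚ.nonNegative 0≤k}} (ℚ.*-monoˡ-≤-nonNeg h {{ℚ.nonNegative 0≤h}} h≤1))))
    (ℚ.≤-reflexive (solve 3 (λ h b k → h :* (con three :* b) :+ k :* (h :* con 1ℚ) := (con three :* b :+ k) :* h)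
      refl h b k))

  -- A discrete intermediate value theorem. Descending from N, the search stops where the
  -- predecessor still lies above a; that step straddles a, so its length bounds the distance.
  -- Comparison of rationals is decidable, which is why the walk is made on rational values.
  first-crossing : ∀ (f : ℕ → ℚ) a {d} N → a < f 0 → f N ≤ℚ a →
                   (∀ j → j ℕ.< N → ∣ f (ℕ.suc j) - f j ∣ ≤ℚ d) →
                   ∃[ j ] j ℕ.≤ N × ∣ f j - a ∣ ≤ℚ d
  first-crossing f a ℕ.zero    a<f₀ f₀≤a step = contradiction (ℚ.<-≤-trans a<f₀ f₀≤a) (ℚ.<-irrefl refl)
  first-crossing f a {d} (ℕ.suc N) a<f₀ f≤a step with f N ℚ.≤? a
  ... | yes fN≤a =
    let j , j≤N , close = first-crossing f a N a<f₀ fN≤a (λ i i<N → step i (ℕ.m<n⇒m<1+n i<N))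
    in j , ℕ.m≤n⇒m≤1+n j≤N , close
  ... | no  fN≰a = ℕ.suc N , ℕ.≤-refl , ℚ.≤-trans below (step N ℕ.≤-refl)
    where
    x y : ℚ
    x = f (ℕ.suc N)
    y = f N
    open ℚ.≤-Reasoning
    below : ∣ x - a ∣ ≤ℚ ∣ x - y ∣
    below = begin
      ∣ x - a ∣ ≡⟨ ∣p-q∣≡∣q-p∣ x a ⟩
      ∣ a - x ∣ ≡⟨ ℚ.0≤p⇒∣p∣≡p (subst (_≤ℚ a - x) (ℚ.+-inverseʳ x) (ℚ.+-monoˡ-≤ (- x) f≤a)) ⟩
      a - x     ≤⟨ ℚ.+-monoˡ-≤ (- x) (ℚ.<⇒≤ (ℚ.≰⇒> fN≰a)) ⟩
      y - x     ≤⟨ p≤∣p∣ (y - x) ⟩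
      ∣ y - x ∣ ≡⟨ ∣p-q∣≡∣q-p∣ y x ⟩
      ∣ x - y ∣ ∎

  vanishing : ∀ {c ε} → 0ℚ ≤ℚ c → 0ℚ < ε → ∃[ N ] (∀ n → N ℕ.≤ n → c * 1/1+ n ≤ℚ ε)
  vanishing {c} {ε} 0≤c 0<ε =
    let δ , 0<δ , [c+1]δ≡ε = divide (ℚ.+-mono-≤-< 0≤c (ℚ.positive⁻¹ 1ℚ)) 0<ε
        N , small = archimedean 0<δ
    in N , λ n N≤n → ℚ.≤-trans
      (*-mono-nonNeg {c} {c + 1ℚ} (ℚ.<⇒≤ (1/1+-pos n)) (+-nonNeg 0≤c (ℚ.nonNegative⁻¹ 1ℚ))
        (≤-by 1ℚ (ℚ.nonNegative⁻¹ 1ℚ) refl) (ℚ.<⇒≤ (small N≤n)))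
      (ℚ.≤-reflexive [c+1]δ≡ε)

-- The Taylor coefficients, multiplied by k!, of cos (√3 x) and of sin (√3 x) / √3.
cosCoeff sinCoeff : ℕ → ℚ
cosCoeff ℕ.zero    = 1ℚ
cosCoeff (ℕ.suc k) = - (three * sinCoeff k)
sinCoeff ℕ.zero    = 0ℚ
sinCoeff (ℕ.suc k) = cosCoeff k

cosSeries sinSeries : ℕ → ℚ → ℚ
cosSeries = series cosCoeff
sinSeries = series sinCoeff

abstract
  cosCoeff-tempered : Tempered cosCoeff
  sinCoeff-tempered : Tempered sinCoeff
  cosCoeff-tempered ℕ.zero    = ℚ.≤-refl
  cosCoeff-tempered (ℕ.suc k) =
    ∣-∣≤ {three * sinCoeff k} (∣*∣≤ {three} {sinCoeff k} (∣fromℕ∣≤ 3) (sinCoeff-tempered k))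
  sinCoeff-tempered ℕ.zero    = ℚ.nonNegative⁻¹ 1ℚ
  sinCoeff-tempered (ℕ.suc k) = ℚ.≤-trans (cosCoeff-tempered k)
    (≤-by (fromℕ 2 * three ^ℚ k) (*-nonNeg (fromℕ-nonNeg 2) (^ℚ-nonNeg (fromℕ-nonNeg 3) k))
      (solve 1 (λ w → w :+ con (fromℕ 2) :* w := con three :* w) refl (three ^ℚ k)))

  series-cos′ : ∀ p x → series (cosCoeff ∘ ℕ.suc) p x ≡ - (three * sinSeries p x)
  series-cos′ ℕ.zero    x = refl
  series-cos′ (ℕ.suc p) x = trans
    (cong (λ z → z + - (three * sinCoeff p) * divPow p x) (series-cos′ p x))
    (solve 4 (λ t S b e → :- (t :* S) :+ (:- (t :* b)) :* e := :- (t :* (S :+ b :* e)))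
      refl three (sinSeries p x) (sinCoeff p) (divPow p x))

  series-sin′ : ∀ p x → series (sinCoeff ∘ ℕ.suc) p x ≡ cosSeries p x
  series-sin′ ℕ.zero    x = refl
  series-sin′ (ℕ.suc p) x = cong (λ z → z + cosCoeff p * divPow p x) (series-sin′ p x)

-- The walk along a grid of mesh h

module Crossing (T : ℚ) (0<T : 0ℚ < T) (K : ℕ) (6T≤K : three * T + three * T ≤ℚ fromℕ K)
                (crossed : ∀ P → K ℕ.≤ P → cosSeries P T ≤ℚ - ½) where

  open Majorant T (ℚ.<⇒≤ 0<T) K 6T≤K

  -- None depends on h: `k` h² bounds the error of one step, `L` h² the change of energy in it, `D`
  -- h the change of the cosine. `Z` adds up the two constants of the final estimate.
  k L D Z : ℚ
  k = three + three * three * B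
  L = fromℕ 12 * (B * B) + fromℕ 20 * (B * k) + fromℕ 4 * (k * k)
  D = three * B + k
  Z = (D + 1ℚ) + (1ℚ * (T * L + D * (B + ½)) + (B + B))

  abstract
    0≤k : 0ℚ ≤ℚ k
    0≤k = +-nonNeg (fromℕ-nonNeg 3) (*-nonNeg (*-nonNeg (fromℕ-nonNeg 3) (fromℕ-nonNeg 3)) 0≤B)

    0≤D : 0ℚ ≤ℚ D
    0≤D = +-nonNeg (*-nonNeg (fromℕ-nonNeg 3) 0≤B) 0≤k

    0≤L : 0ℚ ≤ℚ L
    0≤L = +-nonNeg (+-nonNeg
      (*-nonNeg (fromℕ-nonNeg 12) (*-nonNeg 0≤B 0≤B)) (*-nonNeg (fromℕ-nonNeg 20) (*-nonNeg 0≤B 0≤k)))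
      (*-nonNeg (fromℕ-nonNeg 4) (*-nonNeg 0≤k 0≤k))

    0≤Z₁ : 0ℚ ≤ℚ D + 1ℚ
    0≤Z₁ = +-nonNeg 0≤D (ℚ.nonNegative⁻¹ 1ℚ)

    0≤Z₂ : 0ℚ ≤ℚ 1ℚ * (T * L + D * (B + ½)) + (B + B)
    0≤Z₂ = +-nonNeg
      (*-nonNeg (ℚ.nonNegative⁻¹ 1ℚ) (+-nonNeg (*-nonNeg (ℚ.<⇒≤ 0<T) 0≤L)
        (*-nonNeg 0≤D (+-nonNeg 0≤B (ℚ.nonNegative⁻¹ ½)))))
      (+-nonNeg 0≤B 0≤B)

  module _ {h : ℚ} (0≤h : 0ℚ ≤ℚ h) (h≤1 : h ≤ℚ 1ℚ) {p : ℕ} (small : majorant p ≤ℚ h) where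

    module Step {γ : ℕ → ℚ} (γ≤3ᵏ : Tempered γ) {x : ℚ} (0≤x : 0ℚ ≤ℚ x) (x+h≤T : x + h ≤ℚ T) where

      x≤T : x ≤ℚ T
      x≤T = ℚ.≤-trans (≤-by h 0≤h refl) x+h≤T

      -- The term missing from the derivative of the sum with p + 1 terms. It is at most h by the
      -- choice of p, and it enters a step multiplied by h, so it costs only h².
      truncation : ℚ
      truncation = γ p * divPow p x

      abstract
        ∣truncation∣≤ : ∣ truncation ∣ ≤ℚ h
        ∣truncation∣≤ = ℚ.≤-trans (term-bound γ≤3ᵏ 0≤x x≤T p) small

    open Step using (truncation; ∣truncation∣≤)

    module _ {x : ℚ} (0≤x : 0ℚ ≤ℚ x) (x+h≤T : x + h ≤ℚ T) where

      private
        c s a b Rᶜ Rˢ ρ σ : ℚ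
        c = cosSeries (ℕ.suc p) x
        s = sinSeries (ℕ.suc p) x
        a = truncation cosCoeff-tempered 0≤x x+h≤T
        b = truncation sinCoeff-tempered 0≤x x+h≤T
        Rᶜ = remainderSeries cosCoeff p x h
        Rˢ = remainderSeries sinCoeff p x h
        -- The derivative sums are shorter by the truncation terms `b` and `a`, so -3s is corrected
        -- by +3`b` and c by -`a`.
        ρ = h * (three * b) + h * h * Rᶜ
        σ = h * - a + h * h * Rˢ

      abstract
        cos-step : cosSeries (ℕ.suc p) (x + h) ≡ c + (h * - (three * s) + ρ)
        cos-step = trans (series-taylor cosCoeff p x h)
          (trans (cong (λ z → c + h * z + h * h * Rᶜ) (series-cos′ p x))
            (solve 6 (λ c h t S b R → c :+ h :* (:- (t :* S)) :+ h :* h :* R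
              := c :+ (h :* :- (t :* (S :+ b)) :+ (h :* (t :* b) :+ h :* h :* R)))
              refl c h three (sinSeries p x) b Rᶜ))

        sin-step : sinSeries (ℕ.suc p) (x + h) ≡ s + (h * c + σ)
        sin-step = trans (series-taylor sinCoeff p x h)
          (trans (cong (λ z → s + h * z + h * h * Rˢ) (series-sin′ p x))
            (solve 5 (λ s h C a R → s :+ h :* C :+ h :* h :* R
              := s :+ (h :* (C :+ a) :+ (h :* :- a :+ h :* h :* R)))
              refl s h (cosSeries p x) a Rˢ))

        ∣hh∣≤ : ∣ h * h ∣ ≤ℚ h * h
        ∣hh∣≤ = ∣*∣≤ {h} {h} (nonNeg⇒∣∣≤ 0≤h) (nonNeg⇒∣∣≤ 0≤h)

        ∣ρ∣≤ : ∣ ρ ∣ ≤ℚ k * (h * h)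
        ∣ρ∣≤ = ℚ.≤-trans
          (∣+∣≤ {h * (three * b)} {h * h * Rᶜ}
            (∣*∣≤ {h} {three * b} (nonNeg⇒∣∣≤ 0≤h)
              (∣*∣≤ {three} {b} (∣fromℕ∣≤ 3) (∣truncation∣≤ sinCoeff-tempered 0≤x x+h≤T)))
            (∣*∣≤ {h * h} {Rᶜ} ∣hh∣≤ (remainderSeries-bound cosCoeff-tempered 0≤x 0≤h x+h≤T p)))
          (ℚ.≤-reflexive (solve 3 (λ h t B → h :* (t :* h) :+ h :* h :* (t :* t :* B)
            := (t :+ t :* t :* B) :* (h :* h)) refl h three B))

        ∣σ∣≤ : ∣ σ ∣ ≤ℚ k * (h * h)
        ∣σ∣≤ = ℚ.≤-trans
          (∣+∣≤ {h * - a} {h * h * Rˢ}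
            (∣*∣≤ {h} { - a} (nonNeg⇒∣∣≤ 0≤h) (∣-∣≤ {a} (∣truncation∣≤ cosCoeff-tempered 0≤x x+h≤T)))
            (∣*∣≤ {h * h} {Rˢ} ∣hh∣≤ (remainderSeries-bound sinCoeff-tempered 0≤x 0≤h x+h≤T p)))
          (≤-by (fromℕ 2 * (h * h)) (*-nonNeg (fromℕ-nonNeg 2) (*-nonNeg 0≤h 0≤h))
            (solve 2 (λ h B → (h :* h :+ h :* h :* (con three :* con three :* B)) :+ con (fromℕ 2) :* (h :* h)
              := (con three :+ con three :* con three :* B) :* (h :* h)) refl h B))

        x≤T : x ≤ℚ T
        x≤T = ℚ.≤-trans (≤-by h 0≤h refl) x+h≤T

        ∣s∣≤B : ∣ s ∣ ≤ℚ B
        ∣s∣≤B = series≤B sinCoeff-tempered 0≤x x≤T (ℕ.suc p)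

        energy-drift : ∣ energy (cosSeries (ℕ.suc p) (x + h)) (sinSeries (ℕ.suc p) (x + h)) - energy c s ∣
                       ≤ℚ L * (h * h)
        energy-drift = subst₂ (λ y z → ∣ energy y z - energy c s ∣ ≤ℚ L * (h * h)) (sym cos-step) (sym sin-step)
          (energy-step {c} {s} {h} {ρ} {σ} {B} {k} 0≤h h≤1 0≤k
            (series≤B cosCoeff-tempered 0≤x x≤T (ℕ.suc p)) ∣s∣≤B ∣ρ∣≤ ∣σ∣≤)

        cos-drift : ∣ cosSeries (ℕ.suc p) (x + h) - c ∣ ≤ℚ D * h
        cos-drift = subst (λ z → ∣ z ∣ ≤ℚ D * h)
          (trans (solve 2 (λ c δ → δ := (c :+ δ) :- c) refl c (h * - (three * s) + ρ))
            (cong (λ z → z - c) (sym cos-step)))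
          (drift {s} {h} {ρ} {B} {k} 0≤h h≤1 0≤k ∣s∣≤B ∣ρ∣≤)

    node : ℕ → ℚ
    node j = fromℕ j * h

    abstract
      node-suc : ∀ j → node (ℕ.suc j) ≡ node j + h
      node-suc j = trans (cong (_* h) (fromℕ-suc j))
        (solve 2 (λ j h → (con 1ℚ :+ j) :* h := j :* h :+ h) refl (fromℕ j) h)

      node-nonNeg : ∀ j → 0ℚ ≤ℚ node j
      node-nonNeg j = *-nonNeg (fromℕ-nonNeg j) 0≤h

      node-mono : ∀ {i j} → i ℕ.≤ j → node i ≤ℚ node j
      node-mono i≤j = ℚ.*-monoʳ-≤-nonNeg h {{ℚ.nonNegative 0≤h}} (fromℕ-mono-≤ i≤j)

    energyAt : ℕ → ℚ
    energyAt j = energy (cosSeries (ℕ.suc p) (node j)) (sinSeries (ℕ.suc p) (node j))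

    module _ {N : ℕ} (node-N : node N ≡ T) where

      abstract
        node≤T : ∀ {j} → j ℕ.≤ N → node j ≤ℚ T
        node≤T {j} j≤N = subst (node j ≤ℚ_) node-N (node-mono j≤N)

        node+h≤T : ∀ {j} → j ℕ.< N → node j + h ≤ℚ T
        node+h≤T {j} j<N = subst (_≤ℚ T) (node-suc j) (node≤T j<N)

        energy-march : ∀ j → j ℕ.≤ N → ∣ energyAt j - 1ℚ ∣ ≤ℚ fromℕ j * (L * (h * h))
        energy-march ℕ.zero    j≤N = ℚ.≤-reflexive (trans
          (cong (λ z → ∣ z - 1ℚ ∣) (cong₂ energy
            (trans (cong (cosSeries (ℕ.suc p)) (ℚ.*-zeroˡ h)) (series-at-0 cosCoeff p))
            (trans (cong (sinSeries (ℕ.suc p)) (ℚ.*-zeroˡ h)) (series-at-0 sinCoeff p))))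
          (sym (ℚ.*-zeroˡ (L * (h * h)))))
        energy-march (ℕ.suc j) j<N = begin
          ∣ energyAt (ℕ.suc j) - 1ℚ ∣
            ≤⟨ ∣-∣-triangle (energyAt (ℕ.suc j)) (energyAt j) 1ℚ ⟩
          ∣ energyAt (ℕ.suc j) - energyAt j ∣ + ∣ energyAt j - 1ℚ ∣
            ≤⟨ ℚ.+-mono-≤
                 (subst (λ z → ∣ energy (cosSeries (ℕ.suc p) z) (sinSeries (ℕ.suc p) z) - energyAt j ∣ ≤ℚ L * (h * h))
                   (sym (node-suc j)) (energy-drift (node-nonNeg j) (node+h≤T j<N)))
                 (energy-march j (ℕ.<⇒≤ j<N)) ⟩
          L * (h * h) + fromℕ j * (L * (h * h))
            ≡⟨ solve 2 (λ e j → e :+ j :* e := (con 1ℚ :+ j) :* e) refl (L * (h * h)) (fromℕ j) ⟩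
          (1ℚ + fromℕ j) * (L * (h * h))
            ≡⟨ cong (_* (L * (h * h))) (fromℕ-suc j) ⟨
          fromℕ (ℕ.suc j) * (L * (h * h)) ∎
          where open ℚ.≤-Reasoning

        -- The loss L h² per step is multiplied by j, and j h ≤ T turns one factor h into T.
        energy-near-1 : ∀ {j} → j ℕ.≤ N → ∣ energyAt j - 1ℚ ∣ ≤ℚ T * L * h
        energy-near-1 {j} j≤N = begin
          ∣ energyAt j - 1ℚ ∣      ≤⟨ energy-march j j≤N ⟩
          fromℕ j * (L * (h * h))  ≡⟨ solve 3 (λ j L h → j :* (L :* (h :* h)) := (j :* h) :* (L :* h)) refl (fromℕ j) L h ⟩
          node j * (L * h)         ≤⟨ ℚ.*-monoʳ-≤-nonNeg (L * h) {{ℚ.nonNegative (*-nonNeg 0≤L 0≤h)}} (node≤T j≤N) ⟩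
          T * (L * h)              ≡⟨ ℚ.*-assoc T L h ⟨
          T * L * h                ∎
          where open ℚ.≤-Reasoning

        cos-crossing : K ℕ.≤ ℕ.suc p → ∃[ j ] j ℕ.≤ N × ∣ cosSeries (ℕ.suc p) (node j) - - ½ ∣ ≤ℚ D * h
        cos-crossing K≤1+p = first-crossing (λ j → cosSeries (ℕ.suc p) (node j)) (- ½) N
          (subst (- ½ <_) (sym (trans (cong (cosSeries (ℕ.suc p)) (ℚ.*-zeroˡ h)) (series-at-0 cosCoeff p)))
            (from-yes (- ½ ℚ.<? 1ℚ)))
          (subst (λ z → cosSeries (ℕ.suc p) z ≤ℚ - ½) (sym node-N) (crossed (ℕ.suc p) K≤1+p))
          (λ j j<N → subst (λ z → ∣ cosSeries (ℕ.suc p) z - cosSeries (ℕ.suc p) (node j) ∣ ≤ℚ D * h)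
            (sym (node-suc j)) (cos-drift (node-nonNeg j) (node+h≤T j<N)))

        -- s² - 1/4 is a third of (c² + 3s² - 1) - (c + 1/2)(c - 1/2). The first bracket is small by
        -- near-conservation, the product by the crossing. The factor 1/3 is estimated by 1.
        sin-near : ∀ {j} → j ℕ.≤ N → ∣ cosSeries (ℕ.suc p) (node j) - - ½ ∣ ≤ℚ D * h →
                   ∣ sinSeries (ℕ.suc p) (node j) * sinSeries (ℕ.suc p) (node j) - + 1 / 4 ∣
                   ≤ℚ 1ℚ * (T * L * h + D * h * (B + ½))
        sin-near {j} j≤N close = subst (λ z → ∣ z ∣ ≤ℚ 1ℚ * (T * L * h + D * h * (B + ½)))
          (solve 2 (λ c s → con (+ 1 / 3) :* (((c :* c :+ con three :* (s :* s)) :- con 1ℚ)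
              :+ :- ((c :- con (- ½)) :* (c :+ con (- ½)))) := s :* s :- con (+ 1 / 4)) refl c s)
          (∣*∣≤ {+ 1 / 3} {(energy c s - 1ℚ) + - ((c - - ½) * (c + - ½))} (from-yes (∣ + 1 / 3 ∣ ℚ.≤? 1ℚ))
            (∣+∣≤ {energy c s - 1ℚ} { - ((c - - ½) * (c + - ½))} (energy-near-1 j≤N)
              (∣-∣≤ {(c - - ½) * (c + - ½)} (∣*∣≤ {c - - ½} {c + - ½} close
                (∣+∣≤ {c} { - ½} (series≤B cosCoeff-tempered (node-nonNeg j) (node≤T j≤N) (ℕ.suc p)) ℚ.≤-refl)))))
          where
          c s : ℚ
          c = cosSeries (ℕ.suc p) (node j)
          s = sinSeries (ℕ.suc p) (node j)

        tail-near : K ℕ.≤ p → ∀ {γ} → Tempered γ → ∀ {j} → j ℕ.≤ N → ∀ {q} → ℕ.suc p ℕ.≤ q →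
                    ∣ series γ q (node j) - series γ (ℕ.suc p) (node j) ∣ ≤ℚ h
        tail-near K≤p γ≤3ᵏ {j} j≤N P≤q = ℚ.≤-trans
          (series-tail γ≤3ᵏ (node-nonNeg j) (node≤T j≤N) (ℕ.m≤n⇒m≤1+n K≤p) P≤q)
          (ℚ.≤-trans (majorant-halves p K≤p) small)

        -- The node is found for sums of length p + 1 but has to serve all longer ones. These differ
        -- by at most h, and the sine is carried over by s′² - s² = (s′ - s)(s′ + s).
        solution : K ℕ.≤ p → ∃[ t ] (∀ q → ℕ.suc p ℕ.≤ q →
                   ∣ cosSeries q t - - ½ ∣ ≤ℚ (D + 1ℚ) * h ×
                   ∣ sinSeries q t * sinSeries q t - + 1 / 4 ∣
                     ≤ℚ (1ℚ * (T * L + D * (B + ½)) + (B + B)) * h)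
        solution K≤p =
          let j , j≤N , close = cos-crossing (ℕ.m≤n⇒m≤1+n K≤p)
          in node j , λ q P≤q →
            let c = cosSeries (ℕ.suc p) (node j)
                s = sinSeries (ℕ.suc p) (node j)
                c′ = cosSeries q (node j)
                s′ = sinSeries q (node j)
            in subst (λ z → ∣ z ∣ ≤ℚ (D + 1ℚ) * h)
                 (solve 2 (λ c c′ → (c :- con (- ½)) :+ (c′ :- c) := c′ :- con (- ½)) refl c c′)
                 (ℚ.≤-trans
                   (∣+∣≤ {c - - ½} {c′ - c} close (tail-near K≤p cosCoeff-tempered j≤N P≤q))
                   (ℚ.≤-reflexive (solve 2 (λ D h → D :* h :+ h := (D :+ con 1ℚ) :* h) refl D h))) ,
               subst (λ z → ∣ z ∣ ≤ℚ (1ℚ * (T * L + D * (B + ½)) + (B + B)) * h)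
                 (solve 2 (λ s s′ → (s :* s :- con (+ 1 / 4)) :+ (s′ :- s) :* (s′ :+ s) := s′ :* s′ :- con (+ 1 / 4))
                   refl s s′)
                 (ℚ.≤-trans
                   (∣+∣≤ {s * s - + 1 / 4} {(s′ - s) * (s′ + s)} (sin-near j≤N close)
                     (∣*∣≤ {s′ - s} {s′ + s} (tail-near K≤p sinCoeff-tempered j≤N P≤q)
                       (∣+∣≤ {s′} {s} (series≤B sinCoeff-tempered (node-nonNeg j) (node≤T j≤N) q)
                                      (series≤B sinCoeff-tempered (node-nonNeg j) (node≤T j≤N) (ℕ.suc p)))))
                   (ℚ.≤-reflexive (solve 5 (λ T L D B h →
                       con 1ℚ :* (T :* L :* h :+ D :* h :* (B :+ con ½)) :+ h :* (B :+ B)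
                       := (con 1ℚ :* (T :* L :+ D :* (B :+ con ½)) :+ (B :+ B)) :* h) refl T L D B h)))

  abstract
    weaken : ∀ {h ε} → 0ℚ ≤ℚ h → Z * h ≤ℚ ε → ∀ {y z} → y ≤ℚ (D + 1ℚ) * h →
             z ≤ℚ (1ℚ * (T * L + D * (B + ½)) + (B + B)) * h → y ≤ℚ ε × z ≤ℚ ε
    weaken {h} {ε} 0≤h Zh≤ε y≤ z≤ =
      ℚ.≤-trans y≤ (ℚ.≤-trans (ℚ.*-monoʳ-≤-nonNeg h {{ℚ.nonNegative 0≤h}} (≤-by {Z₁} {Z} Z₂ 0≤Z₂ refl)) Zh≤ε) ,
      ℚ.≤-trans z≤ (ℚ.≤-trans (ℚ.*-monoʳ-≤-nonNeg h {{ℚ.nonNegative 0≤h}}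
        (≤-by {Z₂} {Z} Z₁ 0≤Z₁ (ℚ.+-comm Z₂ Z₁))) Zh≤ε)
      where
      Z₁ Z₂ : ℚ
      Z₁ = D + 1ℚ
      Z₂ = 1ℚ * (T * L + D * (B + ½)) + (B + B)

    Solution : ℚ → Set
    Solution ε = ∃[ t ] ∃[ M ] (∀ q → M ℕ.≤ q →
      ∣ cosSeries q t - - ½ ∣ ≤ℚ ε × ∣ sinSeries q t * sinSeries q t - + 1 / 4 ∣ ≤ℚ ε)

    solution-at : ∀ {ε h p} N → 0ℚ ≤ℚ h → h ≤ℚ 1ℚ → fromℕ (ℕ.suc N) * h ≡ T → Z * h ≤ℚ ε →
                  K ℕ.≤ p → majorant p ≤ℚ h → Solution ε
    solution-at {ε} {h} {p} N 0≤h h≤1 node-N Zh≤ε K≤p m≤h =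
      weakened (solution 0≤h h≤1 {p} m≤h {ℕ.suc N} node-N K≤p)
      where
      weakened : ∃[ t ] (∀ q → ℕ.suc p ℕ.≤ q →
                   ∣ cosSeries q t - - ½ ∣ ≤ℚ (D + 1ℚ) * h ×
                   ∣ sinSeries q t * sinSeries q t - + 1 / 4 ∣
                     ≤ℚ (1ℚ * (T * L + D * (B + ½)) + (B + B)) * h) → Solution ε
      weakened (t , near) = t , ℕ.suc p , λ q P≤q →
        weaken 0≤h Zh≤ε {∣ cosSeries q t - - ½ ∣} {∣ sinSeries q t * sinSeries q t - + 1 / 4 ∣}
          (proj₁ (near q P≤q)) (proj₂ (near q P≤q))

    solution-for : ∀ {ε h} N → 0ℚ < h → h ≤ℚ 1ℚ → fromℕ (ℕ.suc N) * h ≡ T → Z * h ≤ℚ ε → Solution ε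
    solution-for {ε} {h} N 0<h h≤1 node-N Zh≤ε =
      for-p (halving-null majorant K majorant-nonNeg majorant-halves h 0<h)
      where
      for-p : ∃[ p ] K ℕ.≤ p × majorant p + majorant p < h → Solution ε
      for-p (p , K≤p , 2m<h) = solution-at {ε} {h} {p} N (ℚ.<⇒≤ 0<h) h≤1 node-N Zh≤ε K≤p
        (ℚ.≤-trans (≤-by {majorant p} (majorant p) (majorant-nonNeg p) refl) (ℚ.<⇒≤ 2m<h))

    approximate-solution : ∀ {ε} → 0ℚ < ε → ∃[ t ] ∃[ M ] (∀ q → M ℕ.≤ q →
      ∣ cosSeries q t - - ½ ∣ ≤ℚ ε × ∣ sinSeries q t * sinSeries q t - + 1 / 4 ∣ ≤ℚ ε)
    approximate-solution {ε} 0<ε = for-N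
      (vanishing {Z * T} (*-nonNeg (+-nonNeg 0≤Z₁ 0≤Z₂) (ℚ.<⇒≤ 0<T)) 0<ε)
      (vanishing {T} (ℚ.<⇒≤ 0<T) (ℚ.positive⁻¹ 1ℚ))
      where
      for-N : ∃[ N₁ ] (∀ n → N₁ ℕ.≤ n → Z * T * 1/1+ n ≤ℚ ε) →
              ∃[ N₂ ] (∀ n → N₂ ℕ.≤ n → T * 1/1+ n ≤ℚ 1ℚ) → Solution ε
      -- The mesh T/(N+1) places node N + 1 exactly at T.
      for-N (N₁ , fine) (N₂ , short) = solution-for {ε} {T * 1/1+ N} N
        (*-pos 0<T (1/1+-pos N)) (short N (ℕ.m≤n⊔m N₁ N₂))
        (trans (solve 3 (λ n T u → n :* (T :* u) := T :* (n :* u)) refl (fromℕ (ℕ.suc N)) T (1/1+ N))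
          (trans (cong (T *_) (1+*1/1+ N)) (ℚ.*-identityʳ T)))
        (subst (_≤ℚ ε) (ℚ.*-assoc Z T (1/1+ N)) (fine N (ℕ.m≤m⊔n N₁ N₂)))
        where
        N : ℕ
        N = N₁ ℕ.⊔ N₂

abstract
  -- At 3/2 the angle is about 2.6, between 2π/3 and π, with cosine about -0.86. Although 6T = 9,
  -- `K` is 12, so that the tail bound 2 · 4.5^12/12!, about 0.29, fits into the gap down from -1/2.
  cos-crossed : ∀ P → 12 ℕ.≤ P → cosSeries P (+ 3 / 2) ≤ℚ - ½
  cos-crossed P 12≤P = begin
    y                                            ≡⟨ solve 2 (λ x y → y := x :+ (y :- x)) refl x y ⟩
    x + (y - x)                                  ≤⟨ ℚ.+-monoʳ-≤ x (ℚ.≤-trans (p≤∣p∣ (y - x))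
      (series-tail cosCoeff-tempered (ℚ.nonNegative⁻¹ (+ 3 / 2)) ℚ.≤-refl ℕ.≤-refl 12≤P)) ⟩
    x + (majorant 12 + majorant 12)              ≤⟨ from-yes (x + (majorant 12 + majorant 12) ℚ.≤? - ½) ⟩
    - ½                                          ∎
    where
    open ℚ.≤-Reasoning
    open Majorant (+ 3 / 2) (ℚ.nonNegative⁻¹ (+ 3 / 2)) 12 (from-yes (three * (+ 3 / 2) + three * (+ 3 / 2) ℚ.≤? fromℕ 12))
    x y : ℚ
    x = cosSeries 12 (+ 3 / 2)
    y = cosSeries P (+ 3 / 2)

  solve-cos≈-½ : ∀ {ε} → 0ℚ < ε → ∃[ t ] ∃[ M ] (∀ q → M ℕ.≤ q →
    ∣ cosSeries q t - - ½ ∣ ≤ℚ ε × ∣ sinSeries q t * sinSeries q t - + 1 / 4 ∣ ≤ℚ ε)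
  solve-cos≈-½ = Crossing.approximate-solution (+ 3 / 2) (ℚ.positive⁻¹ (+ 3 / 2)) 12
    (from-yes (three * (+ 3 / 2) + three * (+ 3 / 2) ℚ.≤? fromℕ 12)) cos-crossed

-- The exponential of K₁,₃

module ℚ-Sum = Sum ℚ.+-0-commutativeMonoid

abstract
  sum≡ℚ-sum : ∀ {n} (x : Vector ℚ n) → sum x ≡ ℚ-Sum.sum x
  sum≡ℚ-sum x = refl

  sum-permute : ∀ {n} (f : Fin n ↔ Fin 4) (x : Vector ℚ 4) → sum (x ∘ Inverse.to f) ≡ sum x
  sum-permute f x = trans (sum≡ℚ-sum (x ∘ Inverse.to f))
    (trans (sym (ℚ-Sum.sum-permute x f)) (sym (sum≡ℚ-sum x)))

  sum-scale : ∀ {n} q (x : Vector ℚ n) → sum (λ i → q * x i) ≡ q * sum x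
  sum-scale {ℕ.zero}  q x = sym (ℚ.*-zeroʳ q)
  sum-scale {ℕ.suc n} q x = trans (cong (λ s → q * x zero + s) (sum-scale q (x ∘ suc)))
    (sym (ℚ.*-distribˡ-+ q (x zero) (sum (x ∘ suc))))

  sum-+ : ∀ {n} (x y : Vector ℚ n) → sum (λ i → x i + y i) ≡ sum x + sum y
  sum-+ {ℕ.zero}  x y = refl
  sum-+ {ℕ.suc n} x y = trans (cong (λ s → (x zero + y zero) + s) (sum-+ (x ∘ suc) (y ∘ suc)))
    (solve 4 (λ a b c d → (a :+ b) :+ (c :+ d) := (a :+ c) :+ (b :+ d)) refl
      (x zero) (y zero) (sum (x ∘ suc)) (sum (y ∘ suc)))

-- A is the adjacency matrix of K₁,₃, Q = A²/3 the projection onto its row space and R = I − Q.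
A Q R : Fin 4 → Fin 4 → ℚ
A i j = if adj K₁,₃ i j then 1ℚ else 0ℚ
Q zero    zero    = 1ℚ
Q (suc _) (suc _) = + 1 / 3
Q _       _       = 0ℚ
R i j = (if does (i ≟ j) then 1ℚ else 0ℚ) - Q i j

abstract
  A*A : ∀ i j → sum (λ k → A i k * A k j) ≡ three * Q i j
  A*A = from-yes (Fin.all? λ i → Fin.all? λ j → sum (λ k → A i k * A k j) ℚ.≟ three * Q i j)

  A*Q : ∀ i j → sum (λ k → A i k * Q k j) ≡ A i j
  A*Q = from-yes (Fin.all? λ i → Fin.all? λ j → sum (λ k → A i k * Q k j) ℚ.≟ A i j)

  A*R : ∀ i j → sum (λ k → A i k * R k j) ≡ 0ℚ
  A*R = from-yes (Fin.all? λ i → Fin.all? λ j → sum (λ k → A i k * R k j) ℚ.≟ 0ℚ)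

  R-½Q-square : ∀ i j → (R i j - ½ * Q i j) * (R i j - ½ * Q i j) + + 1 / 4 * (A i j * A i j) ≡ + 1 / 4
  R-½Q-square = from-yes (Fin.all? λ i → Fin.all? λ j →
    (R i j - ½ * Q i j) * (R i j - ½ * Q i j) + + 1 / 4 * (A i j * A i j) ℚ.≟ + 1 / 4)

  ∣R-½Q∣≤1 : ∀ i j → ∣ R i j - ½ * Q i j ∣ ≤ℚ 1ℚ
  ∣R-½Q∣≤1 = from-yes (Fin.all? λ i → Fin.all? λ j → ∣ R i j - ½ * Q i j ∣ ℚ.≤? 1ℚ)

  ∣Q∣≤1 : ∀ i j → ∣ Q i j ∣ ≤ℚ 1ℚ
  ∣Q∣≤1 = from-yes (Fin.all? λ i → Fin.all? λ j → ∣ Q i j ∣ ℚ.≤? 1ℚ)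

  ∣A*A∣≤1 : ∀ i j → ∣ A i j * A i j ∣ ≤ℚ 1ℚ
  ∣A*A∣≤1 = from-yes (Fin.all? λ i → Fin.all? λ j → ∣ A i j * A i j ∣ ℚ.≤? 1ℚ)

  identity-entry : ∀ i j → R i j + Q i j ≡ (if does (i ≟ j) then 1ℚ else 0ℚ)
  identity-entry i j = solve 2 (λ d q → (d :- q) :+ q := d) refl (if does (i ≟ j) then 1ℚ else 0ℚ) (Q i j)

module _ {n : ℕ} (M N : Matrix n) (u v : Fin n) (p : ℕ) (a x y : Vector ℚ n)
         (re-M : ∀ w → seq (re (M u w)) p ≡ 0ℚ) (im-M : ∀ w → seq (im (M u w)) p ≡ a w)
         (re-N : ∀ w → seq (re (N w v)) p ≡ x w) (im-N : ∀ w → seq (im (N w v)) p ≡ y w) where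

  abstract
    imaginary-⊗-re : seq (re ((M ⊗ N) u v)) p ≡ sum (λ w → - (a w * y w))
    imaginary-⊗-re = trans (seq-re-∑ p (λ w → M u w *ᶜ N w v)) (sum-cong (λ w → trans
      (cong₂ _+_ (cong₂ _*_ (re-M w) (re-N w)) (cong -_ (cong₂ _*_ (im-M w) (im-N w))))
      (solve 2 (λ x z → con 0ℚ :* x :+ z := z) refl (x w) (- (a w * y w)))))

    imaginary-⊗-im : seq (im ((M ⊗ N) u v)) p ≡ sum (λ w → a w * x w)
    imaginary-⊗-im = trans (seq-im-∑ p (λ w → M u w *ᶜ N w v)) (sum-cong (λ w → trans
      (cong₂ _+_ (cong₂ _*_ (re-M w) (im-N w)) (cong₂ _*_ (im-M w) (re-N w)))
      (solve 2 (λ y z → con 0ℚ :* y :+ z := z) refl (y w) (a w * x w))))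

abstract
  -- Subtracting the exact identity for c = -1/2, s² = 1/4 leaves multiples of c + 1/2 and of s² -
  -- 1/4. Entries bounded by 1 and ε ≤ 1 give the factors 3 and 1, hence 4.
  square-near-¼ : ∀ i j {c s ε} → ∣ c - - ½ ∣ ≤ℚ ε → ε ≤ℚ 1ℚ → ∣ s * s - + 1 / 4 ∣ ≤ℚ ε →
    ∣ ((R i j + c * Q i j) * (R i j + c * Q i j) + (s * A i j) * (s * A i j)) + - (+ 1 / 4) ∣ ≤ℚ fromℕ 4 * ε
  square-near-¼ i j {c} {s} {ε} c-near ε≤1 s-near = begin
    ∣ ((r + c * q) * (r + c * q) + (s * a) * (s * a)) + - (+ 1 / 4) ∣
      ≡⟨ cong ∣_∣ (trans
           (cong (λ z → ((r + c * q) * (r + c * q) + (s * a) * (s * a)) + - z) (sym (R-½Q-square i j)))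
           (solve 5 (λ r q a c s →
             ((r :+ c :* q) :* (r :+ c :* q) :+ (s :* a) :* (s :* a))
               :+ :- ((r :- con ½ :* q) :* (r :- con ½ :* q) :+ con (+ 1 / 4) :* (a :* a))
             := (c :- con (- ½)) :* (q :* ((r :- con ½ :* q) :+ (r :- con ½ :* q) :+ (c :- con (- ½)) :* q))
               :+ (s :* s :- con (+ 1 / 4)) :* (a :* a)) refl r q a c s)) ⟩
    ∣ d * (q * (m + m + d * q)) + (s * s - + 1 / 4) * (a * a) ∣
      ≤⟨ ∣+∣≤ {d * (q * (m + m + d * q))} {(s * s - + 1 / 4) * (a * a)}
           (∣*∣≤ {d} {q * (m + m + d * q)} c-near (∣*∣≤ {q} {m + m + d * q} (∣Q∣≤1 i j)
             (∣+∣≤ {m + m} {d * q} (∣+∣≤ {m} {m} (∣R-½Q∣≤1 i j) (∣R-½Q∣≤1 i j))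
               (∣*∣≤ {d} {q} (ℚ.≤-trans c-near ε≤1) (∣Q∣≤1 i j)))))
           (∣*∣≤ {s * s - + 1 / 4} {a * a} s-near (∣A*A∣≤1 i j)) ⟩
    ε * (1ℚ * (1ℚ + 1ℚ + 1ℚ * 1ℚ)) + ε * 1ℚ
      ≡⟨ solve 1 (λ e → e :* (con 1ℚ :* (con 1ℚ :+ con 1ℚ :+ con 1ℚ :* con 1ℚ)) :+ e :* con 1ℚ := con (fromℕ 4) :* e) refl ε ⟩
    fromℕ 4 * ε ∎
    where
    open ℚ.≤-Reasoning
    r q a d m : ℚ
    r = R i j
    q = Q i j
    a = A i j
    d = c - - ½
    m = r - ½ * q

  normSq-near : ∀ z p {x y b} → seq (re z) p ≡ x → seq (im z) p ≡ y →
                ∣ (x * x + y * y) + - (+ 1 / 4) ∣ ≤ℚ b → ∣ normSq z p + - (+ 1 / 4) ∣ ≤ℚ b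
  normSq-near z p refl refl h = h

unit₀ : ℕ → ℚ
unit₀ ℕ.zero    = 1ℚ
unit₀ (ℕ.suc _) = 0ℚ

abstract
  𝕚-scaled-entry : ∀ t b p → seq (re ((𝕚 *ᶜ fromℝ (fromℚ t)) *ᶜ (if b then 1ᶜ else 0ᶜ))) p ≡ 0ℚ ×
                   seq (im ((𝕚 *ᶜ fromℝ (fromℚ t)) *ᶜ (if b then 1ᶜ else 0ᶜ))) p ≡ t * (if b then 1ℚ else 0ℚ)
  𝕚-scaled-entry t true p =
    solve 1 (λ t → (con 0ℚ :* t :+ :- (con 1ℚ :* con 0ℚ)) :* con 1ℚ :+ :- ((con 0ℚ :* con 0ℚ :+ con 1ℚ :* t) :* con 0ℚ)
      := con 0ℚ) refl t ,
    solve 1 (λ t → (con 0ℚ :* t :+ :- (con 1ℚ :* con 0ℚ)) :* con 0ℚ :+ (con 0ℚ :* con 0ℚ :+ con 1ℚ :* t) :* con 1ℚ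
      := t :* con 1ℚ) refl t
  𝕚-scaled-entry t false p =
    solve 1 (λ t → (con 0ℚ :* t :+ :- (con 1ℚ :* con 0ℚ)) :* con 0ℚ :+ :- ((con 0ℚ :* con 0ℚ :+ con 1ℚ :* t) :* con 0ℚ)
      := con 0ℚ) refl t ,
    solve 1 (λ t → (con 0ℚ :* t :+ :- (con 1ℚ :* con 0ℚ)) :* con 0ℚ :+ (con 0ℚ :* con 0ℚ :+ con 1ℚ :* t) :* con 0ℚ
      := t :* con 0ℚ) refl t

  scaled-adjacency-re : ∀ {n} (G : Graph n) t p u v →
    seq (re (((𝕚 *ᶜ fromℝ (fromℚ t)) · adjacency G) u v)) p ≡ 0ℚ
  scaled-adjacency-re G t p u v = proj₁ (𝕚-scaled-entry t (adj G u v) p)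

  scaled-adjacency-im : ∀ {n} (G : Graph n) (G≅K : G ≅ K₁,₃) t p u v →
    seq (im (((𝕚 *ᶜ fromℝ (fromℚ t)) · adjacency G) u v)) p ≡
    t * A (Inverse.to (proj₁ G≅K) u) (Inverse.to (proj₁ G≅K) v)
  scaled-adjacency-im G G≅K t p u v = trans (proj₂ (𝕚-scaled-entry t (adj G u v) p))
    (cong (λ b → t * (if b then 1ℚ else 0ℚ)) (proj₂ G≅K u v))

module StarExponential {n : ℕ} (π : Fin n ↔ Fin 4) (t : ℚ) (M : Matrix n)
  (M-re : ∀ p u v → seq (re (M u v)) p ≡ 0ℚ)
  (M-im : ∀ p u v → seq (im (M u v)) p ≡ t * A (Inverse.to π u) (Inverse.to π v)) where

  f : Fin n → Fin 4
  f = Inverse.to π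

  -- The powers of itA. As A R = 0, the matrix R survives only in the power 0, where R + Q is the
  -- identity; then A Q = A and A² = 3Q make the powers alternate between multiples of A and of Q.
  powerRe powerIm : ℕ → Fin 4 → Fin 4 → ℚ
  powerRe k i j = t ^ℚ k * (unit₀ k * R i j + cosCoeff k * Q i j)
  powerIm k i j = t ^ℚ k * (sinCoeff k * A i j)

  abstract
    does-≟-to : ∀ u v → does (u ≟ v) ≡ does (f u ≟ f v)
    does-≟-to u v with u ≟ v
    ... | yes u≡v = sym (dec-true (f u ≟ f v) (cong f u≡v))
    ... | no  u≢v = sym (dec-false (f u ≟ f v) (u≢v ∘ Injection.injective (↔⇒↣ π)))

    if-re : ∀ p b → seq (re (if b then 1ᶜ else 0ᶜ)) p ≡ (if b then 1ℚ else 0ℚ)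
    if-re p true  = refl
    if-re p false = refl

    if-im : ∀ p b → seq (im (if b then 1ᶜ else 0ᶜ)) p ≡ 0ℚ
    if-im p true  = refl
    if-im p false = refl

    powerRe-suc : ∀ k i j → sum (λ l → - (t * A i l * powerIm k l j)) ≡ powerRe (ℕ.suc k) i j
    powerRe-suc k i j = begin
      sum (λ l → - (t * A i l * powerIm k l j))
        ≡⟨ sum-cong (λ l → solve 5 (λ t a w s b → :- (t :* a :* (w :* (s :* b))) := :- (t :* w :* s) :* (a :* b))
             refl t (A i l) (t ^ℚ k) (sinCoeff k) (A l j)) ⟩
      sum (λ l → - (t * t ^ℚ k * sinCoeff k) * (A i l * A l j))
        ≡⟨ sum-scale (- (t * t ^ℚ k * sinCoeff k)) (λ l → A i l * A l j) ⟩
      - (t * t ^ℚ k * sinCoeff k) * sum (λ l → A i l * A l j)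
        ≡⟨ cong (- (t * t ^ℚ k * sinCoeff k) *_) (A*A i j) ⟩
      - (t * t ^ℚ k * sinCoeff k) * (three * Q i j)
        ≡⟨ solve 6 (λ t w s c q r → :- (t :* w :* s) :* (c :* q) := t :* w :* (con 0ℚ :* r :+ :- (c :* s) :* q))
             refl t (t ^ℚ k) (sinCoeff k) three (Q i j) (R i j) ⟩
      powerRe (ℕ.suc k) i j ∎
      where open ≡-Reasoning

    powerIm-suc : ∀ k i j → sum (λ l → t * A i l * powerRe k l j) ≡ powerIm (ℕ.suc k) i j
    powerIm-suc k i j = begin
      sum (λ l → t * A i l * powerRe k l j)
        ≡⟨ sum-cong (λ l → solve 7 (λ t a w ι r c q → t :* a :* (w :* (ι :* r :+ c :* q))
               := t :* w :* ι :* (a :* r) :+ t :* w :* c :* (a :* q))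
             refl t (A i l) (t ^ℚ k) (unit₀ k) (R l j) (cosCoeff k) (Q l j)) ⟩
      sum (λ l → x * (A i l * R l j) + y * (A i l * Q l j))
        ≡⟨ sum-+ (λ l → x * (A i l * R l j)) (λ l → y * (A i l * Q l j)) ⟩
      sum (λ l → x * (A i l * R l j)) + sum (λ l → y * (A i l * Q l j))
        ≡⟨ cong₂ _+_ (sum-scale x (λ l → A i l * R l j)) (sum-scale y (λ l → A i l * Q l j)) ⟩
      x * sum (λ l → A i l * R l j) + y * sum (λ l → A i l * Q l j)
        ≡⟨ cong₂ (λ r q → x * r + y * q) (A*R i j) (A*Q i j) ⟩
      x * 0ℚ + y * A i j
        ≡⟨ solve 5 (λ x t w c a → x :* con 0ℚ :+ t :* w :* c :* a := t :* w :* (c :* a))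
             refl x t (t ^ℚ k) (cosCoeff k) (A i j) ⟩
      powerIm (ℕ.suc k) i j ∎
      where
      open ≡-Reasoning
      x y : ℚ
      x = t * t ^ℚ k * unit₀ k
      y = t * t ^ℚ k * cosCoeff k

    power-re : ∀ p k u v → seq (re ((M ^ᴹ k) u v)) p ≡ powerRe k (f u) (f v)
    power-im : ∀ p k u v → seq (im ((M ^ᴹ k) u v)) p ≡ powerIm k (f u) (f v)

    power-re p ℕ.zero u v = begin
      seq (re (basis u v)) p                              ≡⟨ if-re p (does (u ≟ v)) ⟩
      (if does (u ≟ v) then 1ℚ else 0ℚ)                   ≡⟨ cong (λ b → if b then 1ℚ else 0ℚ) (does-≟-to u v) ⟩
      (if does (f u ≟ f v) then 1ℚ else 0ℚ)               ≡⟨ identity-entry (f u) (f v) ⟨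
      R (f u) (f v) + Q (f u) (f v)                       ≡⟨ solve 2 (λ r q → r :+ q := con 1ℚ :* (con 1ℚ :* r :+ con 1ℚ :* q))
                                                               refl (R (f u) (f v)) (Q (f u) (f v)) ⟩
      powerRe 0 (f u) (f v)                               ∎
      where open ≡-Reasoning
    power-re p (ℕ.suc k) u v = trans
      (imaginary-⊗-re M (M ^ᴹ k) u v p (λ w → t * A (f u) (f w)) (λ w → powerRe k (f w) (f v)) (λ w → powerIm k (f w) (f v))
        (M-re p u) (M-im p u) (λ w → power-re p k w v) (λ w → power-im p k w v))
      (trans (sum-permute π (λ l → - (t * A (f u) l * powerIm k l (f v)))) (powerRe-suc k (f u) (f v)))

    power-im p ℕ.zero u v = trans (if-im p (does (u ≟ v)))
      (solve 1 (λ a → con 0ℚ := con 1ℚ :* (con 0ℚ :* a)) refl (A (f u) (f v)))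
    power-im p (ℕ.suc k) u v = trans
      (imaginary-⊗-im M (M ^ᴹ k) u v p (λ w → t * A (f u) (f w)) (λ w → powerRe k (f w) (f v)) (λ w → powerIm k (f w) (f v))
        (M-re p u) (M-im p u) (λ w → power-re p k w v) (λ w → power-im p k w v))
      (trans (sum-permute π (λ l → t * A (f u) l * powerRe k l (f v))) (powerIm-suc k (f u) (f v)))

    -- R comes from the term of degree 0 alone, so the formula needs at least one term.
    partial-re : ∀ p q u v → seq (re (expPartial M (ℕ.suc q) u v)) p ≡
                 R (f u) (f v) + cosSeries (ℕ.suc q) t * Q (f u) (f v)
    partial-re p ℕ.zero u v = trans
      (cong (λ x → 0ℚ + (1ℚ * x + - (0ℚ * seq (im (basis u v)) p))) (power-re p 0 u v))
      (solve 3 (λ r q y → con 0ℚ :+ (con 1ℚ :* (con 1ℚ :* (con 1ℚ :* r :+ con 1ℚ :* q)) :+ :- (con 0ℚ :* y))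
          := r :+ (con 0ℚ :+ con 1ℚ :* (con 1ℚ :* con 1ℚ)) :* q)
        refl (R (f u) (f v)) (Q (f u) (f v)) (seq (im (basis u v)) p))
    partial-re p (ℕ.suc q) u v = trans
      (cong₂ (λ x y → x + (1/ ℕ.suc q ! * y + - (0ℚ * seq (im ((M ^ᴹ ℕ.suc q) u v)) p)))
        (partial-re p q u v) (power-re p (ℕ.suc q) u v))
      (solve 7 (λ r q c g w d y → (r :+ c :* q) :+ (g :* (w :* (con 0ℚ :* r :+ d :* q)) :+ :- (con 0ℚ :* y))
          := r :+ (c :+ d :* (g :* w)) :* q)
        refl (R (f u) (f v)) (Q (f u) (f v)) (cosSeries (ℕ.suc q) t) (1/ ℕ.suc q !) (t ^ℚ ℕ.suc q)
          (cosCoeff (ℕ.suc q)) (seq (im ((M ^ᴹ ℕ.suc q) u v)) p))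

    partial-im : ∀ p q u v → seq (im (expPartial M q u v)) p ≡ sinSeries q t * A (f u) (f v)
    partial-im p ℕ.zero    u v = sym (ℚ.*-zeroˡ (A (f u) (f v)))
    partial-im p (ℕ.suc q) u v = trans
      (cong₂ (λ x y → x + (1/ q ! * y + 0ℚ * seq (re ((M ^ᴹ q) u v)) p))
        (partial-im p q u v) (power-im p q u v))
      (solve 6 (λ a s g w d y → s :* a :+ (g :* (w :* (d :* a)) :+ con 0ℚ :* y) := (s :+ d :* (g :* w)) :* a)
        refl (A (f u) (f v)) (sinSeries q t) (1/ q !) (t ^ℚ q) (sinCoeff q) (seq (re ((M ^ᴹ q) u v)) p))

    exp-re : ∀ q u v → seq (re (exp M u v)) (ℕ.suc q) ≡ R (f u) (f v) + cosSeries (ℕ.suc q) t * Q (f u) (f v)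
    exp-re q u v = partial-re (ℕ.suc q) q u v

    exp-im : ∀ q u v → seq (im (exp M u v)) (ℕ.suc q) ≡ sinSeries (ℕ.suc q) t * A (f u) (f v)
    exp-im q u v = partial-im (ℕ.suc q) (ℕ.suc q) u v

    exp-near : ∀ {ε m} → ε ≤ℚ 1ℚ →
      (∀ q → m ℕ.≤ q → ∣ cosSeries q t - - ½ ∣ ≤ℚ ε × ∣ sinSeries q t * sinSeries q t - + 1 / 4 ∣ ≤ℚ ε) →
      ∀ p → ℕ.suc m ℕ.≤ p → ∀ u v → ∣ normSq (exp M u v) p + - (+ 1 / 4) ∣ ≤ℚ fromℕ 4 * ε
    exp-near ε≤1 near (ℕ.suc q) m<1+q u v = normSq-near (exp M u v) (ℕ.suc q) (exp-re q u v) (exp-im q u v)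
      (square-near-¼ (f u) (f v) {cosSeries (ℕ.suc q) t} {sinSeries (ℕ.suc q) t} (proj₁ (near (ℕ.suc q) (ℕ.<⇒≤ m<1+q))) ε≤1 (proj₂ (near (ℕ.suc q) (ℕ.<⇒≤ m<1+q))))

-- Uniform mixing on the star

abstract
  ∣∣≤⇒square≤ : ∀ {x η} → ∣ x ∣ ≤ℚ η → x * x ≤ℚ η * η
  ∣∣≤⇒square≤ {x} ∣x∣≤η = ℚ.≤-trans (p≤∣p∣ (x * x)) (∣*∣≤ {x} {x} ∣x∣≤η ∣x∣≤η)

  near⇒‖‖< : ∀ {n} (V : Matrix n) u c {η δ ε} → 0ℚ ≤ℚ η → 0ℚ < δ →
    ∃[ N ] (∀ p → N ℕ.≤ p → fromℕ n * η + δ ≤ℚ seq ε p) →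
    ∃[ M ] (∀ p → M ℕ.≤ p → ∀ j → ∣ normSq (V j u) p + - c ∣ ≤ℚ η) →
    ‖ ((V ⊡ basis u) ∘ᵛ (conjᴹ V ⊡ basis u)) -ᵛ constant (fromℝ (fromℚ c)) ‖ <ᴿ ε
  near⇒‖‖< V u c {η} {δ} {ε} 0≤η 0<δ below (M , near) =
    normSq-bounded⇒‖‖< (((V ⊡ basis u) ∘ᵛ (conjᴹ V ⊡ basis u)) -ᵛ constant (fromℝ (fromℚ c))) {η} {δ} {ε} 0≤η 0<δ below
      (M , λ p M≤p j → subst (_≤ℚ η * η)
        (sym (trans (cong₂ (λ x y → x * x + y * y) (defect-re V u c j p) (defect-im V u c j p))
          (ℚ.+-identityʳ ((normSq (V j u) p + - c) * (normSq (V j u) p + - c)))))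
        (∣∣≤⇒square≤ {normSq (V j u) p + - c} (near p M≤p j)))

  -- Besides being small, ε is kept at most 1, as the estimate of squared moduli replaces a
  -- quadratic term in ε by a linear one.
  room : ∀ {c d} → 0ℚ < c → 0ℚ < d → ∃[ ε ] 0ℚ < ε × ε ≤ℚ 1ℚ × c * ε ≤ℚ d
  room {c} {d} 0<c 0<d with divide 0<c 0<d
  ... | ε , 0<ε , cε≡d with ℚ.≤-total ε 1ℚ
  ...   | inj₁ ε≤1 = ε , 0<ε , ε≤1 , ℚ.≤-reflexive cε≡d
  ...   | inj₂ 1≤ε = 1ℚ , ℚ.positive⁻¹ 1ℚ , ℚ.≤-refl ,
    ℚ.≤-trans (ℚ.*-monoˡ-≤-nonNeg c {{ℚ.nonNegative (ℚ.<⇒≤ 0<c)}} 1≤ε) (ℚ.≤-reflexive cε≡d)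

  entry-near : ∀ {n} (G : Graph n) → G ≅ K₁,₃ → ∀ {ε t m} → ε ≤ℚ 1ℚ →
    (∀ q → m ℕ.≤ q → ∣ cosSeries q t - - ½ ∣ ≤ℚ ε × ∣ sinSeries q t * sinSeries q t - + 1 / 4 ∣ ≤ℚ ε) →
    ∀ p → ℕ.suc m ℕ.≤ p → ∀ u v → ∣ normSq (U G (fromℚ t) u v) p + - (+ 1 / 4) ∣ ≤ℚ fromℕ 4 * ε
  entry-near G (π , adj≡) {ε} {t} {m} ε≤1 near p m<p u v =
    StarExponential.exp-near π t ((𝕚 *ᶜ fromℝ (fromℚ t)) · adjacency G)
      (scaled-adjacency-re G t) (scaled-adjacency-im G (π , adj≡) t) {ε} {m} ε≤1 near p m<p u v

  star-mixing-within : (G : Graph 4) → G ≅ K₁,₃ → ∀ {c} → c ≡ + 1 / 4 → ∀ ε → 0ᴿ <ᴿ ε → MixingWithin G c ε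
  star-mixing-within G G≅K {c} c≡¼ ε (δ , 0<δ , N , 0+δ≤ε) =
    -- One factor 4 comes from the squared moduli, the other from the crude norm bound on four
    -- coordinates. Half of δ is left as the margin of strictness.
    for-ε₀ (room {fromℕ 4 * fromℕ 4} (*-pos (ℚ.positive⁻¹ (fromℕ 4)) (ℚ.positive⁻¹ (fromℕ 4))) (½-pos 0<δ))
    where
    for-t : ∀ {ε₀} → 0ℚ < ε₀ → ε₀ ≤ℚ 1ℚ → (fromℕ 4 * fromℕ 4) * ε₀ ≤ℚ ½ * δ →
      ∃[ t ] ∃[ M ] (∀ q → M ℕ.≤ q →
        ∣ cosSeries q t - - ½ ∣ ≤ℚ ε₀ × ∣ sinSeries q t * sinSeries q t - + 1 / 4 ∣ ≤ℚ ε₀) →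
      MixingWithin G c ε
    for-t {ε₀} 0<ε₀ ε₀≤1 16ε₀≤ (t , M , near) = fromℚ t , λ u →
      near⇒‖‖< {4} (U G (fromℚ t)) u c {fromℕ 4 * ε₀} {½ * δ} {ε} (*-nonNeg (fromℕ-nonNeg 4) (ℚ.<⇒≤ 0<ε₀)) (½-pos 0<δ)
        (N , λ p N≤p → ℚ.≤-trans
          (ℚ.+-monoˡ-≤ (½ * δ) (ℚ.≤-trans (ℚ.≤-reflexive (sym (ℚ.*-assoc (fromℕ 4) (fromℕ 4) ε₀))) 16ε₀≤))
          (ℚ.≤-trans (ℚ.≤-reflexive (trans (½+½ δ) (sym (ℚ.+-identityˡ δ)))) (0+δ≤ε p N≤p)))
        (ℕ.suc M , λ p 1+M≤p j → subst (λ c → ∣ normSq (U G (fromℚ t) j u) p + - c ∣ ≤ℚ fromℕ 4 * ε₀)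
          (sym c≡¼) (entry-near G G≅K {ε₀} {t} {M} ε₀≤1 near p 1+M≤p j u))
    for-ε₀ : ∃[ ε₀ ] 0ℚ < ε₀ × ε₀ ≤ℚ 1ℚ × (fromℕ 4 * fromℕ 4) * ε₀ ≤ℚ ½ * δ → MixingWithin G c ε
    for-ε₀ (ε₀ , 0<ε₀ , ε₀≤1 , 16ε₀≤) = for-t 0<ε₀ ε₀≤1 16ε₀≤ (solve-cos≈-½ 0<ε₀)

  within⇒mixing : ∀ {n} .{{_ : NonZero n}} (G : Graph n) →
    (∀ {c} → c ≡ + 1 / n → ∀ ε → 0ᴿ <ᴿ ε → MixingWithin G c ε) → EpsilonUniformMixing G
  within⇒mixing G within ε 0<ε = within refl ε 0<ε

star-mixing : ∀ {n} → n ≡ 4 → .{{_ : NonZero n}} → (G : Graph n) → G ≅ K₁,₃ → EpsilonUniformMixing G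
star-mixing refl {{nz}} G G≅K = within⇒mixing {4} {{nz}} G (λ {c} c≡¼ → star-mixing-within G G≅K {c} c≡¼)

-- The trees on one and two vertices have no vertex of degree two and also mix uniformly, K₂ at time
-- π/4; `3 ≤ n` sets them aside.
corollary28 : ∀ (n : ℕ) .{{_ : NonZero n}} → 3 ≤ n → (G : Graph n) →
    (IsTree G × NoDegreeTwoVertex G × EpsilonUniformMixing G) ⇔ (G ≅ K₁,₃)
corollary28 n {{nz}} 3≤n G = mk⇔
  (λ { (tree , deg≢2 , mixing) →
       let fork = tree⇒fork G 3≤n tree deg≢2
       in fork⇒≅K₁,₃ G (fork⇒n≤4 {n} {{nz}} G fork mixing) fork })
  (λ G≅K → ≅⇒isTree G G≅K , ≅⇒noDegreeTwoVertex G G≅K , star-mixing (↔⇒≡ (proj₁ G≅K)) {{nz}} G G≅K)
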